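{- For every integer $n\geq 1$ there exists an integer $a$ with $n^2<a<(n+1)^2$ and $\Omega(a)\leq 4$.
   Context: $\Omega(a)$ denotes the number of prime factors of the positive integer $a$, counted with multiplicity. -}

module Defs where

open import Data.Nat using (ℕ)
open import Data.List using (List; length)
open import Data.Nat.ListAction using (product)
open import Data.List.Relation.Unary.All using (All)
open import Data.Nat.Primality using (Prime)
open import Data.Product using (Σ; _×_)
open import Relation.Binary.PropositionalEquality using (_≡_)

-- Ω a k : the positive integer a has exactly k prime factors counted with
-- multiplicity, i.e. a is the product of a list of k primes.
-- (By unique factorisation, for a ≥ 1 there is exactly one such k.)
Ω : ℕ → ℕ → Set
Ω a k = Σ (List ℕ) λ ps → All Prime ps × product ps ≡ a × length ps ≡ k

module Submission where

-- A weighted sieve in the manner of Selberg and Kuhn.  Let y = 2^(Y+1) be the least power of 2 with y³ ≥ (n+1)².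
-- Put W(a) = Σ_{7<p<y} ([p ∣ a] + 2[p² ∣ a]).  If a < (n+1)² is prime to 210 and W(a) < 3, then a has at most
-- two prime factors below y, and at most two others since y³ > a.  Such an a exists in (n², (n+1)²) as soon as
-- Σ_a f(a)² (3 - W(a)) > 0, summed over the a prime to 210.
-- Take f = Σ_l max(K - s(l), 0) Π_{p∣l} g_p over squarefree l, where s(l) = Σ_{p∣l} ⌊log₂ p⌋ and the g_p are
-- orthogonal of mean zero.  With h(l) = Π_{p∣l} 1/(p-1) and v_l = max(K - s(l), 0), the mean of f² is Σ h(l) v_l²,
-- and that of f² W is at most Σ h(l) Φ(v_l), where Φ(v) = Σ_p (1/p + 2/p²) min(⌊log₂ p⌋, v)²: multiples of p pair
-- l with pl, and only the difference of the two coefficients survives.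
-- The moment inequality Σ h(l) v_l (K - v_l) ≤ Σ h(l) Ψ(v_l) keeps the mass of h away from small v.  Half of it is
-- added to the main term, which then becomes positive pointwise in v.  Both Φ and Ψ are bounded by partial
-- summation from Σ_{7<p<2^(J+1)} ⌊log₂ p⌋ (1/p + 2/p²) ≤ J - 3/4 alone; no lower bound on primes is needed.
-- What remains is an inequality between harmonic numbers and powers of 2: it is evaluated for Y < 239 and
-- follows from H(9g+13) - H(g) ≤ 9/4 beyond.  For n < 2^18 an a without prime factors below 149 is searched for.

open import Defs
open import Data.Nat using (ℕ; zero; suc; _+_; _*_; _∸_; _^_; _≤_; _<_; z≤n; s≤s; NonZero; _≤ᵇ_; _≡ᵇ_; _!)
import Data.Nat as ℕ
open import Data.Nat.Combinatorics using (k![n∸k]!∣n!)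
import Data.Nat.Properties as ℕP
open import Data.Nat.Divisibility using (_∣_; _∣?_; _∤_; divides)
import Data.Nat.Divisibility as ∣P
open import Data.Nat.DivMod using (_/_; _%_)
import Data.Nat.DivMod as DM
open import Data.Nat.Primality using (Prime; prime?; euclidsLemma; prime⇒nonZero; prime⇒nonTrivial)
import Data.Nat.Primality as PrimeP
import Data.Nat.Coprimality as CP
import Data.Integer as ℤ
import Data.Integer.Properties as ℤP
open import Data.Rational using (ℚ; mkℚ; 0ℚ; 1ℚ; ½; ∣_∣; nonNegative; positive) renaming (_+_ to _⊕_; _*_ to _⊗_; _-_ to _⊖_; -_ to ⊝_; _≤_ to _≤ℚ_; _<_ to _<ℚ_)
import Data.Rational as ℚ
import Data.Rational.Properties as ℚP
import Data.Rational.Unnormalised as ℚᵘ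
import Data.Rational.Unnormalised.Properties as ℚᵘP
open import Data.Product using (Σ; Σ-syntax; _×_; _,_; proj₁; proj₂)
open import Data.Sum using (_⊎_; inj₁; inj₂)
open import Data.Empty using (⊥; ⊥-elim)
open import Data.Unit using (tt)
open import Data.Bool using (Bool; true; false; if_then_else_; T)
open import Data.List using (List; []; _∷_; _++_; length; map; filter; applyUpTo)
open import Data.List.Relation.Unary.All using (All; []; _∷_)
import Data.List.Relation.Unary.All as All
import Data.List.Relation.Unary.All.Properties as AllP
open import Data.List.Relation.Unary.AllPairs using ([]; _∷_)
open import Data.List.Relation.Unary.Unique.Propositional using (Unique)
import Data.List.Relation.Unary.Unique.Propositional.Properties as UP
open import Data.List.Relation.Unary.Any using (here; there)
open import Data.List.Membership.Propositional using (_∈_)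
import Data.List.Properties as LP
import Data.List.Membership.Propositional.Properties as MP
open import Data.Nat.Primality.Factorisation using (factorise; PrimeFactorisation)
open import Data.Nat.ListAction using (product)
import Data.Nat.ListAction.Properties as NLP
open import Data.List.Membership.DecPropositional ℕP._≟_ using (_∈?_)
open import Relation.Nullary using (¬_; Dec; yes; no; does)
open import Relation.Nullary.Decidable using (dec⇒maybe; toWitness; True)
open import Relation.Binary.PropositionalEquality using (_≡_; _≢_; refl; sym; trans; cong; cong₂; subst; subst₂)
open import Tactic.RingSolver.Core.AlmostCommutativeRing using (AlmostCommutativeRing; fromCommutativeRing)
open import Tactic.RingSolver using (solve-∀)
import Data.Nat.Tactic.RingSolver as ℕRing

-- Rational arithmetic

-- The parameter K is squeezed from both sides. The weight f has norm about K² 2^K and there are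
-- fewer than 2^Y sieving primes, so the error is about 2^Y 4^K up to powers of K and Y, against
-- roughly 2^(3Y/2) integers in the interval: K must stay below Y/4. On the other side, Φ(v) is
-- about v² (1 + log(Y/v)), which exceeds 3v² as soon as v < Y/e²; hence 3v² - Φ(v) is negative for
-- small v whatever K is, and the moment inequality is indispensable for a pointwise argument. With
-- half of it added, the leading condition is 10v + 4K ≥ 8v log(Y/v). It is tightest at v = K/2,
-- where it says log(2Y/K) ≤ 9/4, that is, K > 0.211 Y. The choice K = 2⌊(Y-5)/9⌋ lies in the window
-- between 0.211 Y and Y/4. Sizes are measured by ⌊log₂ p⌋, so every quantity is rational and
-- harmonic numbers take the place of logarithms.

ℚring : AlmostCommutativeRing _ _
ℚring = fromCommutativeRing ℚP.+-*-commutativeRing (λ x → dec⇒maybe (0ℚ ℚP.≟ x))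

-- ι n = n and iv n = 1/n (with iv 0 = 0), abstract so that open terms do not unfold.
abstract
  ι : ℕ → ℚ
  ι n = mkℚ (ℤ.+ n) 0 (CP.sym (CP.1-coprimeTo n))

  ι-+ : ∀ m n → ι (m + n) ≡ ι m ⊕ ι n
  ι-+ m n = ℚP.toℚᵘ-injective (ℚᵘP.≃-sym (ℚᵘP.≃-trans (ℚP.toℚᵘ-homo-+ (ι m) (ι n))
    (ℚᵘ.*≡* (cong (ℤ._* ℤ.+ 1) (trans (cong₂ ℤ._+_ (ℤP.*-identityʳ (ℤ.+ m)) (ℤP.*-identityʳ (ℤ.+ n))) (sym (ℤP.pos-+ m n)))))))

  ι-* : ∀ m n → ι (m * n) ≡ ι m ⊗ ι n
  ι-* m n = ℚP.toℚᵘ-injective (ℚᵘP.≃-sym (ℚᵘP.≃-trans (ℚP.toℚᵘ-homo-* (ι m) (ι n))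
    (ℚᵘ.*≡* (cong (ℤ._* ℤ.+ 1) (sym (ℤP.pos-* m n))))))

  ι0 : ι 0 ≡ 0ℚ
  ι0 = refl

  ι1 : ι 1 ≡ 1ℚ
  ι1 = refl

  ι-mono-≤ : ∀ {m n} → m ≤ n → ι m ≤ℚ ι n
  ι-mono-≤ {m} {n} le = ℚ.*≤* (ℤP.*-monoʳ-≤-nonNeg (ℤ.+ 1) (ℤ.+≤+ le))

  ι-mono-< : ∀ {m n} → m < n → ι m <ℚ ι n
  ι-mono-< {m} {n} lt = ℚ.*<* (ℤP.*-monoʳ-<-pos (ℤ.+ 1) (ℤ.+<+ lt))

  iv : ℕ → ℚ
  iv zero    = 0ℚ
  iv (suc n) = mkℚ (ℤ.+ 1) n (CP.1-coprimeTo (suc n))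

  ι⊗iv : ∀ n → .{{NonZero n}} → ι n ⊗ iv n ≡ 1ℚ
  ι⊗iv (suc n) = ℚP.toℚᵘ-injective (ℚᵘP.≃-trans (ℚP.toℚᵘ-homo-* (ι (suc n)) (iv (suc n)))
    (ℚᵘ.*≡* (trans (ℤP.*-identityʳ _) (trans (ℤP.*-identityʳ _)
      (sym (trans (ℤP.*-identityˡ _) (cong (λ k → ℤ.+ suc k) (ℕP.+-identityʳ n))))))))

  ι-val : ∀ n → ι n ≡ mkℚ (ℤ.+ n) 0 (CP.sym (CP.1-coprimeTo n))
  ι-val n = refl

  iv-val : ∀ n → iv (suc n) ≡ mkℚ (ℤ.+ 1) n (CP.1-coprimeTo (suc n))
  iv-val n = refl

  0≤iv : ∀ n → 0ℚ ≤ℚ iv n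
  0≤iv zero    = ℚP.≤-refl
  0≤iv (suc n) = ℚ.*≤* (ℤ.+≤+ z≤n)

≤-by : ∀ {a b} r → 0ℚ ≤ℚ r → a ⊕ r ≡ b → a ≤ℚ b
≤-by {a} r 0≤r refl = subst (_≤ℚ a ⊕ r) (ℚP.+-identityʳ a) (ℚP.+-monoʳ-≤ a 0≤r)

0≤⊖ : ∀ {a b} → a ≤ℚ b → 0ℚ ≤ℚ b ⊖ a
0≤⊖ {a} {b} le = subst (_≤ℚ b ⊖ a) (ℚP.+-inverseʳ a) (ℚP.+-monoˡ-≤ (⊝ a) le)

0≤⊕ : ∀ {a b} → 0ℚ ≤ℚ a → 0ℚ ≤ℚ b → 0ℚ ≤ℚ a ⊕ b
0≤⊕ {a} {b} p q = subst (_≤ℚ a ⊕ b) (ℚP.+-identityˡ 0ℚ) (ℚP.+-mono-≤ p q)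

⊗-monoʳ : ∀ {a b c} → 0ℚ ≤ℚ a → b ≤ℚ c → a ⊗ b ≤ℚ a ⊗ c
⊗-monoʳ {a} p q = ℚP.*-monoˡ-≤-nonNeg a {{nonNegative p}} q

⊗-monoˡ : ∀ {a b c} → 0ℚ ≤ℚ a → b ≤ℚ c → b ⊗ a ≤ℚ c ⊗ a
⊗-monoˡ {a} p q = ℚP.*-monoʳ-≤-nonNeg a {{nonNegative p}} q

0≤⊗ : ∀ {a b} → 0ℚ ≤ℚ a → 0ℚ ≤ℚ b → 0ℚ ≤ℚ a ⊗ b
0≤⊗ {a} {b} p q = subst (_≤ℚ a ⊗ b) (ℚP.*-zeroʳ a) (⊗-monoʳ p q)

⊗-mono : ∀ {a b c d} → 0ℚ ≤ℚ a → 0ℚ ≤ℚ d → a ≤ℚ b → c ≤ℚ d → a ⊗ c ≤ℚ b ⊗ d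
⊗-mono pa pd p q = ℚP.≤-trans (⊗-monoʳ pa q) (⊗-monoˡ pd p)

⊗-cancel-≤ : ∀ c {a b} → 0ℚ <ℚ c → c ⊗ a ≤ℚ c ⊗ b → a ≤ℚ b
⊗-cancel-≤ c pc = ℚP.*-cancelˡ-≤-pos c {{positive pc}}

⊗-cancel-< : ∀ c {a b} → 0ℚ <ℚ c → c ⊗ a <ℚ c ⊗ b → a <ℚ b
⊗-cancel-< c pc = ℚP.*-cancelˡ-<-nonNeg c {{nonNegative (ℚP.<⇒≤ pc)}}

⊝-involutive : ∀ a → ⊝ (⊝ a) ≡ a
⊝-involutive = solve-∀ ℚring

∣∣≤ : ∀ {a b} → ⊝ b ≤ℚ a → a ≤ℚ b → ∣ a ∣ ≤ℚ b
∣∣≤ {a} {b} p q with ℚP.∣p∣≡p∨∣p∣≡-p a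
... | inj₁ e = subst (_≤ℚ b) (sym e) q
... | inj₂ e = subst (_≤ℚ b) (sym e) (subst (⊝ a ≤ℚ_) (⊝-involutive b) (ℚP.neg-antimono-≤ p))

∣∣-lower : ∀ {a b} → ∣ a ∣ ≤ℚ b → ⊝ b ≤ℚ a
∣∣-lower {a} {b} h = ℚP.≤-trans (ℚP.neg-antimono-≤ h) lem
  where
  lem : ⊝ ∣ a ∣ ≤ℚ a
  lem with ℚP.∣p∣≡p∨∣p∣≡-p a
  ... | inj₁ e = ℚP.≤-trans (subst (⊝ ∣ a ∣ ≤ℚ_) refl (ℚP.neg-antimono-≤ (ℚP.0≤∣p∣ a))) (subst (0ℚ ≤ℚ_) e (ℚP.0≤∣p∣ a))
  ... | inj₂ e = ℚP.≤-reflexive (trans (cong ⊝_ e) (⊝-involutive a))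

0≤1 : 0ℚ ≤ℚ 1ℚ
0≤1 = ℚP.nonNegative⁻¹ 1ℚ

0≤ι : ∀ n → 0ℚ ≤ℚ ι n
0≤ι n = subst (_≤ℚ ι n) ι0 (ι-mono-≤ z≤n)

0<ι : ∀ n → .{{NonZero n}} → 0ℚ <ℚ ι n
0<ι n@(suc _) = subst (_<ℚ ι n) ι0 (ι-mono-< (s≤s z≤n))

ι-suc : ∀ n → ι (suc n) ≡ 1ℚ ⊕ ι n
ι-suc n = trans (ι-+ 1 n) (cong (_⊕ ι n) ι1)

ι-∸ : ∀ {m n} → n ≤ m → ι (m ∸ n) ≡ ι m ⊖ ι n
ι-∸ {m} {n} le = trans (lem (ι (m ∸ n)) (ι n)) (cong (_⊖ ι n) (trans (sym (ι-+ (m ∸ n) n)) (cong ι (ℕP.m∸n+n≡m le))))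
  where
  lem : ∀ x y → x ≡ x ⊕ y ⊖ y
  lem = solve-∀ ℚring

ι⊗-cancel : ∀ n → .{{NonZero n}} → ∀ {a b} → ι n ⊗ a ≡ ι n ⊗ b → a ≡ b
ι⊗-cancel n {a} {b} e = trans (lem a) (trans (cong (iv n ⊗_) e) (sym (lem b)))
  where
  lem : ∀ x → x ≡ iv n ⊗ (ι n ⊗ x)
  lem x = trans (sym (ℚP.*-identityˡ x)) (trans (cong (_⊗ x) (trans (sym (ι⊗iv n)) (ℚP.*-comm (ι n) (iv n)))) (ℚP.*-assoc (iv n) (ι n) x))

iv-* : ∀ m n → .{{NonZero m}} → .{{NonZero n}} → iv (m * n) ≡ iv m ⊗ iv n
iv-* m@(suc _) n@(suc _) = ι⊗-cancel (m * n) (trans (ι⊗iv (m * n)) (sym (trans (cong (_⊗ (iv m ⊗ iv n)) (ι-* m n))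
  (trans (lem (ι m) (ι n) (iv m) (iv n)) (trans (cong₂ _⊗_ (ι⊗iv m) (ι⊗iv n)) (ℚP.*-identityˡ 1ℚ))))))
  where
  lem : ∀ a b c d → a ⊗ b ⊗ (c ⊗ d) ≡ a ⊗ c ⊗ (b ⊗ d)
  lem = solve-∀ ℚring

iv1 : iv 1 ≡ 1ℚ
iv1 = trans (sym (ℚP.*-identityˡ (iv 1))) (trans (cong (_⊗ iv 1) (sym ι1)) (ι⊗iv 1))

iv-antimono : ∀ {m n} → .{{NonZero m}} → m ≤ n → iv n ≤ℚ iv m
iv-antimono {m@(suc _)} {n@(suc _)} le = ⊗-cancel-≤ (ι m ⊗ ι n) (subst (0ℚ <ℚ_) (ι-* m n) (0<ι (m * n)))
  (subst₂ _≤ℚ_ (sym (trans (lem₁ (ι m) (ι n) (iv n)) (trans (cong (ι m ⊗_) (ι⊗iv n)) (ℚP.*-identityʳ (ι m)))))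
     (sym (trans (lem₂ (ι m) (ι n) (iv m)) (trans (cong (ι n ⊗_) (ι⊗iv m)) (ℚP.*-identityʳ (ι n))))) (ι-mono-≤ le))
  where
  lem₁ : ∀ a b c → a ⊗ b ⊗ c ≡ a ⊗ (b ⊗ c)
  lem₁ = solve-∀ ℚring
  lem₂ : ∀ a b c → a ⊗ b ⊗ c ≡ b ⊗ (a ⊗ c)
  lem₂ = solve-∀ ℚring

-- Sums over intervals

module _ (m : ℕ) where

  Sum : ℕ → (ℕ → ℚ) → ℚ
  Sum zero    F = 0ℚ
  Sum (suc N) F = Sum N F ⊕ F (m + N)

  Sum-cong : ∀ {F G} N → (∀ a → F a ≡ G a) → Sum N F ≡ Sum N G
  Sum-cong zero    e = refl
  Sum-cong (suc N) e = cong₂ _⊕_ (Sum-cong N e) (e (m + N))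

  Sum-⊕ : ∀ {F G} N → Sum N (λ a → F a ⊕ G a) ≡ Sum N F ⊕ Sum N G
  Sum-⊕ zero    = refl
  Sum-⊕ {F} {G} (suc N) = trans (cong (_⊕ (F (m + N) ⊕ G (m + N))) (Sum-⊕ N)) (lem (Sum N F) (Sum N G) (F (m + N)) (G (m + N)))
    where
    lem : ∀ a b c d → a ⊕ b ⊕ (c ⊕ d) ≡ a ⊕ c ⊕ (b ⊕ d)
    lem = solve-∀ ℚring

  Sum-⊗ : ∀ c {F} N → Sum N (λ a → c ⊗ F a) ≡ c ⊗ Sum N F
  Sum-⊗ c zero    = sym (ℚP.*-zeroʳ c)
  Sum-⊗ c {F} (suc N) = trans (cong (_⊕ c ⊗ F (m + N)) (Sum-⊗ c N)) (sym (ℚP.*-distribˡ-+ c (Sum N F) (F (m + N))))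

  Sum-mono : ∀ {F G} N → (∀ a → m ≤ a → a < m + N → F a ≤ℚ G a) → Sum N F ≤ℚ Sum N G
  Sum-mono zero    h = ℚP.≤-refl
  Sum-mono (suc N) h = ℚP.+-mono-≤ (Sum-mono N (λ a l u → h a l (ℕP.<-≤-trans u (ℕP.+-monoʳ-≤ m (ℕP.n≤1+n N)))))
                                   (h (m + N) (ℕP.m≤m+n m N) (ℕP.+-monoʳ-< m (ℕP.n<1+n N)))

  Sum-pos : ∀ {F} N → 0ℚ <ℚ Sum N F → Σ[ a ∈ ℕ ] m ≤ a × a < m + N × 0ℚ <ℚ F a
  Sum-pos zero    h = ⊥-elim (ℚP.<-irrefl refl h)
  Sum-pos {F} (suc N) h with 0ℚ ℚP.<? F (m + N)
  ... | yes p = m + N , ℕP.m≤m+n m N , ℕP.+-monoʳ-< m (ℕP.n<1+n N) , p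
  ... | no ¬p with Sum-pos {F} N (ℚP.<-≤-trans h (subst (Sum N F ⊕ F (m + N) ≤ℚ_) (ℚP.+-identityʳ (Sum N F)) (ℚP.+-monoʳ-≤ (Sum N F) (ℚP.≮⇒≥ ¬p))))
  ...   | a , l , u , q = a , l , ℕP.<-≤-trans u (ℕP.+-monoʳ-≤ m (ℕP.n≤1+n N)) , q

ind : ℕ → ℕ → ℚ
ind d a = if does (d ∣? a) then 1ℚ else 0ℚ

ind-yes : ∀ {d a} → d ∣ a → ind d a ≡ 1ℚ
ind-yes {d} {a} h with d ∣? a
... | yes _ = refl
... | no ¬p = ⊥-elim (¬p h)

ind-no : ∀ {d a} → ¬ d ∣ a → ind d a ≡ 0ℚ
ind-no {d} {a} h with d ∣? a
... | yes p = ⊥-elim (h p)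
... | no _ = refl

0≤ind : ∀ d a → 0ℚ ≤ℚ ind d a
0≤ind d a with d ∣? a
... | yes _ = 0≤1
... | no _ = ℚP.≤-refl

ind-idem : ∀ d a → ind d a ⊗ ind d a ≡ ind d a
ind-idem d a with d ∣? a
... | yes _ = refl
... | no _ = refl

-- the count of multiples, with remainders tracked so that the estimate is exact
multiples : ∀ b d → .{{_ : NonZero d}} → ∀ N →
  Σ[ c ∈ ℕ ] Σ[ r ∈ ℕ ] Sum (suc b) N (ind d) ≡ ι c × (c * d + r ≡ N + b % d) × r < d × (Σ[ q ∈ ℕ ] q * d + r ≡ b + N)
multiples b d zero = 0 , b % d , sym ι0 , refl , DM.m%n<n b d , b / d , trans (ℕP.+-comm (b / d * d) (b % d)) (trans (sym (DM.m≡m%n+[m/n]*n b d)) (sym (ℕP.+-identityʳ b)))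
multiples b d (suc N) with multiples b d N
... | c , r , e , f , r<d , q , g with suc r ℕP.≟ d
...   | yes refl = suc c , 0 , trans (cong₂ _⊕_ e (ind-yes (divides (suc q) div))) (trans (ℚP.+-comm (ι c) 1ℚ) (sym (ι-suc c)))
                 , trans (lem c r) (cong suc f) , s≤s z≤n , suc q , trans (lem q r) (trans (cong suc g) (sym (ℕP.+-suc b N)))
  where
  lem : ∀ c r → suc c * suc r + 0 ≡ suc (c * suc r + r)
  lem = ℕRing.solve-∀
  div : suc b + N ≡ suc q * suc r
  div = sym (trans (sym (ℕP.+-identityʳ (suc q * suc r))) (trans (lem q r) (cong suc g)))
...   | no ne = c , suc r , trans (cong₂ _⊕_ e (ind-no nd)) (ℚP.+-identityʳ (ι c)) , trans (ℕP.+-suc (c * d) r) (cong suc f)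
                 , sr<d , q , trans (ℕP.+-suc (q * d) r) (trans (cong suc g) (sym (ℕP.+-suc b N)))
  where
  sr<d : suc r < d
  sr<d = ℕP.≤∧≢⇒< r<d ne
  nd : ¬ d ∣ suc b + N
  nd h with ∣P.∣m+n∣m⇒∣n {d} {q * d} {suc r} (subst (d ∣_) (trans (cong suc (sym g)) (sym (ℕP.+-suc (q * d) r))) h) (∣P.n∣m*n q)
  ... | h′ = ℕP.<-irrefl refl (ℕP.<-≤-trans sr<d (∣P.∣⇒≤ h′))

multiples-approx : ∀ b d → .{{_ : NonZero d}} → ∀ N → ∣ Sum (suc b) N (ind d) ⊖ ι N ⊗ iv d ∣ ≤ℚ 1ℚ
multiples-approx b d N with multiples b d N
... | c , r , e , f , r<d , _ = ∣∣≤
    (⊗-cancel-≤ (ι d) (0<ι d) (subst₂ _≤ℚ_ (sym (h₁ (ι d))) (sym scaled) (≤-by (ι (b % d) ⊕ (ι d ⊖ ι r)) (0≤⊕ (0≤ι _) (0≤⊖ (ι-mono-≤ (ℕP.<⇒≤ r<d)))) (h₂ (ι d) (ι (b % d)) (ι r)))))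
    (⊗-cancel-≤ (ι d) (0<ι d) (subst₂ _≤ℚ_ (sym scaled) (sym (ℚP.*-identityʳ (ι d))) (≤-by (ι r ⊕ (ι d ⊖ ι (b % d))) (0≤⊕ (0≤ι _) (0≤⊖ (ι-mono-≤ (ℕP.<⇒≤ (DM.m%n<n b d))))) (h₃ (ι d) (ι (b % d)) (ι r)))))
  where
  h₁ : ∀ x → x ⊗ (⊝ 1ℚ) ≡ ⊝ x
  h₁ = solve-∀ ℚring
  h₂ : ∀ x y z → ⊝ x ⊕ (y ⊕ (x ⊖ z)) ≡ y ⊖ z
  h₂ = solve-∀ ℚring
  h₃ : ∀ x y z → y ⊖ z ⊕ (z ⊕ (x ⊖ y)) ≡ x
  h₃ = solve-∀ ℚring
  h₄ : ∀ x y z w v → (x ⊗ y ⊕ z) ≡ w ⊕ v → y ⊗ x ⊖ w ≡ v ⊖ z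
  h₄ x y z w v e = trans (h₅ x y z w) (trans (cong (λ t → t ⊖ z ⊖ w) e) (h₆ w v z))
    where
    h₅ : ∀ x y z w → y ⊗ x ⊖ w ≡ x ⊗ y ⊕ z ⊖ z ⊖ w
    h₅ = solve-∀ ℚring
    h₆ : ∀ w v z → w ⊕ v ⊖ z ⊖ w ≡ v ⊖ z
    h₆ = solve-∀ ℚring
  h₇ : ∀ x y z w → x ⊗ (y ⊖ z ⊗ w) ≡ x ⊗ y ⊖ z ⊗ (x ⊗ w)
  h₇ = solve-∀ ℚring
  scaled : ι d ⊗ (Sum (suc b) N (ind d) ⊖ ι N ⊗ iv d) ≡ ι (b % d) ⊖ ι r
  scaled = trans (h₇ (ι d) (Sum (suc b) N (ind d)) (ι N) (iv d))
    (trans (cong₂ (λ s t → ι d ⊗ s ⊖ ι N ⊗ t) e (ι⊗iv d))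
    (trans (cong (λ t → ι d ⊗ ι c ⊖ t) (ℚP.*-identityʳ (ι N)))
      (h₄ (ι c) (ι d) (ι r) (ι N) (ι (b % d)) (trans (cong (_⊕ ι r) (sym (ι-* c d))) (trans (sym (ι-+ (c * d) r)) (trans (cong ι f) (ι-+ N (b % d))))))))

-- Divisibility by distinct primes

prime-∤-* : ∀ {q m n} → Prime q → ¬ q ∣ m → ¬ q ∣ n → ¬ q ∣ m * n
prime-∤-* {q} {m} {n} pr hm hn h with euclidsLemma m n pr h
... | inj₁ x = hm x
... | inj₂ y = hn y

prime∣prime : ∀ {q p} → Prime q → Prime p → q ∣ p → q ≡ p
prime∣prime {q} {p} pq pp h with PrimeP.prime⇒irreducible pp h
... | inj₁ refl = ⊥-elim (PrimeP.¬prime[1] pq)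
... | inj₂ e = e

∣-mul-prime : ∀ {p d a} → Prime p → ¬ p ∣ d → d ∣ a → p ∣ a → d * p ∣ a
∣-mul-prime {p} {d} {a} pr p∤d (divides k refl) p∣a with euclidsLemma k d pr p∣a
... | inj₂ p∣d = ⊥-elim (p∤d p∣d)
... | inj₁ (divides j refl) = divides j (lem j p d)
  where
  lem : ∀ j p d → j * p * d ≡ j * (d * p)
  lem = ℕRing.solve-∀

∣-mul-prime² : ∀ {p d a} → Prime p → ¬ p ∣ d → d ∣ a → p * p ∣ a → d * (p * p) ∣ a
∣-mul-prime² {p} {d} {a} pr p∤d (divides k refl) pp∣a with euclidsLemma k d pr (∣P.∣-trans (∣P.m∣m*n p) pp∣a)
... | inj₂ p∣d = ⊥-elim (p∤d p∣d)
... | inj₁ (divides j refl) with euclidsLemma j d pr (∣P.*-cancelʳ-∣ p {{prime⇒nonZero pr}} (subst (p * p ∣_) (lem j p d) pp∣a))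
  where
  lem : ∀ j p d → j * p * d ≡ j * d * p
  lem = ℕRing.solve-∀
...   | inj₂ p∣d = ⊥-elim (p∤d p∣d)
...   | inj₁ (divides i refl) = divides i (lem i p d)
  where
  lem : ∀ i p d → i * p * p * d ≡ i * (d * (p * p))
  lem = ℕRing.solve-∀

ind-mul : ∀ {m} (d a : ℕ) → (d ∣ a → m ∣ a → d * m ∣ a) → ind d a ⊗ ind m a ≡ ind (d * m) a
ind-mul {m} d a h with d ∣? a
... | no ¬p = trans (ℚP.*-zeroˡ (ind m a)) (sym (ind-no (λ x → ¬p (∣P.∣-trans (∣P.m∣m*n m) x))))
... | yes p with m ∣? a
...   | no ¬q = sym (ind-no (λ x → ¬q (∣P.∣-trans (∣P.n∣m*n d) x)))
...   | yes q = sym (ind-yes (h p q))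

Distinct : ℕ → List ℕ → Set
Distinct p = All (λ q → Prime q × q ≢ p)

-- Approximate densities, uniform along multiples

module Approx (b N : ℕ) where

  -- F has density μ up to error ν, also along multiples of every d free of the primes in ps
  App : List ℕ → (ℕ → ℚ) → ℚ → ℚ → Set
  App ps F μ ν = ∀ d → .{{_ : NonZero d}} → All (λ p → ¬ p ∣ d) ps →
    ∣ Sum (suc b) N (λ a → ind d a ⊗ F a) ⊖ ι N ⊗ (iv d ⊗ μ) ∣ ≤ℚ ν

  -- Among N consecutive integers the multiples of d number N/d up to 1, for every d alike. All
  -- later error terms descend from this uniform one.
  app-1 : ∀ {ps} → App ps (λ _ → 1ℚ) 1ℚ 1ℚ
  app-1 d _ = subst₂ (λ x y → ∣ x ⊖ ι N ⊗ y ∣ ≤ℚ 1ℚ) (Sum-cong (suc b) N (λ a → sym (ℚP.*-identityʳ (ind d a)))) (sym (ℚP.*-identityʳ (iv d))) (multiples-approx b d N)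

  app-resp : ∀ {ps F G μ μ′ ν ν′} → (∀ a → F a ≡ G a) → μ ≡ μ′ → ν ≤ℚ ν′ → App ps F μ ν → App ps G μ′ ν′
  app-resp e refl le h d c = subst (λ x → ∣ x ⊖ _ ∣ ≤ℚ _) (Sum-cong (suc b) N (λ a → cong (ind d a ⊗_) (e a))) (ℚP.≤-trans (h d c) le)

  app-tail : ∀ {p ps F μ ν} → App ps F μ ν → App (p ∷ ps) F μ ν
  app-tail h d (_ ∷ c) = h d c

  app-⊕ : ∀ {ps F G μ μ′ ν ν′} → App ps F μ ν → App ps G μ′ ν′ → App ps (λ a → F a ⊕ G a) (μ ⊕ μ′) (ν ⊕ ν′)
  app-⊕ {F = F} {G} {μ} {μ′} h h′ d c = ℚP.≤-trans (ℚP.≤-reflexive (cong ∣_∣ (trans (cong (_⊖ ι N ⊗ (iv d ⊗ (μ ⊕ μ′))) split) (lem (S F) (S G) (ι N) (iv d) μ μ′))))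
      (ℚP.≤-trans (ℚP.∣p+q∣≤∣p∣+∣q∣ (S F ⊖ ι N ⊗ (iv d ⊗ μ)) (S G ⊖ ι N ⊗ (iv d ⊗ μ′))) (ℚP.+-mono-≤ (h d c) (h′ d c)))
    where
    S : (ℕ → ℚ) → ℚ
    S F = Sum (suc b) N (λ a → ind d a ⊗ F a)
    split : S (λ a → F a ⊕ G a) ≡ S F ⊕ S G
    split = trans (Sum-cong (suc b) N (λ a → ℚP.*-distribˡ-+ (ind d a) (F a) (G a))) (Sum-⊕ (suc b) N)
    lem : ∀ x y n i u v → x ⊕ y ⊖ n ⊗ (i ⊗ (u ⊕ v)) ≡ x ⊖ n ⊗ (i ⊗ u) ⊕ (y ⊖ n ⊗ (i ⊗ v))
    lem = solve-∀ ℚring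

  app-⊗′ : ∀ {ps F μ ν} t → App ps F μ ν → App ps (λ a → t ⊗ F a) (t ⊗ μ) (∣ t ∣ ⊗ ν)
  app-⊗′ {F = F} {μ} t h d c = ℚP.≤-trans (ℚP.≤-reflexive (trans (cong ∣_∣ (trans (cong (_⊖ ι N ⊗ (iv d ⊗ (t ⊗ μ))) scale) (lem t (S F) (ι N) (iv d) μ)))
      (ℚP.∣p*q∣≡∣p∣*∣q∣ t (S F ⊖ ι N ⊗ (iv d ⊗ μ))))) (⊗-monoʳ (ℚP.0≤∣p∣ t) (h d c))
    where
    S : (ℕ → ℚ) → ℚ
    S F = Sum (suc b) N (λ a → ind d a ⊗ F a)
    comm : ∀ x y z → x ⊗ (y ⊗ z) ≡ y ⊗ (x ⊗ z)
    comm = solve-∀ ℚring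
    scale : S (λ a → t ⊗ F a) ≡ t ⊗ S F
    scale = trans (Sum-cong (suc b) N (λ a → comm (ind d a) t (F a))) (Sum-⊗ (suc b) t N)
    lem : ∀ t s n i u → t ⊗ s ⊖ n ⊗ (i ⊗ (t ⊗ u)) ≡ t ⊗ (s ⊖ n ⊗ (i ⊗ u))
    lem = solve-∀ ℚring

  app-⊗ : ∀ {ps F μ ν} t → 0ℚ ≤ℚ t → App ps F μ ν → App ps (λ a → t ⊗ F a) (t ⊗ μ) (t ⊗ ν)
  app-⊗ {ν = ν} t pt h = app-resp (λ _ → refl) refl (ℚP.≤-reflexive (cong (_⊗ ν) (ℚP.0≤p⇒∣p∣≡p pt))) (app-⊗′ t h)

  app-⊝ : ∀ {ps F μ ν} t → 0ℚ ≤ℚ t → App ps F μ ν → App ps (λ a → (⊝ t) ⊗ F a) ((⊝ t) ⊗ μ) (t ⊗ ν)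
  app-⊝ {ν = ν} t pt h = app-resp (λ _ → refl) refl (ℚP.≤-reflexive (cong (_⊗ ν) (trans (ℚP.∣-p∣≡∣p∣ t) (ℚP.0≤p⇒∣p∣≡p pt)))) (app-⊗′ (⊝ t) h)

  -- Restricting `F` to multiples of m and then summing over multiples of d is summing `F` over
  -- multiples of `d * m`; as the bound is uniform in d, the error does not grow. It is used with m
  -- = p and m = p².
  app-mod : ∀ {ps F μ ν p} m → .{{_ : NonZero m}} → Distinct p ps →
    (∀ q → Prime q → q ≢ p → ¬ q ∣ m) → (∀ d a → ¬ p ∣ d → d ∣ a → m ∣ a → d * m ∣ a) →
    App ps F μ ν → App (p ∷ ps) (λ a → ind m a ⊗ F a) (iv m ⊗ μ) ν
  app-mod {ps} {F} {μ} {ν} {p} m@(suc _) ds hq hm h d@(suc _) (p∤d ∷ c) =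
    subst₂ (λ x y → ∣ x ⊖ ι N ⊗ y ∣ ≤ℚ ν)
      (Sum-cong (suc b) N (λ a → trans (cong (_⊗ F a) (sym (ind-mul d a (hm d a p∤d)))) (ℚP.*-assoc (ind d a) (ind m a) (F a))))
      (trans (cong (_⊗ μ) (iv-* d m)) (ℚP.*-assoc (iv d) (iv m) μ))
      (h (d * m) (go ds c))
    where
    go : ∀ {qs} → Distinct p qs → All (λ q → ¬ q ∣ d) qs → All (λ q → ¬ q ∣ d * m) qs
    go [] [] = []
    go ((pq , q≢p) ∷ ds) (q∤d ∷ c) = prime-∤-* pq q∤d (hq _ pq q≢p) ∷ go ds c

  app-ind : ∀ {ps F μ ν p} → Prime p → Distinct p ps →
    App ps F μ ν → App (p ∷ ps) (λ a → ind p a ⊗ F a) (iv p ⊗ μ) ν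
  app-ind {p = p} pr ds = app-mod p {{prime⇒nonZero pr}} ds (λ q pq q≢p h → q≢p (prime∣prime pq pr h)) (λ d a p∤d x y → ∣-mul-prime pr p∤d x y)

  app-ind² : ∀ {ps F μ ν p} → Prime p → Distinct p ps →
    App ps F μ ν → App (p ∷ ps) (λ a → ind (p * p) a ⊗ F a) (iv p ⊗ iv p ⊗ μ) ν
  app-ind² {p = p@(suc _)} pr ds h = app-resp (λ _ → refl) (cong (_⊗ _) (iv-* p p)) ℚP.≤-refl
    (app-mod (p * p) ds (λ q pq q≢p → prime-∤-* pq (λ h → q≢p (prime∣prime pq pr h)) (λ h → q≢p (prime∣prime pq pr h))) (λ d a p∤d x y → ∣-mul-prime² pr p∤d x y) h)

  -- The error doubles, so sifting by 2, 3, 5 and 7 costs the factor 16 in `sieve`.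
  app-sift : ∀ {ps F μ ν p} → Prime p → Distinct p ps →
    App ps F μ ν → App (p ∷ ps) (λ a → (1ℚ ⊖ ind p a) ⊗ F a) ((1ℚ ⊖ iv p) ⊗ μ) (ν ⊕ ν)
  app-sift {F = F} {μ} {ν} {p} pr ds h = app-resp (λ a → lem (ind p a) (F a)) (lem (iv p) μ) (ℚP.≤-reflexive (lem′ ν))
      (app-⊕ (app-tail h) (app-⊝ 1ℚ 0≤1 (app-ind pr ds h)))
    where
    lem : ∀ x y → y ⊕ (⊝ 1ℚ) ⊗ (x ⊗ y) ≡ (1ℚ ⊖ x) ⊗ y
    lem = solve-∀ ℚring
    lem′ : ∀ x → x ⊕ 1ℚ ⊗ x ≡ x ⊕ x
    lem′ = solve-∀ ℚring

-- Densities of the sieve weights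

Entry : Set
Entry = ℕ × ℕ

ih : ℕ → ℚ
ih p = iv (ℕ.pred p)

0≤ih : ∀ p → 0ℚ ≤ℚ ih p
0≤ih p = 0≤iv (ℕ.pred p)

ih≤1 : ∀ {p} → Prime p → ih p ≤ℚ 1ℚ
ih≤1 {p} pr with p | prime⇒nonTrivial pr
... | suc (suc k) | _ = subst (iv (suc k) ≤ℚ_) iv1 (iv-antimono (s≤s z≤n))

-- This is the statement that `g p`, whose mean is `ih p` minus the left side, has mean zero.
iv⊗1+ih : ∀ {p} → Prime p → iv p ⊗ (1ℚ ⊕ ih p) ≡ ih p
iv⊗1+ih {p} pr with p | prime⇒nonTrivial pr
... | suc (suc k) | _ = ι⊗-cancel (suc (suc k)) (trans (sym (ℚP.*-assoc (ι (suc (suc k))) (iv (suc (suc k))) (1ℚ ⊕ h))) (trans (cong (_⊗ (1ℚ ⊕ h)) (ι⊗iv (suc (suc k))))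
    (trans (lem₁ h) (trans (cong (h ⊕_) (sym (ι⊗iv (suc k)))) (trans (lem₂ h (ι (suc k))) (cong (_⊗ h) (sym (ι-suc (suc k)))))))))
  where
  h : ℚ
  h = iv (suc k)
  lem₁ : ∀ x → 1ℚ ⊗ (1ℚ ⊕ x) ≡ x ⊕ 1ℚ
  lem₁ = solve-∀ ℚring
  lem₂ : ∀ x y → x ⊕ y ⊗ x ≡ (1ℚ ⊕ y) ⊗ x
  lem₂ = solve-∀ ℚring

data Good : List Entry → Set where
  []  : Good []
  _∷_ : ∀ {p s es} → Prime p × Distinct p (map proj₁ es) → Good es → Good ((p , s) ∷ es)

-- The sieve weight.  Expanded over squarefree l = p₁⋯pᵣ from the list, f is Σ_l (K ∸ s(l)) Π g_p
-- with g_p = -1 on multiples of p and 1/(p-1) elsewhere; the g_p have mean zero and variance 1/(p-1).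
g : ℕ → ℕ → ℚ
g p a = ih p ⊖ (1ℚ ⊕ ih p) ⊗ ind p a

f : List Entry → ℕ → ℕ → ℚ
f []             K a = ι K
f ((p , s) ∷ es) K a = f es K a ⊕ g p a ⊗ f es (K ∸ s) a

-- nu bounds the sum of the absolute values of the coefficients of f, expanded in indicators of divisibility;
-- A and B are the mean values of f_K f_L and of f_K f_L W.
nu : List Entry → ℕ → ℚ
nu []             K = ι K
nu ((p , s) ∷ es) K = nu es K ⊕ (1ℚ ⊕ (ih p ⊕ ih p)) ⊗ nu es (K ∸ s)

A : List Entry → ℕ → ℕ → ℚ
A []             K L = ι K ⊗ ι L
A ((p , s) ∷ es) K L = A es K L ⊕ ih p ⊗ A es (K ∸ s) (L ∸ s)

w : ℕ → ℕ → ℚ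
w p a = ind p a ⊕ (ind (p * p) a ⊕ ind (p * p) a)

W : List Entry → ℕ → ℚ
W []             a = 0ℚ
W ((p , s) ∷ es) a = W es a ⊕ w p a

wt : ℕ → ℚ
wt p = iv p ⊕ (iv p ⊗ iv p ⊕ iv p ⊗ iv p)

3ℚ : ℚ
3ℚ = 1ℚ ⊕ (1ℚ ⊕ 1ℚ)

B : List Entry → ℕ → ℕ → ℚ
B []             K L = 0ℚ
B ((p , s) ∷ es) K L = B es K L ⊕ ih p ⊗ B es (K ∸ s) (L ∸ s)
  ⊕ wt p ⊗ (A es K L ⊕ A es (K ∸ s) (L ∸ s) ⊖ (A es K (L ∸ s) ⊕ A es (K ∸ s) L))

-- The coefficients 1 and 2 of `w p` add up to 3 for each prime; multiplying by `W` inflates the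
-- error by this total.
3len : List Entry → ℚ
3len []       = 0ℚ
3len (_ ∷ es) = 3len es ⊕ 3ℚ

0≤3ℚ : 0ℚ ≤ℚ 3ℚ
0≤3ℚ = ℚP.nonNegative⁻¹ 3ℚ

0≤3len : ∀ es → 0ℚ ≤ℚ 3len es
0≤3len []       = ℚP.≤-refl
0≤3len (_ ∷ es) = 0≤⊕ (0≤3len es) 0≤3ℚ

0≤r : ∀ p → 0ℚ ≤ℚ 1ℚ ⊕ (ih p ⊕ ih p)
0≤r p = 0≤⊕ 0≤1 (0≤⊕ (0≤ih p) (0≤ih p))

0≤nu : ∀ es K → 0ℚ ≤ℚ nu es K
0≤nu []             K = 0≤ι K
0≤nu ((p , s) ∷ es) K = 0≤⊕ (0≤nu es K) (0≤⊗ (0≤r p) (0≤nu es (K ∸ s)))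

module Densities (b N : ℕ) where
  open Approx b N

  -- Since `ind p` is idempotent, g² = h² + (1 - h²) ind p, with mean h² + (1 - h) h = h; the cross
  -- terms carry g, with mean 0, and vanish. The absolute coefficients add up to 1 for g² and to 1 +
  -- 2h for g, which stays within the product of the two values of `nu`.
  app-step : ∀ {p s es} (G : ℕ → ℚ) (M : ℕ → ℕ → ℚ) (C : ℚ) → 0ℚ ≤ℚ C → Prime p → Distinct p (map proj₁ es) →
    (∀ K L → App (map proj₁ es) (λ a → f es K a ⊗ f es L a ⊗ G a) (M K L) (C ⊗ (nu es K ⊗ nu es L))) →
    ∀ K L → App (p ∷ map proj₁ es) (λ a → f ((p , s) ∷ es) K a ⊗ f ((p , s) ∷ es) L a ⊗ G a)
      (M K L ⊕ ih p ⊗ M (K ∸ s) (L ∸ s)) (C ⊗ (nu ((p , s) ∷ es) K ⊗ nu ((p , s) ∷ es) L))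
  app-step {p} {s} {es} G M C 0≤C pr ds H K L =
    app-resp (λ a → sym (pointwise (f es K a) (f es (K ∸ s) a) (f es L a) (f es (L ∸ s) a) (G a) (ind p a) h (ind-idem p a)))
             (mean (M K L) (M (K ∸ s) (L ∸ s)) (M K (L ∸ s) ⊕ M (K ∸ s) L) h (iv p) (iv⊗1+ih pr))
             (≤-by (C ⊗ ((h ⊕ h ⊕ (h ⊕ h) ⊕ (h ⊗ h ⊕ h ⊗ h ⊕ (h ⊗ h ⊕ h ⊗ h))) ⊗ (nu es (K ∸ s) ⊗ nu es (L ∸ s))))
               (0≤⊗ 0≤C (0≤⊗ (0≤⊕ (0≤⊕ (0≤⊕ h0 h0) (0≤⊕ h0 h0)) (0≤⊕ (0≤⊕ hh hh) (0≤⊕ hh hh))) (0≤⊗ (0≤nu es _) (0≤nu es _))))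
               (norm C h (nu es K) (nu es (K ∸ s)) (nu es L) (nu es (L ∸ s))))
     (app-⊕ (app-⊕ (app-⊕ (app-tail (H K L)) (app-⊗ (h ⊗ h) hh (app-tail (H (K ∸ s) (L ∸ s)))))
                   (app-⊗ h h0 (app-⊕ (app-tail (H K (L ∸ s))) (app-tail (H (K ∸ s) L)))))
            (app-⊕ (app-⊗ (1ℚ ⊖ h ⊗ h) 1-hh (app-ind pr ds (H (K ∸ s) (L ∸ s))))
                   (app-⊝ (1ℚ ⊕ h) (0≤⊕ 0≤1 h0) (app-ind pr ds (app-⊕ (H K (L ∸ s)) (H (K ∸ s) L))))))
    where
    h : ℚ
    h = ih p
    h0 : 0ℚ ≤ℚ h
    h0 = 0≤ih p
    hh : 0ℚ ≤ℚ h ⊗ h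
    hh = 0≤⊗ h0 h0
    1-hh : 0ℚ ≤ℚ 1ℚ ⊖ h ⊗ h
    1-hh = 0≤⊖ (ℚP.≤-trans (⊗-mono h0 0≤1 (ih≤1 pr) (ih≤1 pr)) (ℚP.≤-reflexive (ℚP.*-identityʳ 1ℚ)))
    pw : ∀ x y x′ y′ G i h → (x ⊕ (h ⊖ (1ℚ ⊕ h) ⊗ i) ⊗ y) ⊗ (x′ ⊕ (h ⊖ (1ℚ ⊕ h) ⊗ i) ⊗ y′) ⊗ G
      ≡ (x ⊗ x′ ⊗ G ⊕ h ⊗ h ⊗ (y ⊗ y′ ⊗ G) ⊕ h ⊗ (x ⊗ y′ ⊗ G ⊕ y ⊗ x′ ⊗ G)) ⊕ ((1ℚ ⊖ h ⊗ h) ⊗ (i ⊗ (y ⊗ y′ ⊗ G)) ⊕ (⊝ (1ℚ ⊕ h)) ⊗ (i ⊗ (x ⊗ y′ ⊗ G ⊕ y ⊗ x′ ⊗ G)))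
        ⊕ (1ℚ ⊕ h) ⊗ (1ℚ ⊕ h) ⊗ (i ⊗ i ⊖ i) ⊗ (y ⊗ y′ ⊗ G)
    pw = solve-∀ ℚring
    zero-term : ∀ X u i v → X ⊕ u ⊗ (i ⊖ i) ⊗ v ≡ X
    zero-term = solve-∀ ℚring
    pointwise : ∀ x y x′ y′ G i h → i ⊗ i ≡ i → (x ⊕ (h ⊖ (1ℚ ⊕ h) ⊗ i) ⊗ y) ⊗ (x′ ⊕ (h ⊖ (1ℚ ⊕ h) ⊗ i) ⊗ y′) ⊗ G
      ≡ (x ⊗ x′ ⊗ G ⊕ h ⊗ h ⊗ (y ⊗ y′ ⊗ G) ⊕ h ⊗ (x ⊗ y′ ⊗ G ⊕ y ⊗ x′ ⊗ G)) ⊕ ((1ℚ ⊖ h ⊗ h) ⊗ (i ⊗ (y ⊗ y′ ⊗ G)) ⊕ (⊝ (1ℚ ⊕ h)) ⊗ (i ⊗ (x ⊗ y′ ⊗ G ⊕ y ⊗ x′ ⊗ G)))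
    pointwise x y x′ y′ G i h ii = trans (pw x y x′ y′ G i h)
      (trans (cong (λ t → E ⊕ (1ℚ ⊕ h) ⊗ (1ℚ ⊕ h) ⊗ (t ⊖ i) ⊗ (y ⊗ y′ ⊗ G)) ii) (zero-term E ((1ℚ ⊕ h) ⊗ (1ℚ ⊕ h)) i (y ⊗ y′ ⊗ G)))
      where
      E : ℚ
      E = (x ⊗ x′ ⊗ G ⊕ h ⊗ h ⊗ (y ⊗ y′ ⊗ G) ⊕ h ⊗ (x ⊗ y′ ⊗ G ⊕ y ⊗ x′ ⊗ G)) ⊕ ((1ℚ ⊖ h ⊗ h) ⊗ (i ⊗ (y ⊗ y′ ⊗ G)) ⊕ (⊝ (1ℚ ⊕ h)) ⊗ (i ⊗ (x ⊗ y′ ⊗ G ⊕ y ⊗ x′ ⊗ G)))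
    mn : ∀ m₀ m₁ m₂ h i → (m₀ ⊕ h ⊗ h ⊗ m₁ ⊕ h ⊗ m₂) ⊕ ((1ℚ ⊖ h ⊗ h) ⊗ (i ⊗ m₁) ⊕ (⊝ (1ℚ ⊕ h)) ⊗ (i ⊗ m₂))
      ≡ m₀ ⊕ h ⊗ h ⊗ m₁ ⊕ h ⊗ m₂ ⊕ (1ℚ ⊖ h) ⊗ (i ⊗ (1ℚ ⊕ h)) ⊗ m₁ ⊖ (i ⊗ (1ℚ ⊕ h)) ⊗ m₂
    mn = solve-∀ ℚring
    mn′ : ∀ m₀ m₁ m₂ h → m₀ ⊕ h ⊗ h ⊗ m₁ ⊕ h ⊗ m₂ ⊕ (1ℚ ⊖ h) ⊗ h ⊗ m₁ ⊖ h ⊗ m₂ ≡ m₀ ⊕ h ⊗ m₁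
    mn′ = solve-∀ ℚring
    mean : ∀ m₀ m₁ m₂ h i → i ⊗ (1ℚ ⊕ h) ≡ h →
      (m₀ ⊕ h ⊗ h ⊗ m₁ ⊕ h ⊗ m₂) ⊕ ((1ℚ ⊖ h ⊗ h) ⊗ (i ⊗ m₁) ⊕ (⊝ (1ℚ ⊕ h)) ⊗ (i ⊗ m₂)) ≡ m₀ ⊕ h ⊗ m₁
    mean m₀ m₁ m₂ h i e = trans (mn m₀ m₁ m₂ h i) (trans (cong (λ t → m₀ ⊕ h ⊗ h ⊗ m₁ ⊕ h ⊗ m₂ ⊕ (1ℚ ⊖ h) ⊗ t ⊗ m₁ ⊖ t ⊗ m₂) e) (mn′ m₀ m₁ m₂ h))
    norm : ∀ C h n₀ n₁ m₀ m₁ →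
      C ⊗ (n₀ ⊗ m₀) ⊕ h ⊗ h ⊗ (C ⊗ (n₁ ⊗ m₁)) ⊕ h ⊗ (C ⊗ (n₀ ⊗ m₁) ⊕ C ⊗ (n₁ ⊗ m₀))
      ⊕ ((1ℚ ⊖ h ⊗ h) ⊗ (C ⊗ (n₁ ⊗ m₁)) ⊕ (1ℚ ⊕ h) ⊗ (C ⊗ (n₀ ⊗ m₁) ⊕ C ⊗ (n₁ ⊗ m₀)))
      ⊕ C ⊗ ((h ⊕ h ⊕ (h ⊕ h) ⊕ (h ⊗ h ⊕ h ⊗ h ⊕ (h ⊗ h ⊕ h ⊗ h))) ⊗ (n₁ ⊗ m₁))
      ≡ C ⊗ ((n₀ ⊕ (1ℚ ⊕ (h ⊕ h)) ⊗ n₁) ⊗ (m₀ ⊕ (1ℚ ⊕ (h ⊕ h)) ⊗ m₁))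
    norm = solve-∀ ℚring

  app-A : ∀ {es} → Good es → ∀ K L → App (map proj₁ es) (λ a → f es K a ⊗ f es L a ⊗ 1ℚ) (A es K L) (1ℚ ⊗ (nu es K ⊗ nu es L))
  app-A [] K L = app-resp (λ a → refl) (ℚP.*-identityʳ (ι K ⊗ ι L)) (ℚP.≤-reflexive (lem′ (ι K ⊗ ι L)))
                   (app-⊗ (ι K ⊗ ι L) (0≤⊗ (0≤ι K) (0≤ι L)) app-1)
    where
    lem′ : ∀ x → x ⊗ 1ℚ ≡ 1ℚ ⊗ x
    lem′ = solve-∀ ℚring
  app-A {(p , s) ∷ es} ((pr , ds) ∷ gs) K L = app-step {p} {s} {es} (λ _ → 1ℚ) (A es) 1ℚ 0≤1 pr ds (app-A gs) K L

  -- The old part of `W` is handled by `app-step`. The new part lives on multiples of p, where g is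
  -- -1 and f becomes the difference `f es K a` - `f es (K ∸ s) a`; no weight is left there, so
  -- `app-A` suffices.
  app-B : ∀ {es} → Good es → ∀ K L → App (map proj₁ es) (λ a → f es K a ⊗ f es L a ⊗ W es a) (B es K L) (3len es ⊗ (nu es K ⊗ nu es L))
  app-B [] K L = app-resp (λ a → lem (ι K ⊗ ι L)) (ℚP.*-zeroˡ 1ℚ) (ℚP.≤-reflexive (lem′ (ι K ⊗ ι L)))
                   (app-⊗ 0ℚ ℚP.≤-refl app-1)
    where
    lem : ∀ x → 0ℚ ⊗ 1ℚ ≡ x ⊗ 0ℚ
    lem = solve-∀ ℚring
    lem′ : ∀ x → 0ℚ ⊗ 1ℚ ≡ 0ℚ ⊗ x
    lem′ = solve-∀ ℚring
  app-B {(p , s) ∷ es} ((pr , ds) ∷ gs) K L =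
    app-resp (λ a → sym (trans (dist (f es K a ⊕ g p a ⊗ f es (K ∸ s) a) (f es L a ⊕ g p a ⊗ f es (L ∸ s) a) (W es a) (ind p a) (ind (p * p) a))
                          (cong (f ((p , s) ∷ es) K a ⊗ f ((p , s) ∷ es) L a ⊗ W es a ⊕_) (cong₂ _⊕_ (pt (ind p a) a (ind-idem p a)) (cong₂ _⊕_ (pt (ind (p * p) a) a (jj a)) (pt (ind (p * p) a) a (jj a)))))))
             (cong ((B es K L ⊕ ih p ⊗ B es (K ∸ s) (L ∸ s)) ⊕_) (mean (iv p) (A es K L) (A es (K ∸ s) (L ∸ s)) (A es K (L ∸ s) ⊕ A es (K ∸ s) L)))
             nrm
      (app-⊕ (app-step {p} {s} {es} (W es) (B es) (3len es) (0≤3len es) pr ds (app-B gs) K L)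
             (app-⊕ (app-ind pr ds Q) (app-⊕ (app-ind² pr ds Q) (app-ind² pr ds Q))))
    where
    Q : App (map proj₁ es) (λ a → (f es K a ⊗ f es L a ⊗ 1ℚ ⊕ f es (K ∸ s) a ⊗ f es (L ∸ s) a ⊗ 1ℚ) ⊕ (⊝ 1ℚ) ⊗ (f es K a ⊗ f es (L ∸ s) a ⊗ 1ℚ ⊕ f es (K ∸ s) a ⊗ f es L a ⊗ 1ℚ))
          (A es K L ⊕ A es (K ∸ s) (L ∸ s) ⊕ (⊝ 1ℚ) ⊗ (A es K (L ∸ s) ⊕ A es (K ∸ s) L)) _
    Q = app-⊕ (app-⊕ (app-A gs K L) (app-A gs (K ∸ s) (L ∸ s))) (app-⊝ 1ℚ 0≤1 (app-⊕ (app-A gs K (L ∸ s)) (app-A gs (K ∸ s) L)))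
    dist : ∀ x y W i j → x ⊗ y ⊗ (W ⊕ (i ⊕ (j ⊕ j))) ≡ x ⊗ y ⊗ W ⊕ (i ⊗ (x ⊗ y) ⊕ (j ⊗ (x ⊗ y) ⊕ j ⊗ (x ⊗ y)))
    dist = solve-∀ ℚring
    jj : ∀ a → ind (p * p) a ⊗ ind p a ≡ ind (p * p) a
    jj a with p * p ∣? a
    ... | yes h = trans (ℚP.*-identityˡ (ind p a)) (ind-yes (∣P.∣-trans (∣P.m∣m*n {p} p) h))
    ... | no _ = ℚP.*-zeroˡ (ind p a)
    e₁ : ∀ j x y x′ y′ i h → j ⊗ ((x ⊕ (h ⊖ (1ℚ ⊕ h) ⊗ i) ⊗ y) ⊗ (x′ ⊕ (h ⊖ (1ℚ ⊕ h) ⊗ i) ⊗ y′))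
      ≡ j ⊗ (x ⊗ x′) ⊕ (h ⊗ j ⊖ (1ℚ ⊕ h) ⊗ (j ⊗ i)) ⊗ (x ⊗ y′ ⊕ y ⊗ x′)
        ⊕ (h ⊗ (h ⊗ j ⊖ (1ℚ ⊕ h) ⊗ (j ⊗ i)) ⊖ (1ℚ ⊕ h) ⊗ (h ⊗ (j ⊗ i) ⊖ (1ℚ ⊕ h) ⊗ (j ⊗ i ⊗ i))) ⊗ (y ⊗ y′)
    e₁ = solve-∀ ℚring
    e₂ : ∀ j x y x′ y′ h → j ⊗ (x ⊗ x′) ⊕ (h ⊗ j ⊖ (1ℚ ⊕ h) ⊗ j) ⊗ (x ⊗ y′ ⊕ y ⊗ x′)
        ⊕ (h ⊗ (h ⊗ j ⊖ (1ℚ ⊕ h) ⊗ j) ⊖ (1ℚ ⊕ h) ⊗ (h ⊗ j ⊖ (1ℚ ⊕ h) ⊗ j)) ⊗ (y ⊗ y′)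
      ≡ j ⊗ ((x ⊗ x′ ⊗ 1ℚ ⊕ y ⊗ y′ ⊗ 1ℚ) ⊕ (⊝ 1ℚ) ⊗ (x ⊗ y′ ⊗ 1ℚ ⊕ y ⊗ x′ ⊗ 1ℚ))
    e₂ = solve-∀ ℚring
    pt : ∀ j a → j ⊗ ind p a ≡ j → j ⊗ ((f es K a ⊕ g p a ⊗ f es (K ∸ s) a) ⊗ (f es L a ⊕ g p a ⊗ f es (L ∸ s) a))
      ≡ j ⊗ ((f es K a ⊗ f es L a ⊗ 1ℚ ⊕ f es (K ∸ s) a ⊗ f es (L ∸ s) a ⊗ 1ℚ) ⊕ (⊝ 1ℚ) ⊗ (f es K a ⊗ f es (L ∸ s) a ⊗ 1ℚ ⊕ f es (K ∸ s) a ⊗ f es L a ⊗ 1ℚ))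
    pt j a e = trans (e₁ j (f es K a) (f es (K ∸ s) a) (f es L a) (f es (L ∸ s) a) (ind p a) (ih p))
      (trans (cong₂ (λ t u → j ⊗ (f es K a ⊗ f es L a) ⊕ (ih p ⊗ j ⊖ (1ℚ ⊕ ih p) ⊗ t) ⊗ (f es K a ⊗ f es (L ∸ s) a ⊕ f es (K ∸ s) a ⊗ f es L a)
          ⊕ (ih p ⊗ (ih p ⊗ j ⊖ (1ℚ ⊕ ih p) ⊗ t) ⊖ (1ℚ ⊕ ih p) ⊗ (ih p ⊗ t ⊖ (1ℚ ⊕ ih p) ⊗ u)) ⊗ (f es (K ∸ s) a ⊗ f es (L ∸ s) a))
        e (trans (cong (_⊗ ind p a) e) e))
        (e₂ j (f es K a) (f es (K ∸ s) a) (f es L a) (f es (L ∸ s) a) (ih p)))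
    mean : ∀ i x y z → i ⊗ (x ⊕ y ⊕ (⊝ 1ℚ) ⊗ z) ⊕ (i ⊗ i ⊗ (x ⊕ y ⊕ (⊝ 1ℚ) ⊗ z) ⊕ i ⊗ i ⊗ (x ⊕ y ⊕ (⊝ 1ℚ) ⊗ z)) ≡ (i ⊕ (i ⊗ i ⊕ i ⊗ i)) ⊗ (x ⊕ y ⊖ z)
    mean = solve-∀ ℚring
    n₀ n₁ m₀ m₁ : ℚ
    n₀ = nu es K
    n₁ = nu es (K ∸ s)
    m₀ = nu es L
    m₁ = nu es (L ∸ s)
    c₀ : ∀ L n₀ n₁ m₀ m₁ h → L ⊗ ((n₀ ⊕ (1ℚ ⊕ (h ⊕ h)) ⊗ n₁) ⊗ (m₀ ⊕ (1ℚ ⊕ (h ⊕ h)) ⊗ m₁))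
       ⊕ (1ℚ ⊗ (n₀ ⊗ m₀) ⊕ 1ℚ ⊗ (n₁ ⊗ m₁) ⊕ 1ℚ ⊗ (1ℚ ⊗ (n₀ ⊗ m₁) ⊕ 1ℚ ⊗ (n₁ ⊗ m₀))
        ⊕ ((1ℚ ⊗ (n₀ ⊗ m₀) ⊕ 1ℚ ⊗ (n₁ ⊗ m₁) ⊕ 1ℚ ⊗ (1ℚ ⊗ (n₀ ⊗ m₁) ⊕ 1ℚ ⊗ (n₁ ⊗ m₀)))
        ⊕ (1ℚ ⊗ (n₀ ⊗ m₀) ⊕ 1ℚ ⊗ (n₁ ⊗ m₁) ⊕ 1ℚ ⊗ (1ℚ ⊗ (n₀ ⊗ m₁) ⊕ 1ℚ ⊗ (n₁ ⊗ m₀)))))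
       ⊕ (1ℚ ⊕ (1ℚ ⊕ 1ℚ)) ⊗ ((h ⊕ h) ⊗ (n₁ ⊗ (m₀ ⊕ m₁) ⊕ (n₀ ⊕ n₁ ⊕ (h ⊕ h) ⊗ n₁) ⊗ m₁))
       ≡ (L ⊕ (1ℚ ⊕ (1ℚ ⊕ 1ℚ))) ⊗ ((n₀ ⊕ (1ℚ ⊕ (h ⊕ h)) ⊗ n₁) ⊗ (m₀ ⊕ (1ℚ ⊕ (h ⊕ h)) ⊗ m₁))
    c₀ = solve-∀ ℚring
    2h : 0ℚ ≤ℚ ih p ⊕ ih p
    2h = 0≤⊕ (0≤ih p) (0≤ih p)
    -- The new part costs 3 (n₀ + n₁)(m₀ + m₁); the slack comes from raising the coefficient of n₁
    -- and m₁ from 1 to 1 + 2h.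
    nrm = ≤-by (3ℚ ⊗ ((ih p ⊕ ih p) ⊗ (n₁ ⊗ (m₀ ⊕ m₁) ⊕ (n₀ ⊕ n₁ ⊕ (ih p ⊕ ih p) ⊗ n₁) ⊗ m₁)))
      (0≤⊗ 0≤3ℚ (0≤⊗ 2h (0≤⊕ (0≤⊗ (0≤nu es _) (0≤⊕ (0≤nu es _) (0≤nu es _)))
         (0≤⊗ (0≤⊕ (0≤⊕ (0≤nu es _) (0≤nu es _)) (0≤⊗ 2h (0≤nu es _))) (0≤nu es _)))))
      (c₀ (3len es) n₀ n₁ m₀ m₁ (ih p))

-- The main term

-- H es φ K = Σ_l φ(K ∸ s(l)) / Π_{p ∣ l} (p-1), over squarefree l composed of primes of es
H : List Entry → (ℕ → ℚ) → ℕ → ℚ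
H []             φ K = φ K
H ((p , s) ∷ es) φ K = H es φ K ⊕ ih p ⊗ H es φ (K ∸ s)

H-mono : ∀ es {φ ψ} K → (∀ v → v ≤ K → φ v ≤ℚ ψ v) → H es φ K ≤ℚ H es ψ K
H-mono []             K h = h K ℕP.≤-refl
H-mono ((p , s) ∷ es) K h = ℚP.+-mono-≤ (H-mono es K h) (⊗-monoʳ (0≤ih p) (H-mono es (K ∸ s) (λ v v≤ → h v (ℕP.≤-trans v≤ (ℕP.m∸n≤m K s)))))

H-cong : ∀ es {φ ψ} K → (∀ v → φ v ≡ ψ v) → H es φ K ≡ H es ψ K
H-cong []             K h = h K
H-cong ((p , s) ∷ es) K h = cong₂ (λ x y → x ⊕ ih p ⊗ y) (H-cong es K h) (H-cong es (K ∸ s) h)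

H-⊕ : ∀ es {φ ψ} K → H es (λ v → φ v ⊕ ψ v) K ≡ H es φ K ⊕ H es ψ K
H-⊕ []             K = refl
H-⊕ ((p , s) ∷ es) {φ} {ψ} K = trans (cong₂ (λ x y → x ⊕ ih p ⊗ y) (H-⊕ es K) (H-⊕ es (K ∸ s)))
    (lem (H es φ K) (H es ψ K) (H es φ (K ∸ s)) (H es ψ (K ∸ s)) (ih p))
  where
  lem : ∀ a b c d h → a ⊕ b ⊕ h ⊗ (c ⊕ d) ≡ a ⊕ h ⊗ c ⊕ (b ⊕ h ⊗ d)
  lem = solve-∀ ℚring

H-⊗ : ∀ es t {φ} K → H es (λ v → t ⊗ φ v) K ≡ t ⊗ H es φ K
H-⊗ []             t K = refl
H-⊗ ((p , s) ∷ es) t {φ} K = trans (cong₂ (λ x y → x ⊕ ih p ⊗ y) (H-⊗ es t K) (H-⊗ es t (K ∸ s))) (lem (H es φ K) (H es φ (K ∸ s)) (ih p) t)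
  where
  lem : ∀ a b h t → t ⊗ a ⊕ h ⊗ (t ⊗ b) ≡ t ⊗ (a ⊕ h ⊗ b)
  lem = solve-∀ ℚring

H-nonneg : ∀ es {φ} K → (∀ v → v ≤ K → 0ℚ ≤ℚ φ v) → 0ℚ ≤ℚ H es φ K
H-nonneg []             K h = h K ℕP.≤-refl
H-nonneg ((p , s) ∷ es) K h = 0≤⊕ (H-nonneg es K h) (0≤⊗ (0≤ih p) (H-nonneg es (K ∸ s) (λ v v≤ → h v (ℕP.≤-trans v≤ (ℕP.m∸n≤m K s)))))

-- Only the term l = 1 is kept; this is where the sieve gives up the growth of Σ h(l).
H-head : ∀ es {φ} K → (∀ v → v ≤ K → 0ℚ ≤ℚ φ v) → φ K ≤ℚ H es φ K
H-head []             K h = ℚP.≤-refl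
H-head ((p , s) ∷ es) K h = ≤-by₂ (H-head es K h) (0≤⊗ (0≤ih p) (H-nonneg es (K ∸ s) (λ v v≤ → h v (ℕP.≤-trans v≤ (ℕP.m∸n≤m K s)))))
  where
  ≤-by₂ : ∀ {a b c} → a ≤ℚ b → 0ℚ ≤ℚ c → a ≤ℚ b ⊕ c
  ≤-by₂ {a} {b} {c} p q = subst (_≤ℚ b ⊕ c) (ℚP.+-identityʳ a) (ℚP.+-mono-≤ p q)

∸-swap : ∀ K i s → K ∸ i ∸ s ≡ K ∸ s ∸ i
∸-swap K i s = trans (ℕP.∸-+-assoc K i s) (trans (cong (K ∸_) (ℕP.+-comm i s)) (sym (ℕP.∸-+-assoc K s i)))

H-shift : ∀ es φ K s → H es (λ v → φ (v ∸ s)) K ≡ H es φ (K ∸ s)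
H-shift []             φ K s = refl
H-shift ((p , t) ∷ es) φ K s = cong₂ (λ x y → x ⊕ ih p ⊗ y) (H-shift es φ K s) (trans (H-shift es φ (K ∸ t) s) (cong (H es φ) (∸-swap K t s)))

A-H : ∀ es K i j → A es (K ∸ i) (K ∸ j) ≡ H es (λ v → ι (v ∸ i) ⊗ ι (v ∸ j)) K
A-H []             K i j = refl
A-H ((p , s) ∷ es) K i j = cong₂ (λ x y → x ⊕ ih p ⊗ y) (A-H es K i j) (trans (cong₂ (A es) (∸-swap K i s) (∸-swap K j s)) (A-H es (K ∸ s) i j))

Φ : List Entry → ℕ → ℚ
Φ []             v = 0ℚ
Φ ((p , s) ∷ es) v = Φ es v ⊕ wt p ⊗ ((ι v ⊖ ι (v ∸ s)) ⊗ (ι v ⊖ ι (v ∸ s)))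

-- Writing l = p l′, the share of p in Σ h(l) v_l s(l) is `ι s ⊗ ih p` times the sum of h(l′) (v_l′
-- ∸ s).
Ψ : List Entry → ℕ → ℚ
Ψ []             v = 0ℚ
Ψ ((p , s) ∷ es) v = Ψ es v ⊕ ι s ⊗ ih p ⊗ ι (v ∸ s)

sq : ℕ → ℚ
sq v = ι v ⊗ ι v

0≤wt : ∀ p → 0ℚ ≤ℚ wt p
0≤wt p = 0≤⊕ (0≤iv p) (0≤⊕ (0≤⊗ (0≤iv p) (0≤iv p)) (0≤⊗ (0≤iv p) (0≤iv p)))

0≤² : ∀ {a b} → b ≤ℚ a → 0ℚ ≤ℚ (a ⊖ b) ⊗ (a ⊖ b)
0≤² le = 0≤⊗ (0≤⊖ le) (0≤⊖ le)

-- In `B` the square for p meets only those l that p does not divide, while `H` pairs it with all l;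
-- the surplus is `ih p` times a sum of squares.
B≤HΦ : ∀ es K → B es K K ≤ℚ H es (Φ es) K
B≤HΦ []             K = ℚP.≤-refl
B≤HΦ ((p , s) ∷ es) K = ℚP.≤-trans
    (ℚP.+-mono-≤ (ℚP.+-mono-≤ (B≤HΦ es K) (⊗-monoʳ (0≤ih p) (B≤HΦ es (K ∸ s)))) (ℚP.≤-reflexive (sym Hq)))
    (≤-by (ih p ⊗ H es q (K ∸ s)) (0≤⊗ (0≤ih p) (H-nonneg es (K ∸ s) (λ v _ → 0≤⊗ (0≤wt p) (0≤² (ι-mono-≤ (ℕP.m∸n≤m v s))))))
      (trans (lem (H es (Φ es) K) (H es (Φ es) (K ∸ s)) (H es q K) (H es q (K ∸ s)) (ih p))
        (sym (cong₂ (λ x y → x ⊕ ih p ⊗ y) (H-⊕ es K) (H-⊕ es (K ∸ s))))))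
  where
  q : ℕ → ℚ
  q v = wt p ⊗ ((ι v ⊖ ι (v ∸ s)) ⊗ (ι v ⊖ ι (v ∸ s)))
  lem : ∀ a b c d h → a ⊕ h ⊗ b ⊕ c ⊕ h ⊗ d ≡ a ⊕ c ⊕ h ⊗ (b ⊕ d)
  lem = solve-∀ ℚring
  expand : ∀ x y → (x ⊖ y) ⊗ (x ⊖ y) ≡ x ⊗ x ⊕ y ⊗ y ⊕ (⊝ 1ℚ) ⊗ (x ⊗ y ⊕ y ⊗ x)
  expand = solve-∀ ℚring
  fold : ∀ x y → x ⊕ (⊝ 1ℚ) ⊗ y ≡ x ⊖ y
  fold = solve-∀ ℚring
  c₁ c₂ c₃ c₄ : ℕ → ℚ
  c₁ v = ι v ⊗ ι v
  c₂ v = ι (v ∸ s) ⊗ ι (v ∸ s)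
  c₃ v = ι v ⊗ ι (v ∸ s)
  c₄ v = ι (v ∸ s) ⊗ ι v
  Hq : H es q K ≡ wt p ⊗ (A es K K ⊕ A es (K ∸ s) (K ∸ s) ⊖ (A es K (K ∸ s) ⊕ A es (K ∸ s) K))
  Hq = trans (H-⊗ es (wt p) K) (cong (wt p ⊗_)
    (trans (H-cong es K (λ v → expand (ι v) (ι (v ∸ s))))
    (trans (H-⊕ es {λ v → c₁ v ⊕ c₂ v} {λ v → (⊝ 1ℚ) ⊗ (c₃ v ⊕ c₄ v)} K)
    (trans (cong₂ _⊕_ (H-⊕ es {c₁} {c₂} K) (trans (H-⊗ es (⊝ 1ℚ) {λ v → c₃ v ⊕ c₄ v} K) (cong ((⊝ 1ℚ) ⊗_) (H-⊕ es {c₃} {c₄} K))))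
    (trans (fold (H es c₁ K ⊕ H es c₂ K) (H es c₃ K ⊕ H es c₄ K))
      (sym (cong₂ _⊖_ (cong₂ _⊕_ (A-H es K 0 0) (A-H es K s s)) (cong₂ _⊕_ (A-H es K 0 s) (A-H es K s 0)))))))))

-- Σ_l (K - v_l) v_l h(l) is the s-moment of the weights v_l h(l), which is bounded prime by prime
moment : ∀ es K → ι K ⊗ H es ι K ≤ℚ H es sq K ⊕ H es (Ψ es) K
moment []             K = ℚP.≤-reflexive (sym (ℚP.+-identityʳ (ι K ⊗ ι K)))
moment ((p , s) ∷ es) K = ℚP.≤-trans
    (ℚP.≤-trans (ℚP.≤-reflexive (l₁ (ι K) (H es ι K) h X))
       -- K ≤ s + (K ∸ s) holds even when s exceeds K. The summand s goes into `Ψ`, the other into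
       -- the induction hypothesis at `K ∸ s`.
       (ℚP.+-mono-≤ (moment es K) (⊗-monoʳ h0 (ℚP.≤-trans (⊗-monoˡ X0 (ℚP.≤-trans (ι-mono-≤ (ℕP.m≤n+m∸n K s)) (ℚP.≤-reflexive (ι-+ s (K ∸ s)))))
          (ℚP.≤-trans (ℚP.≤-reflexive (ℚP.*-distribʳ-+ X (ι s) (ι (K ∸ s)))) (ℚP.+-monoʳ-≤ (ι s ⊗ X) (moment es (K ∸ s))))))))
    (≤-by (h ⊗ H es q (K ∸ s)) (0≤⊗ h0 (H-nonneg es (K ∸ s) (λ v _ → 0≤⊗ (0≤⊗ (0≤ι s) h0) (0≤ι (v ∸ s)))))
      (trans (l₂ (H es sq K) (H es (Ψ es) K) h (ι s) X (H es sq (K ∸ s)) (H es (Ψ es) (K ∸ s)) (H es q (K ∸ s)))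
        (sym (cong₂ (λ x y → H es sq K ⊕ h ⊗ H es sq (K ∸ s) ⊕ (x ⊕ h ⊗ y)) (trans (H-⊕ es K) (cong (H es (Ψ es) K ⊕_) Hq)) (H-⊕ es (K ∸ s))))))
  where
  h X : ℚ
  h = ih p
  X = H es ι (K ∸ s)
  h0 : 0ℚ ≤ℚ h
  h0 = 0≤ih p
  X0 : 0ℚ ≤ℚ X
  X0 = H-nonneg es (K ∸ s) (λ v _ → 0≤ι v)
  q : ℕ → ℚ
  q v = ι s ⊗ h ⊗ ι (v ∸ s)
  Hq : H es q K ≡ ι s ⊗ h ⊗ X
  Hq = trans (H-⊗ es (ι s ⊗ h) {λ v → ι (v ∸ s)} K) (cong (ι s ⊗ h ⊗_) (H-shift es ι K s))
  l₁ : ∀ k a h x → k ⊗ (a ⊕ h ⊗ x) ≡ k ⊗ a ⊕ h ⊗ (k ⊗ x)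
  l₁ = solve-∀ ℚring
  l₂ : ∀ a b h s x c d e → a ⊕ b ⊕ h ⊗ (s ⊗ x ⊕ (c ⊕ d)) ⊕ h ⊗ e ≡ a ⊕ h ⊗ c ⊕ (b ⊕ s ⊗ h ⊗ x ⊕ h ⊗ (d ⊕ e))
  l₂ = solve-∀ ℚring

-- 2 (3v² - Φ) splits as (5v² + Kv - 2Φ - Ψ) + (v² + Ψ - Kv). The second bracket is nonnegative on
-- average by `moment`, and the first is at least θ by hypothesis.
main-term : ∀ es K (θ : ℕ → ℚ) → (∀ v → v ≤ K → 0ℚ ≤ℚ θ v) →
  (∀ v → v ≤ K → θ v ⊕ (Φ es v ⊕ Φ es v ⊕ Ψ es v) ≤ℚ (3ℚ ⊕ 1ℚ ⊕ 1ℚ) ⊗ sq v ⊕ ι K ⊗ ι v) →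
  θ K ≤ℚ (1ℚ ⊕ 1ℚ) ⊗ (3ℚ ⊗ A es K K ⊖ B es K K)
main-term es K θ θ0 hyp = ℚP.≤-trans (H-head es K θ0)
    (≤-by ((H es sq K ⊕ HΨ ⊖ ι K ⊗ H es ι K) ⊕ ((5sq ⊕ ι K ⊗ H es ι K ⊖ (Hθ ⊕ (HΦ ⊕ HΦ ⊕ HΨ))) ⊕ ((HΦ ⊖ B es K K) ⊕ (HΦ ⊖ B es K K))))
       (0≤⊕ (0≤⊖ (moment es K)) (0≤⊕ (0≤⊖ main) (0≤⊕ (0≤⊖ (B≤HΦ es K)) (0≤⊖ (B≤HΦ es K)))))
       (trans (lem Hθ HΦ HΨ (H es sq K) (ι K ⊗ H es ι K) (B es K K)) (cong (λ t → (1ℚ ⊕ 1ℚ) ⊗ (3ℚ ⊗ t ⊖ B es K K)) (sym (A-H es K 0 0)))))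
  where
  Hθ HΦ HΨ 5sq : ℚ
  Hθ = H es θ K
  HΦ = H es (Φ es) K
  HΨ = H es (Ψ es) K
  5sq = (3ℚ ⊕ 1ℚ ⊕ 1ℚ) ⊗ H es sq K
  main : Hθ ⊕ (HΦ ⊕ HΦ ⊕ HΨ) ≤ℚ 5sq ⊕ ι K ⊗ H es ι K
  main = subst₂ _≤ℚ_ (trans (H-⊕ es K) (cong (Hθ ⊕_) (trans (H-⊕ es K) (cong (_⊕ HΨ) (H-⊕ es K)))))
      (trans (H-⊕ es K) (cong₂ _⊕_ (H-⊗ es (3ℚ ⊕ 1ℚ ⊕ 1ℚ) {sq} K) (H-⊗ es (ι K) {ι} K))) (H-mono es K hyp)
  lem : ∀ t φ ψ s m b → t ⊕ ((s ⊕ ψ ⊖ m) ⊕ ((3ℚ ⊕ 1ℚ ⊕ 1ℚ) ⊗ s ⊕ m ⊖ (t ⊕ (φ ⊕ φ ⊕ ψ)) ⊕ ((φ ⊖ b) ⊕ (φ ⊖ b))))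
     ≡ (1ℚ ⊕ 1ℚ) ⊗ (3ℚ ⊗ s ⊖ b)
  lem = solve-∀ ℚring

-- Primes in dyadic classes

ΣL : List ℕ → (ℕ → ℚ) → ℚ
ΣL []       F = 0ℚ
ΣL (p ∷ ps) F = ΣL ps F ⊕ F p

-- primes in [2^j, 2^(j+1)); the classes below 8 are empty since 2, 3, 5, 7 are sifted separately
cls : ℕ → List ℕ
cls j@(suc (suc (suc _))) = filter prime? (applyUpTo (λ i → 2 ^ j + i) (2 ^ j))
cls _                     = []

ent : ℕ → List Entry
ent j = map (λ p → p , j) (cls j)

es : ℕ → List Entry
es zero    = []
es (suc j) = ent (suc j) ++ es j

InClass : ℕ → ℕ → Set
InClass j p = Prime p × 8 ≤ p × 2 ^ j ≤ p × p < 2 ^ suc j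

8≤2^ : ∀ i → 8 ≤ 2 ^ (3 + i)
8≤2^ i = ℕP.^-monoʳ-≤ 2 (ℕP.m≤m+n 3 i)

cls-in : ∀ j → All (InClass j) (cls j)
cls-in zero                    = []
cls-in (suc zero)              = []
cls-in (suc (suc zero))        = []
cls-in j@(suc (suc (suc i)))   = All.zipWith {P = Prime} {Q = Range} (λ { (pr , lo , hi) → pr , ℕP.≤-trans (8≤2^ i) lo , lo , hi })
  ( AllP.all-filter prime? (applyUpTo (λ i → 2 ^ j + i) (2 ^ j))
  , AllP.filter⁺ prime? (AllP.applyUpTo⁺₁ (λ i → 2 ^ j + i) (2 ^ j) (λ {i} lt → ℕP.m≤m+n (2 ^ j) i ,
      subst (2 ^ j + i <_) (cong (2 ^ j +_) (sym (ℕP.+-identityʳ (2 ^ j)))) (ℕP.+-monoʳ-< (2 ^ j) lt))) )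
  where
  Range : ℕ → Set
  Range p = 2 ^ j ≤ p × p < 2 ^ suc j

-- Bounds for Φ and Ψ by partial summation

-- Using h = (1 + h)/p twice gives h = 1/p + (1 + h)/p², and h ≤ 1. Thus one bound for the sums of
-- `τ` serves both Φ and Ψ.
ih≤wt : ∀ {p} → Prime p → ih p ≤ℚ wt p
ih≤wt {p} pr = subst (_≤ℚ wt p) (trans (expand (iv p) (ih p)) (trans (cong (λ t → iv p ⊕ iv p ⊗ t) (iv⊗1+ih pr)) (trans (lem (iv p) (ih p)) (iv⊗1+ih pr))))
   (ℚP.+-monoʳ-≤ (iv p) (ℚP.≤-trans (⊗-monoʳ (0≤⊗ (0≤iv p) (0≤iv p)) (ℚP.+-monoʳ-≤ 1ℚ (ih≤1 pr))) (ℚP.≤-reflexive (two (iv p ⊗ iv p)))))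
  where
  expand : ∀ i h → i ⊕ i ⊗ i ⊗ (1ℚ ⊕ h) ≡ i ⊕ i ⊗ (i ⊗ (1ℚ ⊕ h))
  expand = solve-∀ ℚring
  lem : ∀ i h → i ⊕ i ⊗ h ≡ i ⊗ (1ℚ ⊕ h)
  lem = solve-∀ ℚring
  two : ∀ x → x ⊗ (1ℚ ⊕ 1ℚ) ≡ x ⊕ x
  two = solve-∀ ℚring

τ : ℕ → ℚ
τ j = ι j ⊗ ΣL (cls j) wt

0≤ΣLwt : ∀ ps → 0ℚ ≤ℚ ΣL ps wt
0≤ΣLwt []       = ℚP.≤-refl
0≤ΣLwt (p ∷ ps) = 0≤⊕ (0≤ΣLwt ps) (0≤wt p)

Φ-++ : ∀ ps j es v → Φ (map (λ p → p , j) ps ++ es) v ≡ Φ es v ⊕ ΣL ps wt ⊗ ((ι v ⊖ ι (v ∸ j)) ⊗ (ι v ⊖ ι (v ∸ j)))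
Φ-++ []       j es v = lem (Φ es v) ((ι v ⊖ ι (v ∸ j)) ⊗ (ι v ⊖ ι (v ∸ j)))
  where
  lem : ∀ x y → x ≡ x ⊕ 0ℚ ⊗ y
  lem = solve-∀ ℚring
Φ-++ (p ∷ ps) j es v = trans (cong (_⊕ wt p ⊗ d) (Φ-++ ps j es v)) (lem (Φ es v) (ΣL ps wt) d (wt p))
  where
  d : ℚ
  d = (ι v ⊖ ι (v ∸ j)) ⊗ (ι v ⊖ ι (v ∸ j))
  lem : ∀ x y d w → x ⊕ y ⊗ d ⊕ w ⊗ d ≡ x ⊕ (y ⊕ w) ⊗ d
  lem = solve-∀ ℚring

Ψ-++ : ∀ ps j es v → All Prime ps → Ψ (map (λ p → p , j) ps ++ es) v ≤ℚ Ψ es v ⊕ ι j ⊗ ΣL ps wt ⊗ ι (v ∸ j)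
Ψ-++ []       j es v [] = ℚP.≤-reflexive (lem (Ψ es v) (ι j) (ι (v ∸ j)))
  where
  lem : ∀ x j y → x ≡ x ⊕ j ⊗ 0ℚ ⊗ y
  lem = solve-∀ ℚring
Ψ-++ (p ∷ ps) j es v (pr ∷ prs) = ℚP.≤-trans (ℚP.+-mono-≤ (Ψ-++ ps j es v prs) (⊗-monoˡ (0≤ι (v ∸ j)) (⊗-monoʳ (0≤ι j) (ih≤wt pr))))
    (ℚP.≤-reflexive (lem (Ψ es v) (ι j) (ΣL ps wt) (ι (v ∸ j)) (wt p)))
  where
  lem : ∀ x j y d w → x ⊕ j ⊗ y ⊗ d ⊕ j ⊗ w ⊗ d ≡ x ⊕ j ⊗ (y ⊕ w) ⊗ d
  lem = solve-∀ ℚring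

-- min(v,j)² / j made monotone in j
G : ℕ → ℕ → ℚ
G v j with j ℕP.≤? v
... | yes _ = ι v
... | no _  = ι v ⊗ ι v ⊗ iv j

Δ²≤G : ∀ v j → .{{_ : NonZero j}} → (ι v ⊖ ι (v ∸ j)) ⊗ (ι v ⊖ ι (v ∸ j)) ≤ℚ ι j ⊗ G v j
Δ²≤G v j with j ℕP.≤? v
... | yes j≤v = ℚP.≤-trans (ℚP.≤-reflexive (cong₂ _⊗_ e e)) (⊗-monoʳ (0≤ι j) (ι-mono-≤ j≤v))
  where
  lem : ∀ x y → x ⊖ (x ⊖ y) ≡ y
  lem = solve-∀ ℚring
  e : ι v ⊖ ι (v ∸ j) ≡ ι j
  e = trans (cong (ι v ⊖_) (ι-∸ j≤v)) (lem (ι v) (ι j))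
... | no j≰v = ℚP.≤-reflexive (trans (cong₂ _⊗_ e e) (sym (trans (lem (ι j) (ι v) (iv j)) (trans (cong (ι v ⊗ ι v ⊗_) (ι⊗iv j)) (ℚP.*-identityʳ (ι v ⊗ ι v))))))
  where
  e : ι v ⊖ ι (v ∸ j) ≡ ι v
  e = trans (cong (λ t → ι v ⊖ t) (trans (cong ι (ℕP.m≤n⇒m∸n≡0 (ℕP.<⇒≤ (ℕP.≰⇒> j≰v)))) ι0)) (ℚP.+-identityʳ (ι v))
  lem : ∀ j v i → j ⊗ (v ⊗ v ⊗ i) ≡ v ⊗ v ⊗ (j ⊗ i)
  lem = solve-∀ ℚring

0≤G : ∀ v j → 0ℚ ≤ℚ G v j
0≤G v j with j ℕP.≤? v
... | yes _ = 0≤ι v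
... | no _  = 0≤⊗ (0≤⊗ (0≤ι v) (0≤ι v)) (0≤iv j)

ι⊗iv≤1 : ∀ {v j} → v ≤ j → ι v ⊗ iv j ≤ℚ 1ℚ
ι⊗iv≤1 {v} {zero}  z≤n = ℚP.≤-trans (ℚP.≤-reflexive (trans (cong (_⊗ iv 0) ι0) (ℚP.*-zeroˡ (iv 0)))) 0≤1
ι⊗iv≤1 {v} {suc j} le = ℚP.≤-trans (⊗-monoˡ (0≤iv (suc j)) (ι-mono-≤ le)) (ℚP.≤-reflexive (ι⊗iv (suc j)))

G-anti : ∀ v j → .{{_ : NonZero j}} → G v (suc j) ≤ℚ G v j
G-anti v j@(suc _) with suc j ℕP.≤? v | j ℕP.≤? v
... | yes _ | yes _ = ℚP.≤-refl
... | yes p | no ¬p = ⊥-elim (¬p (ℕP.≤-trans (ℕP.n≤1+n j) p))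
... | no ¬p | yes p = ℚP.≤-trans (ℚP.≤-reflexive (ℚP.*-assoc (ι v) (ι v) (iv (suc j))))
    (ℚP.≤-trans (⊗-monoʳ (0≤ι v) (ι⊗iv≤1 (ℕP.<⇒≤ (ℕP.≰⇒> ¬p)))) (ℚP.≤-reflexive (ℚP.*-identityʳ (ι v))))
... | no _ | no _ = ⊗-monoʳ (0≤⊗ (0≤ι v) (0≤ι v)) (iv-antimono (ℕP.n≤1+n j))

Φ≤ : ∀ Y v → Φ (es Y) v ≤ℚ Sum 1 Y (λ j → τ j ⊗ G v j)
Φ≤ zero    v = ℚP.≤-refl
Φ≤ (suc Y) v = ℚP.≤-trans (ℚP.≤-reflexive (Φ-++ (cls (suc Y)) (suc Y) (es Y) v))
  (ℚP.+-mono-≤ (Φ≤ Y v) (ℚP.≤-trans (⊗-monoʳ (0≤ΣLwt (cls (suc Y))) (Δ²≤G v (suc Y))) (ℚP.≤-reflexive (lem (ΣL (cls (suc Y)) wt) (ι (suc Y)) (G v (suc Y))))))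
  where
  lem : ∀ x y z → x ⊗ (y ⊗ z) ≡ y ⊗ x ⊗ z
  lem = solve-∀ ℚring

Ψ≤ : ∀ Y v → Ψ (es Y) v ≤ℚ Sum 1 Y (λ j → τ j ⊗ ι (v ∸ j))
Ψ≤ zero    v = ℚP.≤-refl
Ψ≤ (suc Y) v = ℚP.≤-trans (Ψ-++ (cls (suc Y)) (suc Y) (es Y) v (All.map proj₁ (cls-in (suc Y))))
  (ℚP.+-monoˡ-≤ (τ (suc Y) ⊗ ι (v ∸ suc Y)) (Ψ≤ Y v))

-- partial summation: only upper bounds for the cumulative sums of x are needed
abel : ∀ (x w : ℕ → ℚ) κ → (∀ j → 0ℚ ≤ℚ w (suc j)) → (∀ j → w (suc (suc j)) ≤ℚ w (suc j)) →
  (∀ n → Sum 1 (suc n) x ≤ℚ ι (suc n) ⊖ κ) → ∀ n → Sum 1 (suc n) (λ j → x j ⊗ w j) ≤ℚ Sum 1 (suc n) w ⊖ κ ⊗ w 1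
abel x w κ w0 wa T n = ≤-by (w (suc n) ⊗ (ι (suc n) ⊖ κ ⊖ Sum 1 (suc n) x) ⊕ (Sum 1 (suc n) w ⊖ κ ⊗ w 1 ⊖ (S n ⊕ w (suc n) ⊗ (ι (suc n) ⊖ κ ⊖ Sum 1 (suc n) x))))
    (0≤⊕ (0≤⊗ (w0 n) (0≤⊖ (T n))) (0≤⊖ (go n))) (fin (S n) (w (suc n) ⊗ (ι (suc n) ⊖ κ ⊖ Sum 1 (suc n) x)) (Sum 1 (suc n) w ⊖ κ ⊗ w 1))
  where
  S : ℕ → ℚ
  S n = Sum 1 (suc n) (λ j → x j ⊗ w j)
  fin : ∀ s t u → s ⊕ (t ⊕ (u ⊖ (s ⊕ t))) ≡ u
  fin = solve-∀ ℚring
  go : ∀ n → S n ⊕ w (suc n) ⊗ (ι (suc n) ⊖ κ ⊖ Sum 1 (suc n) x) ≤ℚ Sum 1 (suc n) w ⊖ κ ⊗ w 1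
  go zero = ℚP.≤-reflexive (trans (cong (λ t → 0ℚ ⊕ x 1 ⊗ w 1 ⊕ w 1 ⊗ (t ⊖ κ ⊖ (0ℚ ⊕ x 1))) ι1) (lem (x 1) (w 1) κ))
    where
    lem : ∀ x w k → 0ℚ ⊕ x ⊗ w ⊕ w ⊗ (1ℚ ⊖ k ⊖ (0ℚ ⊕ x)) ≡ 0ℚ ⊕ w ⊖ k ⊗ w
    lem = solve-∀ ℚring
  go (suc n) = ≤-by (((Sum 1 (suc n) w ⊖ κ ⊗ w 1) ⊖ (S n ⊕ w (suc n) ⊗ (ι (suc n) ⊖ κ ⊖ Sum 1 (suc n) x))) ⊕ (w (suc n) ⊖ w (suc (suc n))) ⊗ (ι (suc n) ⊖ κ ⊖ Sum 1 (suc n) x))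
      (0≤⊕ (0≤⊖ (go n)) (0≤⊗ (0≤⊖ (wa n)) (0≤⊖ (T n))))
      (trans (cong (λ t → S n ⊕ x (suc (suc n)) ⊗ w (suc (suc n)) ⊕ w (suc (suc n)) ⊗ (t ⊖ κ ⊖ (Sum 1 (suc n) x ⊕ x (suc (suc n)))) ⊕ (((Sum 1 (suc n) w ⊖ κ ⊗ w 1) ⊖ (S n ⊕ w (suc n) ⊗ (ι (suc n) ⊖ κ ⊖ Sum 1 (suc n) x))) ⊕ (w (suc n) ⊖ w (suc (suc n))) ⊗ (ι (suc n) ⊖ κ ⊖ Sum 1 (suc n) x))) (ι-suc (suc n)))
        (lem (S n) (x (suc (suc n))) (w (suc n)) (w (suc (suc n))) (ι (suc n)) κ (Sum 1 (suc n) x) (Sum 1 (suc n) w) (κ ⊗ w 1)))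
    where
    lem : ∀ s x w w′ i k t u v → s ⊕ x ⊗ w′ ⊕ w′ ⊗ (1ℚ ⊕ i ⊖ k ⊖ (t ⊕ x)) ⊕ ((u ⊖ v ⊖ (s ⊕ w ⊗ (i ⊖ k ⊖ t))) ⊕ (w ⊖ w′) ⊗ (i ⊖ k ⊖ t)) ≡ u ⊕ w′ ⊖ v
    lem = solve-∀ ℚring

Hm : ℕ → ℚ
Hm n = Sum 1 n iv

ΣG : ∀ v m → Sum 1 (v + m) (G v) ≡ ι v ⊗ ι v ⊕ ι v ⊗ ι v ⊗ (Hm (v + m) ⊖ Hm v)
ΣG v zero = trans (cong (λ t → Sum 1 t (G v)) (ℕP.+-identityʳ v)) (trans (low v ℕP.≤-refl) (trans (lem (ι v) (Hm v)) (cong (λ t → ι v ⊗ ι v ⊕ ι v ⊗ ι v ⊗ (Hm t ⊖ Hm v)) (sym (ℕP.+-identityʳ v)))))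
  where
  lem : ∀ x h → x ⊗ x ≡ x ⊗ x ⊕ x ⊗ x ⊗ (h ⊖ h)
  lem = solve-∀ ℚring
  step : ∀ x y → x ⊗ y ⊕ y ≡ (1ℚ ⊕ x) ⊗ y
  step = solve-∀ ℚring
  Glow : ∀ j → j ≤ v → G v j ≡ ι v
  Glow j le with j ℕP.≤? v
  ... | yes _ = refl
  ... | no ¬p = ⊥-elim (¬p le)
  low : ∀ n → n ≤ v → Sum 1 n (G v) ≡ ι n ⊗ ι v
  low zero    _  = sym (trans (cong (_⊗ ι v) ι0) (ℚP.*-zeroˡ (ι v)))
  low (suc n) le = trans (cong₂ _⊕_ (low n (ℕP.≤-trans (ℕP.n≤1+n n) le)) (Glow (suc n) le)) (trans (step (ι n) (ι v)) (cong (_⊗ ι v) (sym (ι-suc n))))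
ΣG v (suc m) = trans (cong (λ t → Sum 1 t (G v)) (ℕP.+-suc v m)) (trans (cong₂ _⊕_ (ΣG v m) high)
    (trans (lem (ι v) (Hm (v + m)) (Hm v) (iv (suc (v + m)))) (cong (λ t → ι v ⊗ ι v ⊕ ι v ⊗ ι v ⊗ (Hm t ⊖ Hm v)) (sym (ℕP.+-suc v m)))))
  where
  lem : ∀ x a b i → x ⊗ x ⊕ x ⊗ x ⊗ (a ⊖ b) ⊕ x ⊗ x ⊗ i ≡ x ⊗ x ⊕ x ⊗ x ⊗ (a ⊕ i ⊖ b)
  lem = solve-∀ ℚring
  high : G v (suc (v + m)) ≡ ι v ⊗ ι v ⊗ iv (suc (v + m))
  high with suc (v + m) ℕP.≤? v
  ... | yes p = ⊥-elim (ℕP.<-irrefl refl (ℕP.<-≤-trans (s≤s (ℕP.m≤m+n v m)) p))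
  ... | no _ = refl

-- With u = v ∸ n, the left side plus u² - u does not change with n, and u² ≥ u for natural u.
Σ∸ : ∀ v n → Sum 1 n (λ j → ι (v ∸ j)) ⊕ Sum 1 n (λ j → ι (v ∸ j)) ⊕ ι v ≤ℚ ι v ⊗ ι v
Σ∸ v n = ≤-by (ι (v ∸ n) ⊗ ι (v ∸ n) ⊖ ι (v ∸ n) ⊕ (ι v ⊗ ι v ⊖ S n)) (0≤⊕ (u²-u (v ∸ n)) (0≤⊖ (go n)))
    (fin (Sum 1 n (λ j → ι (v ∸ j))) (ι v) (ι (v ∸ n)))
  where
  S : ℕ → ℚ
  S n = Sum 1 n (λ j → ι (v ∸ j)) ⊕ Sum 1 n (λ j → ι (v ∸ j)) ⊕ ι v ⊕ (ι (v ∸ n) ⊗ ι (v ∸ n) ⊖ ι (v ∸ n))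
  fin : ∀ s v u → s ⊕ s ⊕ v ⊕ (u ⊗ u ⊖ u ⊕ (v ⊗ v ⊖ (s ⊕ s ⊕ v ⊕ (u ⊗ u ⊖ u)))) ≡ v ⊗ v
  fin = solve-∀ ℚring
  u²-u : ∀ u → 0ℚ ≤ℚ ι u ⊗ ι u ⊖ ι u
  u²-u zero    = ℚP.≤-reflexive (sym (trans (cong (λ t → t ⊗ t ⊖ t) ι0) refl))
  u²-u (suc u) = subst (0ℚ ≤ℚ_) (trans (lem (ι u)) (cong (λ t → t ⊗ t ⊖ t) (sym (ι-suc u)))) (0≤⊗ (0≤⊕ 0≤1 (0≤ι u)) (0≤ι u))
    where
    lem : ∀ x → (1ℚ ⊕ x) ⊗ x ≡ (1ℚ ⊕ x) ⊗ (1ℚ ⊕ x) ⊖ (1ℚ ⊕ x)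
    lem = solve-∀ ℚring
  go : ∀ n → S n ≤ℚ ι v ⊗ ι v
  go zero = ℚP.≤-reflexive (lem (ι v))
    where
    lem : ∀ v → 0ℚ ⊕ 0ℚ ⊕ v ⊕ (v ⊗ v ⊖ v) ≡ v ⊗ v
    lem = solve-∀ ℚring
  go (suc n) = ℚP.≤-trans (ℚP.≤-reflexive (same (v ∸ n) (v ∸ suc n) (sym (trans (cong (v ∸_) (ℕP.+-comm 1 n)) (sym (ℕP.∸-+-assoc v n 1)))))) (go n)
    where
    s = Sum 1 n (λ j → ι (v ∸ j))
    z : ∀ s v → s ⊕ 0ℚ ⊕ (s ⊕ 0ℚ) ⊕ v ⊕ (0ℚ ⊗ 0ℚ ⊖ 0ℚ) ≡ s ⊕ s ⊕ v ⊕ (0ℚ ⊗ 0ℚ ⊖ 0ℚ)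
    z = solve-∀ ℚring
    z′ : ∀ s v u → s ⊕ u ⊕ (s ⊕ u) ⊕ v ⊕ (u ⊗ u ⊖ u) ≡ s ⊕ s ⊕ v ⊕ ((1ℚ ⊕ u) ⊗ (1ℚ ⊕ u) ⊖ (1ℚ ⊕ u))
    z′ = solve-∀ ℚring
    same : ∀ u u′ → u ∸ 1 ≡ u′ → s ⊕ ι u′ ⊕ (s ⊕ ι u′) ⊕ ι v ⊕ (ι u′ ⊗ ι u′ ⊖ ι u′) ≡ s ⊕ s ⊕ ι v ⊕ (ι u ⊗ ι u ⊖ ι u)
    same zero    _ refl = subst (λ t → s ⊕ t ⊕ (s ⊕ t) ⊕ ι v ⊕ (t ⊗ t ⊖ t) ≡ s ⊕ s ⊕ ι v ⊕ (t ⊗ t ⊖ t)) (sym ι0) (z s (ι v))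
    same (suc u) _ refl = trans (z′ s (ι v) (ι u)) (cong (λ t → s ⊕ s ⊕ ι v ⊕ (t ⊗ t ⊖ t)) (sym (ι-suc u)))

2ℚ 4ℚ 8ℚ ¾ : ℚ
2ℚ = 1ℚ ⊕ 1ℚ
4ℚ = 2ℚ ⊕ 2ℚ
8ℚ = 4ℚ ⊕ 4ℚ
¾ = 1ℚ ⊖ ½ ⊗ ½

ι2 : ι 2 ≡ 2ℚ
ι2 = trans (ι-+ 1 1) (cong₂ _⊕_ ι1 ι1)

ι3 : ι 3 ≡ 3ℚ
ι3 = trans (ι-+ 1 2) (cong₂ _⊕_ ι1 ι2)

ι4 : ι 4 ≡ 4ℚ
ι4 = trans (ι-+ 2 2) (cong₂ _⊕_ ι2 ι2)

ι8 : ι 8 ≡ 8ℚ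
ι8 = trans (ι-+ 4 4) (cong₂ _⊕_ ι4 ι4)

-- E Y K v / 4 is a lower bound for 3v² - Φ(v) + ((K-v)v - Ψ(v))/2.
E : ℕ → ℕ → ℕ → ℚ
E Y K v = (8ℚ ⊕ 2ℚ) ⊗ sq v ⊕ 4ℚ ⊗ (ι K ⊗ ι v) ⊕ (8ℚ ⊕ 3ℚ) ⊗ ι v ⊖ 3ℚ ⊖ 8ℚ ⊗ (sq v ⊗ (Hm Y ⊖ Hm v))

Φ0 : ∀ es → Φ es 0 ≡ 0ℚ
Φ0 []             = refl
Φ0 ((p , s) ∷ es) = trans (cong₂ (λ x y → x ⊕ wt p ⊗ ((ι 0 ⊖ ι y) ⊗ (ι 0 ⊖ ι y))) (Φ0 es) (ℕP.0∸n≡0 s)) (lem (wt p) (ι 0))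
  where
  lem : ∀ w x → 0ℚ ⊕ w ⊗ ((x ⊖ x) ⊗ (x ⊖ x)) ≡ 0ℚ
  lem = solve-∀ ℚring

Ψ0 : ∀ es → Ψ es 0 ≡ 0ℚ
Ψ0 []             = refl
Ψ0 ((p , s) ∷ es) = trans (cong₂ (λ x y → x ⊕ ι s ⊗ ih p ⊗ y) (Ψ0 es) (trans (cong ι (ℕP.0∸n≡0 s)) ι0)) (lem (ι s ⊗ ih p))
  where
  lem : ∀ w → 0ℚ ⊕ w ⊗ 0ℚ ≡ 0ℚ
  lem = solve-∀ ℚring

module _ (mertens : ∀ n → Sum 1 (suc n) τ ≤ℚ ι (suc n) ⊖ ¾) where

  -- In both partial summations the saving ¾ is multiplied by the first weight, which is v for `G v`
  -- and v - 1 for `v ∸ j`.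
  pointwise : ∀ Y v → v ≤ Y → 1 ≤ v → Φ (es Y) v ⊕ Φ (es Y) v ⊕ Ψ (es Y) v
    ≤ℚ 2ℚ ⊗ (sq v ⊕ sq v ⊗ (Hm Y ⊖ Hm v) ⊖ ¾ ⊗ ι v) ⊕ (½ ⊗ (sq v ⊖ ι v) ⊖ ¾ ⊗ (ι v ⊖ 1ℚ))
  pointwise zero zero z≤n ()
  pointwise (suc Y) v v≤Y 1≤v = ℚP.≤-trans (ℚP.+-mono-≤ (ℚP.+-mono-≤ φ φ) ψ)
      (ℚP.≤-reflexive (lem (sq v ⊕ sq v ⊗ (Hm (suc Y) ⊖ Hm v) ⊖ ¾ ⊗ ι v) (½ ⊗ (sq v ⊖ ι v) ⊖ ¾ ⊗ (ι v ⊖ 1ℚ))))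
    where
    lem : ∀ x y → x ⊕ x ⊕ y ≡ 2ℚ ⊗ x ⊕ y
    lem = solve-∀ ℚring
    G1 : G v 1 ≡ ι v
    G1 with 1 ℕP.≤? v
    ... | yes _ = refl
    ... | no ¬p = ⊥-elim (¬p 1≤v)
    φ : Φ (es (suc Y)) v ≤ℚ sq v ⊕ sq v ⊗ (Hm (suc Y) ⊖ Hm v) ⊖ ¾ ⊗ ι v
    φ = ℚP.≤-trans (Φ≤ (suc Y) v) (ℚP.≤-trans (abel τ (G v) ¾ (λ j → 0≤G v (suc j)) (λ j → G-anti v (suc j)) mertens Y)
        (ℚP.≤-reflexive (cong₂ _⊖_ (trans (cong (λ t → Sum 1 t (G v)) (sym e)) (trans (ΣG v (suc Y ∸ v)) (cong (λ t → sq v ⊕ sq v ⊗ (Hm t ⊖ Hm v)) e))) (cong (¾ ⊗_) G1))))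
      where
      e : v + (suc Y ∸ v) ≡ suc Y
      e = ℕP.m+[n∸m]≡n v≤Y
    half : ∀ s v q → s ⊕ s ⊕ v ≤ℚ q → s ≤ℚ ½ ⊗ (q ⊖ v)
    half s v q h = ≤-by (½ ⊗ (q ⊖ (s ⊕ s ⊕ v))) (0≤⊗ (ℚP.nonNegative⁻¹ ½) (0≤⊖ h)) (hl s v q)
      where
      hl : ∀ s v q → s ⊕ ½ ⊗ (q ⊖ (s ⊕ s ⊕ v)) ≡ ½ ⊗ (q ⊖ v)
      hl = solve-∀ ℚring
    ψ : Ψ (es (suc Y)) v ≤ℚ ½ ⊗ (sq v ⊖ ι v) ⊖ ¾ ⊗ (ι v ⊖ 1ℚ)
    ψ = ℚP.≤-trans (Ψ≤ (suc Y) v) (ℚP.≤-trans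
        (abel τ (λ j → ι (v ∸ j)) ¾ (λ j → 0≤ι (v ∸ suc j)) (λ j → ι-mono-≤ (ℕP.∸-monoʳ-≤ v (ℕP.n≤1+n (suc j)))) mertens Y)
        (ℚP.+-mono-≤ (half (Sum 1 (suc Y) (λ j → ι (v ∸ j))) (ι v) (sq v) (Σ∸ v (suc Y)))
           (ℚP.≤-reflexive (cong (λ t → ⊝ (¾ ⊗ t)) (trans (ι-∸ 1≤v) (cong (λ t → ι v ⊖ t) ι1))))))

  mean-bound : ∀ Y K → suc K ≤ Y → (∀ v → 1 ≤ v → v ≤ suc K → 0ℚ ≤ℚ E Y (suc K) v) →
    E Y (suc K) (suc K) ≤ℚ 8ℚ ⊗ (3ℚ ⊗ A (es Y) (suc K) (suc K) ⊖ B (es Y) (suc K) (suc K))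
  mean-bound Y K K≤Y hyp = ≤-by ((2ℚ ⊗ 2ℚ) ⊗ (2ℚ ⊗ D ⊖ ½ ⊗ ½ ⊗ E Y (suc K) (suc K))) (0≤⊗ (ℚP.nonNegative⁻¹ (2ℚ ⊗ 2ℚ)) (0≤⊖ (main-term (es Y) (suc K) θ θ0 bound)))
      (fin (E Y (suc K) (suc K)) D)
    where
    D : ℚ
    D = 3ℚ ⊗ A (es Y) (suc K) (suc K) ⊖ B (es Y) (suc K) (suc K)
    fin : ∀ e d → e ⊕ (2ℚ ⊗ 2ℚ) ⊗ (2ℚ ⊗ d ⊖ ½ ⊗ ½ ⊗ e) ≡ 8ℚ ⊗ d
    fin = solve-∀ ℚring
    θ : ℕ → ℚ
    -- At v = 0 the polynomial `E` would be -3; but Φ and Ψ vanish there, so 0 is admissible.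
    θ zero      = 0ℚ
    θ v@(suc _) = ½ ⊗ ½ ⊗ E Y (suc K) v
    θ0 : ∀ v → v ≤ suc K → 0ℚ ≤ℚ θ v
    θ0 zero    _  = ℚP.≤-refl
    θ0 (suc v) le = 0≤⊗ (ℚP.nonNegative⁻¹ (½ ⊗ ½)) (hyp (suc v) (s≤s z≤n) le)
    id : ∀ v k L → ½ ⊗ ½ ⊗ ((8ℚ ⊕ 2ℚ) ⊗ (v ⊗ v) ⊕ 4ℚ ⊗ (k ⊗ v) ⊕ (8ℚ ⊕ 3ℚ) ⊗ v ⊖ 3ℚ ⊖ 8ℚ ⊗ (v ⊗ v ⊗ L))
       ⊕ (2ℚ ⊗ (v ⊗ v ⊕ v ⊗ v ⊗ L ⊖ ¾ ⊗ v) ⊕ (½ ⊗ (v ⊗ v ⊖ v) ⊖ ¾ ⊗ (v ⊖ 1ℚ)))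
       ≡ (3ℚ ⊕ 1ℚ ⊕ 1ℚ) ⊗ (v ⊗ v) ⊕ k ⊗ v
    id = solve-∀ ℚring
    bound : ∀ v → v ≤ suc K → θ v ⊕ (Φ (es Y) v ⊕ Φ (es Y) v ⊕ Ψ (es Y) v) ≤ℚ (3ℚ ⊕ 1ℚ ⊕ 1ℚ) ⊗ sq v ⊕ ι (suc K) ⊗ ι v
    bound zero    _  = ℚP.≤-trans (ℚP.≤-reflexive (cong₂ (λ x y → 0ℚ ⊕ (x ⊕ x ⊕ y)) (Φ0 (es Y)) (Ψ0 (es Y))))
                         (0≤⊕ (0≤⊗ (ℚP.nonNegative⁻¹ (3ℚ ⊕ 1ℚ ⊕ 1ℚ)) (0≤⊗ (0≤ι 0) (0≤ι 0))) (0≤⊗ (0≤ι (suc K)) (0≤ι 0)))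
    bound v@(suc _) le = ℚP.≤-trans (ℚP.+-monoʳ-≤ (θ v) (pointwise Y v (ℕP.≤-trans le K≤Y) (s≤s z≤n))) (ℚP.≤-reflexive (id (ι v) (ι (suc K)) (Hm Y ⊖ Hm v)))

cls-unique : ∀ j → Unique (cls j)
cls-unique zero                  = []
cls-unique (suc zero)            = []
cls-unique (suc (suc zero))      = []
cls-unique j@(suc (suc (suc _))) = UP.filter⁺ prime? (UP.applyUpTo⁺₁ (λ i → 2 ^ j + i) (2 ^ j) (λ i<k _ e → ℕP.<⇒≢ i<k (ℕP.+-cancelˡ-≡ (2 ^ j) _ _ e)))

es-in : ∀ Y → All (λ q → Prime q × 8 ≤ q × q < 2 ^ suc Y) (map proj₁ (es Y))
es-in zero    = []
es-in (suc Y) = go (cls (suc Y)) (All.map (λ { (pr , e , _ , hi) → pr , e , hi }) (cls-in (suc Y)))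
  where
  go : ∀ ps → All (λ q → Prime q × 8 ≤ q × q < 2 ^ suc (suc Y)) ps → All (λ q → Prime q × 8 ≤ q × q < 2 ^ suc (suc Y)) (map proj₁ (map (λ p → p , suc Y) ps ++ es Y))
  go []       []       = All.map (λ { (pr , e , hi) → pr , e , ℕP.<-≤-trans hi (ℕP.^-monoʳ-≤ 2 (ℕP.n≤1+n (suc Y))) }) (es-in Y)
  go (p ∷ ps) (h ∷ hs) = h ∷ go ps hs

good : ∀ Y → Good (es Y)
good zero    = []
good (suc Y) = go (cls (suc Y)) (cls-in (suc Y)) (cls-unique (suc Y))
  where
  dist : ∀ {p} ps → InClass (suc Y) p → All (InClass (suc Y)) ps → All (p ≢_) ps → Distinct p (map proj₁ (map (λ q → q , suc Y) ps ++ es Y))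
  dist []       (_ , _ , lo , _) []       []       = All.map (λ { (pr , _ , hi) → pr , λ e → ℕP.<-irrefl e (ℕP.<-≤-trans hi lo) }) (es-in Y)
  dist (q ∷ ps) h (h′ ∷ hs) (p≢q ∷ us) = (proj₁ h′ , λ e → p≢q (sym e)) ∷ dist ps h hs us
  go : ∀ ps → All (InClass (suc Y)) ps → Unique ps → Good (map (λ q → q , suc Y) ps ++ es Y)
  go []       []       []       = good Y
  go (p ∷ ps) (h ∷ hs) (u ∷ us) = (proj₁ h , dist ps h hs u) ∷ go ps hs us

-- Positivity of the sifted sum

≤! : ∀ m n → {T (m ≤ᵇ n)} → m ≤ n
≤! m n {t} = ℕP.≤ᵇ⇒≤ m n t

prime2 : Prime 2
prime2 = toWitness {a? = prime? 2} tt
prime3 : Prime 3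
prime3 = toWitness {a? = prime? 3} tt
prime5 : Prime 5
prime5 = toWitness {a? = prime? 5} tt
prime7 : Prime 7
prime7 = toWitness {a? = prime? 7} tt

-- The integers prime to 210 have density 8/35.
scale35 : ∀ x → ι 35 ⊗ ((1ℚ ⊖ iv 2) ⊗ ((1ℚ ⊖ iv 3) ⊗ ((1ℚ ⊖ iv 5) ⊗ ((1ℚ ⊖ iv 7) ⊗ x)))) ≡ 8ℚ ⊗ x
scale35 x = ι⊗-cancel 6 (trans (split 6 35 V₂) (trans (cong (_⊗ V₂) (trans (ι-* 105 2) (cong (_⊗ ι 2) (trans (ι-* 35 3) (cong (_⊗ ι 3) (ι-* 7 5))))))
    (trans (a₁ (ι 7) (ι 5) (ι 3) (ι 2) V₂) (trans (cong (λ t → ι 7 ⊗ (ι 5 ⊗ (ι 3 ⊗ t))) (peel 1 V₃))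
    (trans (cong (λ t → ι 7 ⊗ (ι 5 ⊗ t)) (swap (ι 3) (ι 1) V₃)) (trans (cong (λ t → ι 7 ⊗ (ι 5 ⊗ (ι 1 ⊗ t))) (peel 2 V₅))
    (trans (cong (ι 7 ⊗_) (a₂ (ι 5) (ι 1) (ι 2) V₅)) (trans (cong (λ t → ι 7 ⊗ (ι 1 ⊗ ι 2 ⊗ t)) (peel 4 V₇))
    (trans (a₃ (ι 7) (ι 1) (ι 2) (ι 4) V₇) (trans (cong (λ t → ι 1 ⊗ ι 2 ⊗ ι 4 ⊗ t) (peel 6 x))
    (trans (sym (ℚP.*-assoc (ι 1 ⊗ ι 2 ⊗ ι 4) (ι 6) x)) (trans (cong (λ t → t ⊗ ι 6 ⊗ x) (trans (cong (_⊗ ι 4) (sym (ι-* 1 2))) (trans (sym (ι-* 2 4)) ι8)))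
    (a₄ 8ℚ (ι 6) x)))))))))))))
  where
  V₇ V₅ V₃ V₂ : ℚ
  V₇ = (1ℚ ⊖ iv 7) ⊗ x
  V₅ = (1ℚ ⊖ iv 5) ⊗ V₇
  V₃ = (1ℚ ⊖ iv 3) ⊗ V₅
  V₂ = (1ℚ ⊖ iv 2) ⊗ V₃
  split : ∀ m n y → ι m ⊗ (ι n ⊗ y) ≡ ι (m * n) ⊗ y
  split m n y = trans (sym (ℚP.*-assoc (ι m) (ι n) y)) (cong (_⊗ y) (sym (ι-* m n)))
  a₁ : ∀ a b c d y → a ⊗ b ⊗ c ⊗ d ⊗ y ≡ a ⊗ (b ⊗ (c ⊗ (d ⊗ y)))
  a₁ = solve-∀ ℚring
  swap : ∀ a b y → a ⊗ (b ⊗ y) ≡ b ⊗ (a ⊗ y)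
  swap = solve-∀ ℚring
  a₂ : ∀ a b c y → a ⊗ (b ⊗ (c ⊗ y)) ≡ b ⊗ c ⊗ (a ⊗ y)
  a₂ = solve-∀ ℚring
  a₃ : ∀ a b c d y → a ⊗ (b ⊗ c ⊗ (d ⊗ y)) ≡ b ⊗ c ⊗ d ⊗ (a ⊗ y)
  a₃ = solve-∀ ℚring
  a₄ : ∀ a b y → a ⊗ b ⊗ y ≡ b ⊗ (a ⊗ y)
  a₄ = solve-∀ ℚring
  p₁ : ∀ a b y → a ⊗ ((1ℚ ⊖ b) ⊗ y) ≡ (a ⊖ a ⊗ b) ⊗ y
  p₁ = solve-∀ ℚring
  p₂ : ∀ a → 1ℚ ⊕ a ⊖ 1ℚ ≡ a
  p₂ = solve-∀ ℚring
  peel : ∀ n y → ι (suc n) ⊗ ((1ℚ ⊖ iv (suc n)) ⊗ y) ≡ ι n ⊗ y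
  peel n y = trans (p₁ (ι (suc n)) (iv (suc n)) y) (cong (_⊗ y) (trans (cong₂ _⊖_ (ι-suc n) (ι⊗iv (suc n))) (p₂ (ι n))))

module _ where
  private
    fold-ind : ∀ q a x → 0ℚ <ℚ (1ℚ ⊖ ind q a) ⊗ x → q ∤ a × 0ℚ <ℚ x
    fold-ind q a x h with q ∣? a
    ... | yes _ = ⊥-elim (ℚP.<-irrefl refl (subst (0ℚ <ℚ_) (ℚP.*-zeroˡ x) h))
    ... | no ¬p = ¬p , subst (0ℚ <ℚ_) (ℚP.*-identityˡ x) h

    weight : ∀ y W → 0ℚ <ℚ 3ℚ ⊗ (y ⊗ y ⊗ 1ℚ) ⊕ (⊝ 1ℚ) ⊗ (y ⊗ y ⊗ W) → W <ℚ 3ℚ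
    weight y W h with W ℚP.<? 3ℚ
    ... | yes p = p
    ... | no ¬p = ⊥-elim (ℚP.<-irrefl refl (ℚP.<-≤-trans h (≤-by (y ⊗ y ⊗ (W ⊖ 3ℚ)) (0≤⊗ (0≤sq y) (0≤⊖ (ℚP.≮⇒≥ ¬p))) (lem y W))))
      where
      lem : ∀ y W → 3ℚ ⊗ (y ⊗ y ⊗ 1ℚ) ⊕ (⊝ 1ℚ) ⊗ (y ⊗ y ⊗ W) ⊕ y ⊗ y ⊗ (W ⊖ 3ℚ) ≡ 0ℚ
      lem = solve-∀ ℚring
      neg² : ∀ y → (⊝ y) ⊗ (⊝ y) ≡ y ⊗ y
      neg² = solve-∀ ℚring
      0≤sq : ∀ y → 0ℚ ≤ℚ y ⊗ y
      0≤sq y with ℚP.≤-total 0ℚ y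
      ... | inj₁ p = 0≤⊗ p p
      ... | inj₂ p = subst (0ℚ ≤ℚ_) (neg² y) (0≤⊗ (ℚP.neg-antimono-≤ p) (ℚP.neg-antimono-≤ p))

  -- The error of 3f² - f²W is at most (3 + `3len`) nu², times 16 for the sifting by four primes;
  -- clearing the denominator of the density 8/35 turns 16 into 560 and leaves the factor 8 on the
  -- main term.
  sieve : ∀ b N Y K → ι 560 ⊗ ((3ℚ ⊕ 3len (es Y)) ⊗ (nu (es Y) K ⊗ nu (es Y) K)) <ℚ ι N ⊗ (8ℚ ⊗ (3ℚ ⊗ A (es Y) K K ⊖ B (es Y) K K)) →
    Σ[ a ∈ ℕ ] suc b ≤ a × a < suc b + N × (2 ∤ a × 3 ∤ a × 5 ∤ a × 7 ∤ a) × W (es Y) a <ℚ 3ℚ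
  sieve b N Y K hyp = finish (Sum-pos (suc b) N pos)
    where
    open Approx b N
    open Densities b N
    n² : ℚ
    n² = nu (es Y) K ⊗ nu (es Y) K
    D : ℚ
    D = 3ℚ ⊗ A (es Y) K K ⊕ (⊝ 1ℚ) ⊗ B (es Y) K K
    R : ℚ
    R = 3ℚ ⊗ (1ℚ ⊗ n²) ⊕ 1ℚ ⊗ (3len (es Y) ⊗ n²)
    dst : ∀ {q} → q < 8 → Distinct q (map proj₁ (es Y))
    dst q<8 = All.map (λ { (pr , le , _) → pr , λ e → ℕP.<-irrefl (sym e) (ℕP.<-≤-trans q<8 le) }) (es-in Y)
    F : ℕ → ℚ
    F a = (1ℚ ⊖ ind 2 a) ⊗ ((1ℚ ⊖ ind 3 a) ⊗ ((1ℚ ⊖ ind 5 a) ⊗ ((1ℚ ⊖ ind 7 a) ⊗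
      (3ℚ ⊗ (f (es Y) K a ⊗ f (es Y) K a ⊗ 1ℚ) ⊕ (⊝ 1ℚ) ⊗ (f (es Y) K a ⊗ f (es Y) K a ⊗ W (es Y) a)))))
    V : ℚ
    V = (1ℚ ⊖ iv 2) ⊗ ((1ℚ ⊖ iv 3) ⊗ ((1ℚ ⊖ iv 5) ⊗ ((1ℚ ⊖ iv 7) ⊗ D)))
    total : App (2 ∷ 3 ∷ 5 ∷ 7 ∷ map proj₁ (es Y)) F V (R ⊕ R ⊕ (R ⊕ R) ⊕ (R ⊕ R ⊕ (R ⊕ R)) ⊕ (R ⊕ R ⊕ (R ⊕ R) ⊕ (R ⊕ R ⊕ (R ⊕ R))))
    total = app-sift prime2 ((prime3 , λ ()) ∷ (prime5 , λ ()) ∷ (prime7 , λ ()) ∷ dst (≤! 3 8))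
           (app-sift prime3 ((prime5 , λ ()) ∷ (prime7 , λ ()) ∷ dst (≤! 4 8))
           (app-sift prime5 ((prime7 , λ ()) ∷ dst (≤! 6 8))
           (app-sift prime7 (dst (≤! 8 8))
             (app-⊕ (app-⊗ 3ℚ 0≤3ℚ (app-A (good Y) K K)) (app-⊝ 1ℚ 0≤1 (app-B (good Y) K K))))))
    ¬∣1 : ∀ {q} → Prime q → ¬ q ∣ 1
    ¬∣1 pr h = PrimeP.¬prime[1] (subst Prime (∣P.∣1⇒≡1 h) pr)
    cop : All (λ p → ¬ p ∣ 1) (2 ∷ 3 ∷ 5 ∷ 7 ∷ map proj₁ (es Y))
    cop = ¬∣1 prime2 ∷ ¬∣1 prime3 ∷ ¬∣1 prime5 ∷ ¬∣1 prime7 ∷ All.map (λ { (pr , _) → ¬∣1 pr }) (es-in Y)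
    R16 : ℚ
    R16 = R ⊕ R ⊕ (R ⊕ R) ⊕ (R ⊕ R ⊕ (R ⊕ R)) ⊕ (R ⊕ R ⊕ (R ⊕ R) ⊕ (R ⊕ R ⊕ (R ⊕ R)))
    lower : ⊝ R16 ≤ℚ Sum (suc b) N F ⊖ ι N ⊗ V
    lower = ∣∣-lower (subst₂ (λ x y → ∣ x ⊖ ι N ⊗ y ∣ ≤ℚ R16)
       (Sum-cong (suc b) N (λ a → trans (cong (_⊗ F a) (ind-yes (∣P.1∣ a))) (ℚP.*-identityˡ (F a)))) (trans (cong (_⊗ V) iv1) (ℚP.*-identityˡ V)) (total 1 cop))
    ι16 : ∀ x → ι 16 ⊗ x ≡ x ⊕ x ⊕ (x ⊕ x) ⊕ (x ⊕ x ⊕ (x ⊕ x)) ⊕ (x ⊕ x ⊕ (x ⊕ x) ⊕ (x ⊕ x ⊕ (x ⊕ x)))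
    ι16 x = trans (cong (_⊗ x) (trans (ι-+ 8 8) (cong (λ t → t ⊕ t) (trans (ι-+ 4 4) (cong (λ t → t ⊕ t) (trans (ι-+ 2 2) (cong (λ t → t ⊕ t) ι2))))))) (lem x)
      where
      lem : ∀ x → (2ℚ ⊕ 2ℚ ⊕ 4ℚ ⊕ 8ℚ) ⊗ x
        ≡ x ⊕ x ⊕ (x ⊕ x) ⊕ (x ⊕ x ⊕ (x ⊕ x)) ⊕ (x ⊕ x ⊕ (x ⊕ x) ⊕ (x ⊕ x ⊕ (x ⊕ x)))
      lem = solve-∀ ℚring
    big : R16 <ℚ ι N ⊗ V
    big = ⊗-cancel-< (ι 35) (0<ι 35) (subst₂ _<ℚ_
        (trans (cong (_⊗ ((3ℚ ⊕ 3len (es Y)) ⊗ n²)) (ι-* 35 16)) (trans (l₁ (ι 35) (ι 16) (3len (es Y)) n²) (cong (ι 35 ⊗_) (ι16 R))))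
        (trans (cong (λ t → ι N ⊗ (8ℚ ⊗ t)) (l₂ (3ℚ ⊗ A (es Y) K K) (B (es Y) K K))) (trans (cong (ι N ⊗_) (sym (scale35 D))) (l₃ (ι N) (ι 35) V)))
        hyp)
      where
      l₁ : ∀ a c l n → a ⊗ c ⊗ ((3ℚ ⊕ l) ⊗ n) ≡ a ⊗ (c ⊗ (3ℚ ⊗ (1ℚ ⊗ n) ⊕ 1ℚ ⊗ (l ⊗ n)))
      l₁ = solve-∀ ℚring
      l₂ : ∀ x y → x ⊖ y ≡ x ⊕ (⊝ 1ℚ) ⊗ y
      l₂ = solve-∀ ℚring
      l₃ : ∀ n c v → n ⊗ (c ⊗ v) ≡ c ⊗ (n ⊗ v)
      l₃ = solve-∀ ℚring
    pos : 0ℚ <ℚ Sum (suc b) N F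
    pos = subst₂ _<ℚ_ (ℚP.+-inverseˡ R16) (l₄ (Sum (suc b) N F) (ι N ⊗ V)) (ℚP.+-mono-≤-< lower big)
      where
      l₄ : ∀ s v → s ⊖ v ⊕ v ≡ s
      l₄ = solve-∀ ℚring
    finish : Σ[ a ∈ ℕ ] suc b ≤ a × a < suc b + N × 0ℚ <ℚ F a →
      Σ[ a ∈ ℕ ] suc b ≤ a × a < suc b + N × (2 ∤ a × 3 ∤ a × 5 ∤ a × 7 ∤ a) × W (es Y) a <ℚ 3ℚ
    finish (a , lo , hi , p) = a , lo , hi , (proj₁ s₂ , proj₁ s₃ , proj₁ s₅ , proj₁ s₇) , weight (f (es Y) K a) (W (es Y) a) (proj₂ s₇)
      where
      x₇ x₅ x₃ x₂ : ℚ
      x₇ = 3ℚ ⊗ (f (es Y) K a ⊗ f (es Y) K a ⊗ 1ℚ) ⊕ (⊝ 1ℚ) ⊗ (f (es Y) K a ⊗ f (es Y) K a ⊗ W (es Y) a)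
      x₅ = (1ℚ ⊖ ind 7 a) ⊗ x₇
      x₃ = (1ℚ ⊖ ind 5 a) ⊗ x₅
      x₂ = (1ℚ ⊖ ind 3 a) ⊗ x₃
      s₂ = fold-ind 2 a x₂ p
      s₃ = fold-ind 3 a x₃ (proj₂ s₂)
      s₅ = fold-ind 5 a x₅ (proj₂ s₃)
      s₇ = fold-ind 7 a x₇ (proj₂ s₅)

-- From the weight to the number of prime factors

es-∋ : ∀ Y q → Prime q → 8 ≤ q → q < 2 ^ suc Y → q ∈ map proj₁ (es Y)
es-∋ zero    q pr e hi = ⊥-elim (ℕP.<-irrefl refl (ℕP.<-≤-trans hi (ℕP.≤-trans (ℕP.≤ᵇ⇒≤ 2 8 tt) e)))
es-∋ (suc Y) q pr e hi with q ℕP.<? 2 ^ suc Y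
... | yes lt = subst (q ∈_) (sym (LP.map-++ proj₁ (ent (suc Y)) (es Y))) (MP.∈-++⁺ʳ (map proj₁ (ent (suc Y))) (es-∋ Y q pr e lt))
... | no ge = subst (q ∈_) (sym (LP.map-++ proj₁ (ent (suc Y)) (es Y))) (MP.∈-++⁺ˡ (MP.∈-map⁺ proj₁ (MP.∈-map⁺ (λ p → p , suc Y) (in-cls Y hi (ℕP.≮⇒≥ ge)))))
  where
  in-cls : ∀ Y → q < 2 ^ suc (suc Y) → 2 ^ suc Y ≤ q → q ∈ cls (suc Y)
  in-cls zero          hi lo = ⊥-elim (ℕP.<-irrefl refl (ℕP.<-≤-trans hi (ℕP.≤-trans (ℕP.≤ᵇ⇒≤ 4 8 tt) e)))
  in-cls (suc zero)    hi lo = ⊥-elim (ℕP.<-irrefl refl (ℕP.<-≤-trans hi e))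
  in-cls (suc (suc Y)) hi lo = MP.∈-filter⁺ prime? (subst (_∈ applyUpTo (λ i → 2 ^ j + i) (2 ^ j)) (ℕP.m+[n∸m]≡n lo)
      (MP.∈-applyUpTo⁺ (λ i → 2 ^ j + i) (ℕP.+-cancelˡ-< (2 ^ j) (q ∸ 2 ^ j) (2 ^ j) (subst₂ _<_ (sym (ℕP.m+[n∸m]≡n lo)) (cong (2 ^ j +_) (ℕP.+-identityʳ (2 ^ j))) hi)))) pr
    where
    j : ℕ
    j = suc (suc (suc Y))

0≤w : ∀ p a → 0ℚ ≤ℚ w p a
0≤w p a = 0≤⊕ (0≤ind p a) (0≤⊕ (0≤ind (p * p) a) (0≤ind (p * p) a))

1≤w : ∀ {p a} → p ∣ a → 1ℚ ≤ℚ w p a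
1≤w {p} {a} h = ≤-by (ind (p * p) a ⊕ ind (p * p) a) (0≤⊕ (0≤ind (p * p) a) (0≤ind (p * p) a)) (cong (_⊕ (ind (p * p) a ⊕ ind (p * p) a)) (sym (ind-yes h)))

0≤W : ∀ es a → 0ℚ ≤ℚ W es a
0≤W []             a = ℚP.≤-refl
0≤W ((p , s) ∷ es) a = 0≤⊕ (0≤W es a) (0≤w p a)

⊕-mono : ∀ {a b c d} → a ≤ℚ b → c ≤ℚ d → a ⊕ c ≤ℚ b ⊕ d
⊕-mono = ℚP.+-mono-≤

W≥² : ∀ es {q a} → q ∈ map proj₁ es → q * q ∣ a → 3ℚ ≤ℚ W es a
W≥² ((p , s) ∷ es) {q} {a} (here refl) h = ℚP.≤-trans (ℚP.≤-reflexive (sym (cong₂ (λ x y → 0ℚ ⊕ (x ⊕ (y ⊕ y))) (ind-yes (∣P.∣-trans (∣P.m∣m*n {q} q) h)) (ind-yes h)))) (⊕-mono (0≤W es a) ℚP.≤-refl)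
W≥² ((p , s) ∷ es) {q} {a} (there m)   h = ⊕-mono {3ℚ} {W es a} {0ℚ} (W≥² es m h) (0≤w p a)

W≥₁ : ∀ es {q a} → q ∈ map proj₁ es → q ∣ a → 1ℚ ≤ℚ W es a
W≥₁ ((p , s) ∷ es) {q} {a} (here refl) h = ⊕-mono {0ℚ} {W es a} {1ℚ} (0≤W es a) (1≤w h)
W≥₁ ((p , s) ∷ es) {q} {a} (there m)   h = ⊕-mono {1ℚ} {W es a} {0ℚ} (W≥₁ es m h) (0≤w p a)

W≥₂ : ∀ es {q r a} → q ≢ r → q ∈ map proj₁ es → r ∈ map proj₁ es → q ∣ a → r ∣ a → 2ℚ ≤ℚ W es a
W≥₂ (_ ∷ es)           ne (here refl) (here refl) h k = ⊥-elim (ne refl)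
W≥₂ (_ ∷ es) {a = a}   ne (here refl) (there m)   h k = ⊕-mono {1ℚ} {W es a} {1ℚ} (W≥₁ es m k) (1≤w h)
W≥₂ (_ ∷ es) {a = a}   ne (there m)   (here refl) h k = ⊕-mono {1ℚ} {W es a} {1ℚ} (W≥₁ es m h) (1≤w k)
W≥₂ ((p , s) ∷ es) {a = a} ne (there m) (there n) h k = ⊕-mono {2ℚ} {W es a} {0ℚ} (W≥₂ es ne m n h k) (0≤w p a)

W≥₃ : ∀ es {q r t a} → q ≢ r → q ≢ t → r ≢ t → q ∈ map proj₁ es → r ∈ map proj₁ es → t ∈ map proj₁ es → q ∣ a → r ∣ a → t ∣ a → 3ℚ ≤ℚ W es a
W≥₃ (_ ∷ es)         qr qt rt (here refl) (here refl) _ h k l = ⊥-elim (qr refl)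
W≥₃ (_ ∷ es)         qr qt rt (here refl) (there _) (here refl) h k l = ⊥-elim (qt refl)
W≥₃ (_ ∷ es)         qr qt rt (there _) (here refl) (here refl) h k l = ⊥-elim (rt refl)
W≥₃ (_ ∷ es) {a = a} qr qt rt (here refl) (there m) (there n) h k l = ⊕-mono {2ℚ} {W es a} {1ℚ} (W≥₂ es rt m n k l) (1≤w h)
W≥₃ (_ ∷ es) {a = a} qr qt rt (there m) (here refl) (there n) h k l = ⊕-mono {2ℚ} {W es a} {1ℚ} (W≥₂ es qt m n h l) (1≤w k)
W≥₃ (_ ∷ es) {a = a} qr qt rt (there m) (there n) (here refl) h k l = ⊕-mono {2ℚ} {W es a} {1ℚ} (W≥₂ es qr m n h k) (1≤w l)
W≥₃ ((p , s) ∷ es) {a = a} qr qt rt (there m) (there n) (there o) h k l = ⊕-mono {3ℚ} {W es a} {0ℚ} (W≥₃ es qr qt rt m n o h k l) (0≤w p a)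

-- Of the primes at least y only the number k is needed, since y^k is bounded by the product. Those
-- below y are kept with repetition, so that a repeated prime shows up as a square divisor.
small : ∀ y ps → All Prime ps → Σ[ qs ∈ List ℕ ] Σ[ k ∈ ℕ ] All (λ q → Prime q × q < y) qs × product qs ∣ product ps × y ^ k ≤ product ps × length ps ≡ k + length qs
small y []       []         = [] , 0 , [] , ∣P.∣-refl , s≤s z≤n , refl
small y (p ∷ ps) (pr ∷ prs) with small y ps prs | p ℕP.<? y
... | qs , k , al , dv , le , ln | yes lt = p ∷ qs , k , (pr , lt) ∷ al , ∣P.*-monoʳ-∣ p dv
    , ℕP.≤-trans le (ℕP.m≤n*m (product ps) p {{prime⇒nonZero pr}}) , trans (cong suc ln) (sym (ℕP.+-suc k (length qs)))
... | qs , k , al , dv , le , ln | no ge = qs , suc k , al , ∣P.∣-trans dv (∣P.n∣m*n p)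
    , ℕP.*-mono-≤ (ℕP.≮⇒≥ ge) le , cong suc ln

Ω≤4 : ℕ → Set
Ω≤4 a = Σ ℕ λ k → Ω a k × k ≤ 4

factored : ∀ a → .{{_ : NonZero a}} → (∀ ps → All Prime ps → product ps ≡ a → length ps ≤ 4) → Ω≤4 a
factored a h = length ps , (ps , pr , sym e , refl) , h ps pr (sym e)
  where
  open PrimeFactorisation (factorise a) renaming (factors to ps; isFactorisation to e; factorsPrime to pr)

prime≥8 : ∀ {q a} → Prime q → q ∣ a → 2 ∤ a × 3 ∤ a × 5 ∤ a × 7 ∤ a → 8 ≤ q
prime≥8 {0} pr _ _ = ⊥-elim (PrimeP.¬prime[0] pr)
prime≥8 {1} pr _ _ = ⊥-elim (PrimeP.¬prime[1] pr)
prime≥8 {2} _ h (n , _) = ⊥-elim (n h)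
prime≥8 {3} _ h (_ , n , _) = ⊥-elim (n h)
prime≥8 {4} pr _ _ = ⊥-elim (PrimeP.composite⇒¬prime (toWitness {a? = PrimeP.composite? 4} tt) pr)
prime≥8 {5} _ h (_ , _ , n , _) = ⊥-elim (n h)
prime≥8 {6} pr _ _ = ⊥-elim (PrimeP.composite⇒¬prime (toWitness {a? = PrimeP.composite? 6} tt) pr)
prime≥8 {7} _ h (_ , _ , _ , n) = ⊥-elim (n h)
prime≥8 {suc (suc (suc (suc (suc (suc (suc (suc q)))))))} _ _ _ = ℕP.m≤m+n 8 q

sieved⇒Ω≤4 : ∀ Y a → .{{_ : NonZero a}} → a < (2 ^ suc Y) ^ 3 → (2 ∤ a × 3 ∤ a × 5 ∤ a × 7 ∤ a) → W (es Y) a <ℚ 3ℚ → Ω≤4 a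
sieved⇒Ω≤4 Y a a< rough W<3 = factored a bound
  where
  y : ℕ
  y = 2 ^ suc Y
  no3 : ¬ 3ℚ ≤ℚ W (es Y) a
  no3 h = ℚP.<-irrefl refl (ℚP.<-≤-trans W<3 h)
  mem : ∀ {q} → Prime q × q < y → q ∣ a → q ∈ map proj₁ (es Y)
  mem {q} (pr , lt) h = es-∋ Y q pr (prime≥8 pr h rough) lt
  -- Three prime factors below y force W ≥ 3: distinct ones contribute 1 each, and a repeated one
  -- contributes 1 + 2 by itself.
  triple : ∀ q r t rest → All (λ q → Prime q × q < y) (q ∷ r ∷ t ∷ rest) → product (q ∷ r ∷ t ∷ rest) ∣ a → ⊥
  triple q r t rest (hq ∷ hr ∷ ht ∷ _) dv = cases
    where
    dq : q ∣ a
    dq = ∣P.∣-trans (divides (r * (t * product rest)) (ℕP.*-comm q _)) dv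
    dr : r ∣ a
    dr = ∣P.∣-trans (divides (q * (t * product rest)) (lem q r t (product rest))) dv
      where
      lem : ∀ q r t s → q * (r * (t * s)) ≡ q * (t * s) * r
      lem = ℕRing.solve-∀
    dt : t ∣ a
    dt = ∣P.∣-trans (divides (q * (r * product rest)) (lem q r t (product rest))) dv
      where
      lem : ∀ q r t s → q * (r * (t * s)) ≡ q * (r * s) * t
      lem = ℕRing.solve-∀
    cases : ⊥
    cases with q ℕP.≟ r | q ℕP.≟ t | r ℕP.≟ t
    ... | yes refl | _ | _ = no3 (W≥² (es Y) (mem hq dq) (∣P.∣-trans (divides (t * product rest) (lem q t (product rest))) dv))
      where
      lem : ∀ q t s → q * (q * (t * s)) ≡ t * s * (q * q)
      lem = ℕRing.solve-∀
    ... | no _ | yes refl | _ = no3 (W≥² (es Y) (mem hq dq) (∣P.∣-trans (divides (r * product rest) (lem q r (product rest))) dv))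
      where
      lem : ∀ q r s → q * (r * (q * s)) ≡ r * s * (q * q)
      lem = ℕRing.solve-∀
    ... | no _ | no _ | yes refl = no3 (W≥² (es Y) (mem hr dr) (∣P.∣-trans (divides (q * product rest) (lem q r (product rest))) dv))
      where
      lem : ∀ q r s → q * (r * (r * s)) ≡ q * s * (r * r)
      lem = ℕRing.solve-∀
    ... | no qr | no qt | no rt = no3 (W≥₃ (es Y) qr qt rt (mem hq dq) (mem hr dr) (mem ht dt) dq dr dt)
  bound : ∀ ps → All Prime ps → product ps ≡ a → length ps ≤ 4
  bound ps prs e with small y ps prs
  ... | qs , k , al , dv , le , ln = subst (_≤ 4) (sym ln) (ℕP.+-mono-≤ k≤2 (qs≤2 qs al dv))
    where
    k≤2 : k ≤ 2
    k≤2 with k ℕP.≤? 2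
    ... | yes p = p
    ... | no ¬p = ⊥-elim (ℕP.<-irrefl refl (ℕP.<-≤-trans a< (ℕP.≤-trans (ℕP.^-monoʳ-≤ y {{ℕP.m^n≢0 2 (suc Y)}} (ℕP.≰⇒> ¬p)) (subst (y ^ k ≤_) e le))))
    qs≤2 : ∀ qs → All (λ q → Prime q × q < y) qs → product qs ∣ product ps → length qs ≤ 2
    qs≤2 []                 _  _  = z≤n
    qs≤2 (_ ∷ [])           _  _  = s≤s z≤n
    qs≤2 (_ ∷ _ ∷ [])       _  _  = s≤s (s≤s z≤n)
    qs≤2 (q ∷ r ∷ t ∷ rest) al dv = ⊥-elim (triple q r t rest al (subst (_ ∣_) e dv))

-- Chebyshev and Mertens bounds

prime∤! : ∀ {p} m → Prime p → m < p → ¬ p ∣ m !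
prime∤! zero    pr lt h = PrimeP.¬prime[1] (subst Prime (∣P.∣1⇒≡1 h) pr)
prime∤! (suc m) pr lt h with euclidsLemma (suc m) (m !) pr h
... | inj₁ x = ℕP.<-irrefl refl (ℕP.<-≤-trans lt (∣P.∣⇒≤ x))
... | inj₂ y = prime∤! m pr (ℕP.<-trans (ℕP.n<1+n m) lt) y

product-∣ : ∀ ps c → All Prime ps → Unique ps → All (_∣ c) ps → product ps ∣ c
product-∣ []       c _          _        _        = ∣P.1∣ c
product-∣ (p ∷ ps) c (pr ∷ prs) (u ∷ us) (divides k refl ∷ ds) =
  subst (p * product ps ∣_) (ℕP.*-comm p k) (∣P.*-monoʳ-∣ p (product-∣ ps k prs us (go ps prs u ds)))
  where
  go : ∀ qs → All Prime qs → All (p ≢_) qs → All (_∣ k * p) qs → All (_∣ k) qs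
  go []       _          _         _         = []
  go (q ∷ qs) (qr ∷ qrs) (ne ∷ nes) (d ∷ ds) with euclidsLemma k p qr d
  ... | inj₁ x = x ∷ go qs qrs nes ds
  ... | inj₂ y = ⊥-elim (ne (sym (prime∣prime qr pr y)))

[2m]!≤ : ∀ m → (m + m) ! ≤ 4 ^ m * (m ! * m !)
[2m]!≤ zero    = s≤s z≤n
[2m]!≤ (suc m) = subst (λ t → (suc t) ! ≤ 4 ^ suc m * (suc m ! * suc m !)) (sym (ℕP.+-suc m m)) (begin
    suc (suc (m + m)) * (suc (m + m) * (m + m) !)     ≤⟨ ℕP.*-monoʳ-≤ (suc (suc (m + m))) (ℕP.*-mono-≤ (ℕP.n≤1+n (suc (m + m))) ([2m]!≤ m)) ⟩
    suc (suc (m + m)) * (suc (suc (m + m)) * (4 ^ m * (m ! * m !)))   ≡⟨ lem m (4 ^ m) (m !) ⟩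
    4 ^ suc m * (suc m ! * suc m !)   ∎)
  where
  open ℕP.≤-Reasoning
  lem : ∀ m x y → suc (suc (m + m)) * (suc (suc (m + m)) * (x * (y * y))) ≡ 4 * x * (suc m * y * (suc m * y))
  lem = ℕRing.solve-∀

2^length≤product : ∀ j ps → All (2 ^ j ≤_) ps → 2 ^ (j * length ps) ≤ product ps
2^length≤product j []       []       = ℕP.≤-reflexive (cong (2 ^_) (ℕP.*-zeroʳ j))
2^length≤product j (p ∷ ps) (h ∷ hs) = ℕP.≤-trans (ℕP.≤-reflexive (trans (cong (2 ^_) (ℕP.*-suc j (length ps))) (ℕP.^-distribˡ-+-* 2 j (j * length ps))))
  (ℕP.*-mono-≤ h (2^length≤product j ps hs))

^-cancel-≤ : ∀ m n → 2 ^ m ≤ 2 ^ n → m ≤ n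
^-cancel-≤ m n h with m ℕP.≤? n
... | yes p = p
... | no ¬p = ⊥-elim (ℕP.<-irrefl refl (ℕP.<-≤-trans (ℕP.^-monoʳ-< 2 (s≤s (s≤s z≤n)) (ℕP.≰⇒> ¬p)) h))

-- It makes the lower end of a dyadic class strict: p > 2^j is used for p ∤ (2^j)! in `chebyshev`
-- and for p - 1 ≥ 2^j in `r≤rj`.
prime-not-2^ : ∀ {p} j → Prime p → 8 ≤ p → p ≢ 2 ^ j
prime-not-2^ zero    pr h refl = PrimeP.¬prime[1] pr
prime-not-2^ (suc j) pr h refl with prime∣prime prime2 pr (∣P.m∣m*n (2 ^ j))
... | e = ℕP.<-irrefl e (ℕP.≤-trans (ℕP.≤ᵇ⇒≤ 3 8 tt) h)

-- With m = 2^j, the primes of the class divide the central binomial coefficient c = (2m)!/(m!)²,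
-- which is at most 4^m; each of them is at least 2^j, and exponents of 2 are compared.
chebyshev : ∀ j → j * length (cls j) ≤ 2 ^ suc j
chebyshev j with k![n∸k]!∣n! (ℕP.m≤m+n (2 ^ j) (2 ^ j))
... | divides c e′ = ^-cancel-≤ (j * length (cls j)) (2 ^ suc j) (begin
    2 ^ (j * length (cls j))   ≤⟨ 2^length≤product j (cls j) (All.map (λ { (_ , _ , lo , _) → lo }) (cls-in j)) ⟩
    product (cls j)            ≤⟨ ∣P.∣⇒≤ {{c≢0}} (product-∣ (cls j) c (All.map proj₁ (cls-in j)) (cls-unique j) (All.map div (cls-in j))) ⟩
    c                          ≤⟨ ℕP.*-cancelʳ-≤ c (4 ^ m) (m ! * m !) {{m!²≢0}} (subst (_≤ 4 ^ m * (m ! * m !)) e ([2m]!≤ m)) ⟩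
    4 ^ m                      ≡⟨ ℕP.^-*-assoc 2 2 m ⟩
    2 ^ (2 ^ suc j)            ∎)
  where
  open ℕP.≤-Reasoning
  m : ℕ
  m = 2 ^ j
  e : (m + m) ! ≡ c * (m ! * m !)
  e = trans e′ (cong (λ t → c * (m ! * t !)) (ℕP.m+n∸m≡n m m))
  m!²≢0 : NonZero (m ! * m !)
  m!²≢0 = ℕP.m*n≢0 (m !) (m !) {{m ℕP.!≢0}} {{m ℕP.!≢0}}
  c≢0 : NonZero c
  c≢0 = ℕ.≢-nonZero (λ c≡0 → ℕ.≢-nonZero⁻¹ ((m + m) !) {{(m + m) ℕP.!≢0}} (trans e (cong (_* (m ! * m !)) c≡0)))
  ∣! : ∀ p → Prime p → p ∣ p !
  ∣! zero    pr = ⊥-elim (PrimeP.¬prime[0] pr)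
  ∣! (suc p) pr = ∣P.m∣m*n (p !)
  div : ∀ {p} → InClass j p → p ∣ c
  div {p} (pr , h , lo , hi) with euclidsLemma c (m ! * m !) pr (subst (p ∣_) e (∣P.∣-trans (∣! p pr) (∣P.m≤n⇒m!∣n! (ℕP.≤-trans (ℕP.<⇒≤ hi) (ℕP.≤-reflexive (cong (m +_) (ℕP.+-identityʳ m)))))))
  ... | inj₁ x = x
  ... | inj₂ y = ⊥-elim (prime-∤-* pr ∤m! ∤m! y)
    where
    ∤m! : ¬ p ∣ m !
    ∤m! = prime∤! m pr (ℕP.≤∧≢⇒< lo (λ eq → prime-not-2^ j pr h (sym eq)))

Sum-++ : ∀ m N M F → Sum m (N + M) F ≡ Sum m N F ⊕ Sum (m + N) M F
Sum-++ m N zero    F = trans (cong (λ t → Sum m t F) (ℕP.+-identityʳ N)) (sym (ℚP.+-identityʳ (Sum m N F)))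
Sum-++ m N (suc M) F = trans (cong (λ t → Sum m t F) (ℕP.+-suc N M)) (trans (cong₂ _⊕_ (Sum-++ m N M F) (cong F (sym (ℕP.+-assoc m N M)))) (ℚP.+-assoc (Sum m N F) (Sum (m + N) M F) (F (m + N + M))))

Sum-≤-const : ∀ m N {F} c → (∀ a → m ≤ a → a < m + N → F a ≤ℚ c) → Sum m N F ≤ℚ ι N ⊗ c
Sum-≤-const m N c h = ℚP.≤-trans (Sum-mono m N h) (ℚP.≤-reflexive (go N))
  where
  lem : ∀ x c → x ⊗ c ⊕ c ≡ (1ℚ ⊕ x) ⊗ c
  lem = solve-∀ ℚring
  go : ∀ N → Sum m N (λ _ → c) ≡ ι N ⊗ c
  go zero    = sym (trans (cong (_⊗ c) ι0) (ℚP.*-zeroˡ c))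
  go (suc N) = trans (cong (_⊕ c) (go N)) (trans (lem (ι N) c) (cong (_⊗ c) (sym (ι-suc N))))

Sum-grow : ∀ {F} N k → (∀ j → 0ℚ ≤ℚ F j) → Sum 1 N F ≤ℚ Sum 1 (N + k) F
Sum-grow {F} N k h = ≤-by (Sum (1 + N) k F) (nn k) (sym (Sum-++ 1 N k F))
  where
  nn : ∀ k → 0ℚ ≤ℚ Sum (1 + N) k F
  nn zero    = ℚP.≤-refl
  nn (suc k) = 0≤⊕ (nn k) (h (1 + N + k))

-- The floor of N/d is at least (N + 1)/d - 1. The numerator N + 1 is convenient because N + 1 will
-- be a power of 2.
multiples-lower : ∀ d → .{{_ : NonZero d}} → ∀ N → ι (suc N) ⊗ iv d ⊖ 1ℚ ≤ℚ Sum 1 N (ind d)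
multiples-lower d@(suc d′) N with multiples 0 d N
... | c , r , e , eq , r<d , _ = ℚP.≤-trans (⊗-cancel-≤ (ι d) (0<ι d) (subst₂ _≤ℚ_ (sym lhs) (trans (ι-+ c (c * d′)) (trans (cong (ι c ⊕_) (ι-* c d′)) (trans (lem₂ (ι c) (ι d′)) (cong (_⊗ ι c) (sym (ι-suc d′))))))
      (≤-by (ι (c + c * d′) ⊕ 0ℚ ⊖ (ι (suc N) ⊖ ι d)) (0≤⊖′) (lem₃ (ι (suc N) ⊖ ι d) (ι (c + c * d′))))))
    (ℚP.≤-reflexive (sym e))
  where
  lem₁ : ∀ d n i → d ⊗ (n ⊗ i ⊖ 1ℚ) ≡ n ⊗ (d ⊗ i) ⊖ d
  lem₁ = solve-∀ ℚring
  lem₂ : ∀ c d → c ⊕ c ⊗ d ≡ (1ℚ ⊕ d) ⊗ c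
  lem₂ = solve-∀ ℚring
  lem₃ : ∀ x y → x ⊕ (y ⊕ 0ℚ ⊖ x) ≡ y
  lem₃ = solve-∀ ℚring
  lem₄ : ∀ x y z → z ⊕ 0ℚ ⊖ (x ⊖ y) ≡ z ⊕ y ⊖ x
  lem₄ = solve-∀ ℚring
  lhs : ι d ⊗ (ι (suc N) ⊗ iv d ⊖ 1ℚ) ≡ ι (suc N) ⊖ ι d
  lhs = trans (lem₁ (ι d) (ι (suc N)) (iv d)) (cong (_⊖ ι d) (trans (cong (ι (suc N) ⊗_) (ι⊗iv d)) (ℚP.*-identityʳ (ι (suc N)))))
  bound : suc N ≤ c + c * d′ + d
  bound = ℕP.≤-trans (s≤s (ℕP.≤-reflexive (trans (sym (ℕP.+-identityʳ N)) (trans (sym eq) (cong (_+ r) (ℕP.*-suc c d′))))))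
            (ℕP.≤-trans (ℕP.≤-reflexive (sym (ℕP.+-suc (c + c * d′) r))) (ℕP.+-monoʳ-≤ (c + c * d′) r<d))
  0≤⊖′ : 0ℚ ≤ℚ ι (c + c * d′) ⊕ 0ℚ ⊖ (ι (suc N) ⊖ ι d)
  0≤⊖′ = subst (0ℚ ≤ℚ_) (sym (lem₄ (ι (suc N)) (ι d) (ι (c + c * d′)))) (0≤⊖ (ℚP.≤-trans (ι-mono-≤ bound) (ℚP.≤-reflexive (ι-+ (c + c * d′) d))))

-- A Mertens bound from integer logarithms

S : List Entry → ℕ → ℚ
S []             a = 0ℚ
S ((p , s) ∷ es) a = S es a ⊕ ι s ⊗ ind p a

-- Z is a natural number z, witnessed by a divisor d ≥ 2^z of a which is free of the primes in L
Log : List ℕ → ℕ → ℚ → Set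
Log L a Z = Σ[ z ∈ ℕ ] Σ[ d ∈ ℕ ] Z ≡ ι z × 2 ^ z ≤ d × d ∣ a × All (λ q → ¬ q ∣ d) L

ι⊗ind-yes : ∀ s {p a} → p ∣ a → ι s ⊗ ind p a ≡ ι s
ι⊗ind-yes s h = trans (cong (ι s ⊗_) (ind-yes h)) (ℚP.*-identityʳ (ι s))

free-* : ∀ {p d L} → Prime p → Distinct p L → All (λ q → ¬ q ∣ d) L → All (λ q → ¬ q ∣ d * p) L
free-* pr []              []       = []
free-* pr ((qr , ne) ∷ ds) (c ∷ cs) = prime-∤-* qr c (λ h → ne (prime∣prime qr pr h)) ∷ free-* pr ds cs

log-step : ∀ {p s L a Z} → Prime p → Distinct p L → 2 ^ s ≤ p → Log (p ∷ L) a Z → Log L a (Z ⊕ ι s ⊗ ind p a)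
log-step {p} {s} {L} {a} {Z} pr ds le (z , d , e , lo , dv , (c ∷ cs)) with p ∣? a
... | no ¬h = z , d , trans (cong₂ _⊕_ e (ℚP.*-zeroʳ (ι s))) (ℚP.+-identityʳ (ι z)) , lo , dv , cs
... | yes h = z + s , d * p , trans (cong₂ _⊕_ e (ℚP.*-identityʳ (ι s))) (sym (ι-+ z s))
            , ℕP.≤-trans (ℕP.≤-reflexive (ℕP.^-distribˡ-+-* 2 z s)) (ℕP.*-mono-≤ lo le) , ∣-mul-prime pr c dv h , free-* pr ds cs

-- For p = 3 the square deserves more than twice the weight of the prime: 3 ≥ 2 but 9 ≥ 2³, whence s
-- = 1 and t = 2.
log-step² : ∀ {p s t L a Z} → Prime p → Distinct p L → 2 ^ s ≤ p → 2 ^ (s + t) ≤ p * p → Log (p ∷ L) a Z →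
  Log L a (Z ⊕ (ι s ⊗ ind p a ⊕ ι t ⊗ ind (p * p) a))
log-step² {p} {s} {t} {L} {a} {Z} pr ds le le² l@(z , d , e , lo , dv , (c ∷ cs)) with p * p ∣? a
... | yes h = z + (s + t) , d * (p * p) , trans (cong₂ _⊕_ e (trans (cong₂ _⊕_ (ι⊗ind-yes s (∣P.∣-trans (∣P.m∣m*n {p} p) h)) (ℚP.*-identityʳ (ι t))) (sym (ι-+ s t)))) (sym (ι-+ z (s + t)))
            , ℕP.≤-trans (ℕP.≤-reflexive (ℕP.^-distribˡ-+-* 2 z (s + t))) (ℕP.*-mono-≤ lo le²) , ∣-mul-prime² pr c dv h
            , subst (λ x → All (λ q → ¬ q ∣ x) L) (ℕP.*-assoc d p p) (free-* pr ds (free-* pr ds cs))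
... | no ¬h = subst (λ x → Log L a (Z ⊕ x)) (sym (trans (cong (ι s ⊗ ind p a ⊕_) (ℚP.*-zeroʳ (ι t))) (ℚP.+-identityʳ (ι s ⊗ ind p a)))) (log-step pr ds le l)

-- The exponent of 2 in a, capped at k.
pow2 : ℕ → ℕ → ℚ
pow2 zero    a = 0ℚ
pow2 (suc k) a = pow2 k a ⊕ ind (2 ^ suc k) a

log-2 : ∀ {L} k a → Distinct 2 L → Log L a (pow2 k a)
log-2 {L} k a ds with go k
  where
  go : ∀ k → Σ[ z ∈ ℕ ] pow2 k a ≡ ι z × 2 ^ z ∣ a × (2 ^ k ∣ a → z ≡ k)
  go zero    = 0 , sym ι0 , ∣P.1∣ a , λ _ → refl
  go (suc k) with go k | 2 ^ suc k ∣? a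
  ... | z , e , dv , top | no ¬h = z , trans (ℚP.+-identityʳ (pow2 k a)) e , dv , λ h → ⊥-elim (¬h h)
  ... | z , e , dv , top | yes h = suc k , trans (ℚP.+-comm (pow2 k a) 1ℚ) (trans (cong (1ℚ ⊕_) (trans e (cong ι (top (∣P.∣-trans (∣P.n∣m*n 2) h))))) (sym (ι-suc k))) , h , λ _ → refl
... | z , e , dv , _ = z , 2 ^ z , e , ℕP.≤-refl , dv , free z
  where
  free : ∀ k → All (λ q → ¬ q ∣ 2 ^ k) L
  free zero    = All.map (λ { (pr , _) h → PrimeP.¬prime[1] (subst Prime (∣P.∣1⇒≡1 h) pr) }) ds
  free (suc k) = subst (λ x → All (λ q → ¬ q ∣ x) L) (ℕP.*-comm (2 ^ k) 2) (free-* prime2 ds (free k))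

log-S : ∀ {es a Z} → Good es → All (λ e → 2 ^ proj₂ e ≤ proj₁ e) es → Log (map proj₁ es) a Z → Log [] a (Z ⊕ S es a)
log-S {a = a} {Z} [] [] l = subst (Log [] a) (sym (ℚP.+-identityʳ Z)) l
log-S {(p , s) ∷ es} {a} {Z} ((pr , ds) ∷ gs) (le ∷ les) l = subst (Log [] a) (lem Z (ι s ⊗ ind p a) (S es a)) (log-S gs les (log-step pr ds le l))
  where
  lem : ∀ x y z → x ⊕ y ⊕ z ≡ x ⊕ (z ⊕ y)
  lem = solve-∀ ℚring

es-size : ∀ Y → All (λ e → 2 ^ proj₂ e ≤ proj₁ e) (es Y)
es-size zero    = []
es-size (suc Y) = AllP.++⁺ (AllP.map⁺ (All.map (λ { (_ , _ , lo , _) → lo }) (cls-in (suc Y)))) (es-size Y)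

-- The powers of 2, 3, 5 and 7 are included to lower the constant in the Mertens bound.
Z : ℕ → ℕ → ℚ
Z J a = pow2 4 a ⊕ (ι 1 ⊗ ind 3 a ⊕ ι 2 ⊗ ind 9 a) ⊕ ι 2 ⊗ ind 5 a ⊕ ι 2 ⊗ ind 7 a ⊕ S (es J) a

Z≤ : ∀ J i a → 2 ^ i ≤ a → a < 2 ^ suc i → Z J a ≤ℚ ι i
Z≤ J i a lo hi = fin (log-S (good J) (es-size J) (log-step prime7 (dst (≤! 8 8)) (≤! 4 7)
    (log-step prime5 ((prime7 , λ ()) ∷ dst (≤! 6 8)) (≤! 4 5)
    (log-step² prime3 ((prime5 , λ ()) ∷ (prime7 , λ ()) ∷ dst (≤! 4 8)) (≤! 2 3) (≤! 8 9)
    (log-2 4 a ((prime3 , λ ()) ∷ (prime5 , λ ()) ∷ (prime7 , λ ()) ∷ dst (≤! 3 8)))))))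
  where
  dst : ∀ {q} → q < 8 → Distinct q (map proj₁ (es J))
  dst q<8 = All.map (λ { (pr , le , _) → pr , λ e → ℕP.<-irrefl (sym e) (ℕP.<-≤-trans q<8 le) }) (es-in J)
  fin : ∀ {Z} → Log [] a Z → Z ≤ℚ ι i
  fin (z , d , refl , le , dv , _) = ι-mono-≤ (ℕP.≤-pred (ℕP.≰⇒> (λ h → ℕP.<-irrefl refl (ℕP.<-≤-trans hi (ℕP.≤-trans (ℕP.^-monoʳ-≤ 2 h)
     (ℕP.≤-trans le (∣P.∣⇒≤ {{ℕ.>-nonZero (ℕP.≤-trans (ℕP.^-monoʳ-≤ 2 {0} {i} z≤n) lo)}} dv)))))))

-- As `Z J a` is at most ⌊log₂ a⌋, summing over dyadic blocks gives (I - 2) 2^I + 2; the subtraction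
-- is moved to the left.
ΣZ≤ : ∀ J I → Sum 1 (2 ^ I ∸ 1) (Z J) ⊕ ι (2 ^ I + 2 ^ I) ≤ℚ ι (I * 2 ^ I) ⊕ ι 2
ΣZ≤ J zero = ℚP.≤-reflexive (cong (_⊕ ι 2) (sym ι0))
ΣZ≤ J (suc I) = subst₂ _≤ℚ_ (sym (trans (cong (λ t → Sum 1 t (Z J) ⊕ ι (2 ^ suc I + 2 ^ suc I)) len) (trans (cong₂ _⊕_ (Sum-++ 1 (2 ^ I ∸ 1) (2 ^ I) (Z J)) (trans (cong ι (cong₂ _+_ dbl dbl)) (ι-+ (2 ^ I + 2 ^ I) (2 ^ I + 2 ^ I)))) (lem₁ (Sum 1 (2 ^ I ∸ 1) (Z J)) (Sum (1 + (2 ^ I ∸ 1)) (2 ^ I) (Z J)) (ι (2 ^ I + 2 ^ I))))))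
    (trans (lem₂ (ι (I * 2 ^ I)) (ι 2) (ι (2 ^ I + 2 ^ I)) (ι (2 ^ I) ⊗ ι I)) (cong (_⊕ ι 2) (trans (cong (λ t → ι (I * 2 ^ I) ⊕ t ⊕ ι (2 ^ I + 2 ^ I)) (sym (ι-* (2 ^ I) I))) (trans (cong (_⊕ ι (2 ^ I + 2 ^ I)) (sym (ι-+ (I * 2 ^ I) (2 ^ I * I)))) (trans (sym (ι-+ (I * 2 ^ I + 2 ^ I * I) (2 ^ I + 2 ^ I))) (cong ι (nat I (2 ^ I))))))))
    (ℚP.+-mono-≤ (ℚP.+-mono-≤ (ΣZ≤ J I) (Sum-≤-const (1 + (2 ^ I ∸ 1)) (2 ^ I) (ι I) block)) ℚP.≤-refl)
  where
  pos : 1 ≤ 2 ^ I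
  pos = ℕP.^-monoʳ-≤ 2 {0} {I} z≤n
  dbl : 2 ^ suc I ≡ 2 ^ I + 2 ^ I
  dbl = cong (2 ^ I +_) (ℕP.+-identityʳ (2 ^ I))
  len : 2 ^ suc I ∸ 1 ≡ 2 ^ I ∸ 1 + 2 ^ I
  len = trans (cong (_∸ 1) dbl) (ℕP.+-∸-comm (2 ^ I) pos)
  st : 1 + (2 ^ I ∸ 1) ≡ 2 ^ I
  st = ℕP.m+[n∸m]≡n pos
  block : ∀ a → 1 + (2 ^ I ∸ 1) ≤ a → a < 1 + (2 ^ I ∸ 1) + 2 ^ I → Z J a ≤ℚ ι I
  block a lo hi = Z≤ J I a (subst (_≤ a) st lo) (subst (a <_) (trans (cong (_+ 2 ^ I) st) (sym dbl)) hi)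
  lem₁ : ∀ a b c → a ⊕ b ⊕ (c ⊕ c) ≡ a ⊕ c ⊕ b ⊕ c
  lem₁ = solve-∀ ℚring
  lem₂ : ∀ a b c d → a ⊕ b ⊕ d ⊕ c ≡ a ⊕ d ⊕ c ⊕ b
  lem₂ = solve-∀ ℚring
  nat : ∀ I x → I * x + x * I + (x + x) ≡ suc I * (x + (x + 0))
  nat = ℕRing.solve-∀

Lw : ℕ → List Entry → ℚ
Lw n []             = 0ℚ
Lw n ((p , s) ∷ es) = Lw n es ⊕ ι s ⊗ (ι n ⊗ iv p ⊖ 1ℚ)

Lw-++ : ∀ n ps j es → Lw n (map (λ p → p , j) ps ++ es) ≡ Lw n es ⊕ ι j ⊗ (ι n ⊗ ΣL ps iv ⊖ ι (length ps))
Lw-++ n []       j es = trans (lem (Lw n es) (ι j) (ι n)) (cong (λ t → Lw n es ⊕ ι j ⊗ (ι n ⊗ 0ℚ ⊖ t)) (sym ι0))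
  where
  lem : ∀ l j n → l ≡ l ⊕ j ⊗ (n ⊗ 0ℚ ⊖ 0ℚ)
  lem = solve-∀ ℚring
Lw-++ n (p ∷ ps) j es = trans (cong (_⊕ ι j ⊗ (ι n ⊗ iv p ⊖ 1ℚ)) (Lw-++ n ps j es))
    (trans (lem (Lw n es) (ι j) (ι n) (ΣL ps iv) (ι (length ps)) (iv p)) (cong (λ t → Lw n es ⊕ ι j ⊗ (ι n ⊗ (ΣL ps iv ⊕ iv p) ⊖ t)) (sym (ι-suc (length ps)))))
  where
  lem : ∀ l j n x k i → l ⊕ j ⊗ (n ⊗ x ⊖ k) ⊕ j ⊗ (n ⊗ i ⊖ 1ℚ) ≡ l ⊕ j ⊗ (n ⊗ (x ⊕ i) ⊖ (1ℚ ⊕ k))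
  lem = solve-∀ ℚring

σ X : ℕ → ℚ
σ J = Sum 1 J (λ j → ι j ⊗ ΣL (cls j) iv)
X J = Sum 1 J (λ j → ι (j * length (cls j)))

Lw-es : ∀ n J → Lw n (es J) ≡ ι n ⊗ σ J ⊖ X J
Lw-es n zero    = lem (ι n)
  where
  lem : ∀ n → 0ℚ ≡ n ⊗ 0ℚ ⊖ 0ℚ
  lem = solve-∀ ℚring
Lw-es n (suc J) = trans (Lw-++ n (cls (suc J)) (suc J) (es J)) (trans (cong (_⊕ ι (suc J) ⊗ (ι n ⊗ ΣL (cls (suc J)) iv ⊖ ι (length (cls (suc J))))) (Lw-es n J))
    (trans (lem (ι n) (σ J) (X J) (ι (suc J)) (ΣL (cls (suc J)) iv) (ι (length (cls (suc J))))) (cong (λ t → ι n ⊗ (σ J ⊕ ι (suc J) ⊗ ΣL (cls (suc J)) iv) ⊖ (X J ⊕ t)) (sym (ι-* (suc J) (length (cls (suc J))))))))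
  where
  lem : ∀ n s x j a k → n ⊗ s ⊖ x ⊕ j ⊗ (n ⊗ a ⊖ k) ≡ n ⊗ (s ⊕ j ⊗ a) ⊖ (x ⊕ j ⊗ k)
  lem = solve-∀ ℚring

-- A geometric series by `chebyshev`; it starts at class 3, which accounts for the 16.
X≤ : ∀ J → X (2 + J) ⊕ ι 16 ≤ℚ ι (2 ^ (4 + J))
X≤ zero    = ℚP.≤-reflexive (trans (cong₂ (λ x y → 0ℚ ⊕ x ⊕ y ⊕ ι 16) ι0 ι0) (ℚP.+-identityˡ (ι 16)))
X≤ (suc J) = ℚP.≤-trans (ℚP.≤-reflexive (lem (X (2 + J)) (ι ((3 + J) * length (cls (3 + J)))) (ι 16)))
    (ℚP.≤-trans (ℚP.+-mono-≤ (X≤ J) (ι-mono-≤ (chebyshev (3 + J)))) (ℚP.≤-reflexive (trans (sym (ι-+ (2 ^ (4 + J)) (2 ^ (4 + J)))) (cong (λ t → ι (2 ^ (4 + J) + t)) (sym (ℕP.+-identityʳ (2 ^ (4 + J))))))))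
  where
  lem : ∀ a b c → a ⊕ b ⊕ c ≡ a ⊕ c ⊕ b
  lem = solve-∀ ℚring

-- The mean of the part of `Z` due to 2, 3, 5 and 7, which becomes the saving in `σ≤`.
ω : ℚ
ω = 0ℚ ⊕ iv 2 ⊕ iv 4 ⊕ iv 8 ⊕ iv 16 ⊕ (ι 1 ⊗ iv 3 ⊕ ι 2 ⊗ iv 9) ⊕ ι 2 ⊗ iv 5 ⊕ ι 2 ⊗ iv 7

module _ (N : ℕ) where
  private
    LB : (ℕ → ℚ) → ℚ → Set
    LB F l = l ≤ℚ Sum 1 N F

    lb-ind : ∀ d → .{{_ : NonZero d}} → LB (ind d) (ι (suc N) ⊗ iv d ⊖ 1ℚ)
    lb-ind d = multiples-lower d N

    lb-⊕ : ∀ {F G l m} → LB F l → LB G m → LB (λ a → F a ⊕ G a) (l ⊕ m)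
    lb-⊕ p q = ℚP.≤-trans (ℚP.+-mono-≤ p q) (ℚP.≤-reflexive (sym (Sum-⊕ 1 N)))

    lb-⊗ : ∀ {F l} s → LB F l → LB (λ a → ι s ⊗ F a) (ι s ⊗ l)
    lb-⊗ s p = ℚP.≤-trans (⊗-monoʳ (0≤ι s) p) (ℚP.≤-reflexive (sym (Sum-⊗ 1 (ι s) N)))

    lb-0 : LB (λ _ → 0ℚ) 0ℚ
    lb-0 = ℚP.≤-reflexive (sym (trans (Sum-⊗ 1 0ℚ {λ _ → 0ℚ} N) (ℚP.*-zeroˡ (Sum 1 N (λ _ → 0ℚ)))))

    lb-S : ∀ es → All (λ e → NonZero (proj₁ e)) es → LB (S es) (Lw (suc N) es)
    lb-S []             []       = lb-0
    lb-S ((p , s) ∷ es) (h ∷ hs) = lb-⊕ (lb-S es hs) (lb-⊗ s (lb-ind p {{h}}))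

  ΣZ≥ : ∀ J → ι (suc N) ⊗ ω ⊖ (4ℚ ⊕ ι 1 ⊕ ι 2 ⊕ ι 2 ⊕ ι 2) ⊕ (ι (suc N) ⊗ σ J ⊖ X J) ≤ℚ Sum 1 N (Z J)
  ΣZ≥ J = ℚP.≤-trans (ℚP.≤-reflexive (trans (cong (ι (suc N) ⊗ ω ⊖ (4ℚ ⊕ ι 1 ⊕ ι 2 ⊕ ι 2 ⊕ ι 2) ⊕_) (sym (Lw-es (suc N) J))) (cong (_⊕ Lw (suc N) (es J)) (lem (ι (suc N)) (iv 2) (iv 4) (iv 8) (iv 16) (iv 3) (iv 9) (iv 5) (iv 7) (ι 1) (ι 2)))))
      (lb-⊕ (lb-⊕ (lb-⊕ (lb-⊕ (lb-⊕ (lb-⊕ (lb-⊕ (lb-⊕ lb-0 (lb-ind 2)) (lb-ind 4)) (lb-ind 8)) (lb-ind 16))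
        (lb-⊕ (lb-⊗ 1 (lb-ind 3)) (lb-⊗ 2 (lb-ind 9)))) (lb-⊗ 2 (lb-ind 5))) (lb-⊗ 2 (lb-ind 7)))
        (lb-S (es J) (es-nz J)))
    where
    es-nz : ∀ Y → All (λ e → NonZero (proj₁ e)) (es Y)
    es-nz Y = All.map (λ {e} h → ℕ.>-nonZero (ℕP.≤-trans (ℕP.^-monoʳ-≤ 2 {0} {proj₂ e} z≤n) h)) (es-size Y)
    lem : ∀ n a b c d e f g h o t → n ⊗ (0ℚ ⊕ a ⊕ b ⊕ c ⊕ d ⊕ (o ⊗ e ⊕ t ⊗ f) ⊕ t ⊗ g ⊕ t ⊗ h) ⊖ (2ℚ ⊕ 2ℚ ⊕ o ⊕ t ⊕ t ⊕ t)
      ≡ 0ℚ ⊕ (n ⊗ a ⊖ 1ℚ) ⊕ (n ⊗ b ⊖ 1ℚ) ⊕ (n ⊗ c ⊖ 1ℚ) ⊕ (n ⊗ d ⊖ 1ℚ) ⊕ (o ⊗ (n ⊗ e ⊖ 1ℚ) ⊕ t ⊗ (n ⊗ f ⊖ 1ℚ)) ⊕ t ⊗ (n ⊗ g ⊖ 1ℚ) ⊕ t ⊗ (n ⊗ h ⊖ 1ℚ)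
    lem = solve-∀ ℚring

-- Let n = 2^(3+J). Then ΣZ over a < n is at least nω - 11 + nσ - X and at most (3 + J) n - 2n + 2.
-- The 2n gained by summing ⌊log₂ a⌋ pays for X ≤ 2n - 16, and the constants 2 - 16 + 11 = -3 are
-- harmless.
σ≤ : ∀ J → σ (2 + J) ≤ℚ ι (3 + J) ⊖ ω
σ≤ J = ⊗-cancel-≤ (ι n) (0<ι n {{ℕP.m^n≢0 2 (3 + J)}}) (≤-by
    ((ι (2 ^ (4 + J)) ⊖ (X (2 + J) ⊕ ι 16)) ⊕ ((ι ((3 + J) * n) ⊕ ι 2 ⊖ (Sum 1 (n ∸ 1) (Z (2 + J)) ⊕ ι (n + n))) ⊕ ((Sum 1 (n ∸ 1) (Z (2 + J)) ⊖ low) ⊕ ι 3)))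
    (0≤⊕ (0≤⊖ (X≤ J)) (0≤⊕ (0≤⊖ (ΣZ≤ (2 + J) (3 + J))) (0≤⊕ (0≤⊖ (subst (λ t → ι t ⊗ ω ⊖ (4ℚ ⊕ ι 1 ⊕ ι 2 ⊕ ι 2 ⊕ ι 2) ⊕ (ι t ⊗ σ (2 + J) ⊖ X (2 + J)) ≤ℚ Sum 1 (n ∸ 1) (Z (2 + J))) sn (ΣZ≥ (n ∸ 1) (2 + J)))) (0≤ι 3))))
    (trans (cong₂ (λ u v → ι n ⊗ σ (2 + J) ⊕ ((u ⊖ (X (2 + J) ⊕ ι 16)) ⊕ ((v ⊕ ι 2 ⊖ (Sum 1 (n ∸ 1) (Z (2 + J)) ⊕ ι (n + n))) ⊕ ((Sum 1 (n ∸ 1) (Z (2 + J)) ⊖ low) ⊕ ι 3)))) (cong (λ t → ι (n + t)) (ℕP.+-identityʳ n)) (ι-* (3 + J) n))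
      (trans (lem (ι n) (σ (2 + J)) (X (2 + J)) (ι 16) (ι (n + n)) (ι (3 + J)) (ι 2) (Sum 1 (n ∸ 1) (Z (2 + J))) ω (ι 1) (ι 3))
         (trans (cong (ι n ⊗ (ι (3 + J) ⊖ ω) ⊕_) consts) (ℚP.+-identityʳ (ι n ⊗ (ι (3 + J) ⊖ ω)))))))
  where
  n : ℕ
  n = 2 ^ (3 + J)
  sn : suc (n ∸ 1) ≡ n
  sn = ℕP.m+[n∸m]≡n (ℕP.^-monoʳ-≤ 2 {0} {3 + J} z≤n)
  low : ℚ
  low = ι n ⊗ ω ⊖ (4ℚ ⊕ ι 1 ⊕ ι 2 ⊕ ι 2 ⊕ ι 2) ⊕ (ι n ⊗ σ (2 + J) ⊖ X (2 + J))
  lem : ∀ n s x c m i t z w o h → n ⊗ s ⊕ ((m ⊖ (x ⊕ c)) ⊕ ((i ⊗ n ⊕ t ⊖ (z ⊕ m)) ⊕ ((z ⊖ (n ⊗ w ⊖ (2ℚ ⊕ 2ℚ ⊕ o ⊕ t ⊕ t ⊕ t) ⊕ (n ⊗ s ⊖ x))) ⊕ h)))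
     ≡ n ⊗ (i ⊖ w) ⊕ (t ⊖ c ⊕ (2ℚ ⊕ 2ℚ ⊕ o ⊕ t ⊕ t ⊕ t) ⊕ h)
  lem = solve-∀ ℚring
  consts : ι 2 ⊖ ι 16 ⊕ (4ℚ ⊕ ι 1 ⊕ ι 2 ⊕ ι 2 ⊕ ι 2) ⊕ ι 3 ≡ 0ℚ
  consts rewrite ι-val 2 | ι-val 16 | ι-val 1 | ι-val 3 = refl

iv² : ℕ → ℚ
iv² p = iv p ⊗ iv p

0≤ΣLiv² : ∀ ps → 0ℚ ≤ℚ ΣL ps iv²
0≤ΣLiv² []       = ℚP.≤-refl
0≤ΣLiv² (p ∷ ps) = 0≤⊕ (0≤ΣLiv² ps) (0≤⊗ (0≤iv p) (0≤iv p))

ΣLiv²≤ : ∀ m → .{{_ : NonZero m}} → ∀ ps → All (m ≤_) ps → ΣL ps iv² ≤ℚ ι (length ps) ⊗ iv² m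
ΣLiv²≤ m []       []       = ℚP.≤-reflexive (sym (trans (cong (_⊗ iv² m) ι0) (ℚP.*-zeroˡ (iv² m))))
ΣLiv²≤ m (p ∷ ps) (h ∷ hs) = ℚP.≤-trans (ℚP.+-mono-≤ (ΣLiv²≤ m ps hs) (⊗-mono (0≤iv p) (0≤iv m) (iv-antimono h) (iv-antimono h)))
    (ℚP.≤-reflexive (trans (lem (ι (length ps)) (iv² m)) (cong (_⊗ iv² m) (sym (ι-suc (length ps))))))
  where
  lem : ∀ x y → x ⊗ y ⊕ y ≡ (1ℚ ⊕ x) ⊗ y
  lem = solve-∀ ℚring

ρ : ℕ → ℚ
ρ J = Sum 1 J (λ j → ι j ⊗ ΣL (cls j) iv²)

ρ-class : ∀ j m ℓ → .{{_ : NonZero m}} → length (cls j) ≡ ℓ → All (m ≤_) (cls j) → ι j ⊗ ΣL (cls j) iv² ≤ℚ ι j ⊗ (ι ℓ ⊗ iv² m)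
ρ-class j m ℓ refl al = ⊗-monoʳ (0≤ι j) (ΣLiv²≤ m (cls j) al)

ρ₅ : ℚ
ρ₅ = ι 3 ⊗ (ι 2 ⊗ iv² 11) ⊕ ι 4 ⊗ (ι 5 ⊗ iv² 17) ⊕ ι 5 ⊗ (ι 7 ⊗ iv² 37)

-- Classes 3, 4, 5 contain 2, 5, 7 primes, starting at 11, 17, 37. From class 6 on, `chebyshev`
-- bounds class j by 2/2^j, and these terms add up to at most 2/2^5.
ρ≤ : ∀ J → ρ J ≤ℚ ρ₅ ⊕ (iv (2 ^ 5) ⊕ iv (2 ^ 5))
ρ≤ J = ℚP.≤-trans (Sum-grow J 5 (λ j → 0≤⊗ (0≤ι j) (0≤ΣLiv² (cls j))))
    (ℚP.≤-trans (≤-by (iv (2 ^ (J + 5)) ⊕ iv (2 ^ (J + 5))) (0≤⊕ (0≤iv (2 ^ (J + 5))) (0≤iv (2 ^ (J + 5)))) refl)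
      (subst (λ t → ρ t ⊕ (iv (2 ^ t) ⊕ iv (2 ^ t)) ≤ℚ ρ₅ ⊕ (iv (2 ^ 5) ⊕ iv (2 ^ 5))) (ℕP.+-comm 5 J) (tail J)))
  where
  base : ρ 5 ≤ℚ ρ₅
  base = ℚP.+-mono-≤ (ℚP.+-mono-≤ (ℚP.≤-trans (ℚP.≤-reflexive (trans (cong (_⊕ ι 3 ⊗ ΣL (cls 3) iv²) (trans (cong₂ (λ x y → 0ℚ ⊕ x ⊕ y) (ℚP.*-zeroʳ (ι 1)) (ℚP.*-zeroʳ (ι 2))) refl)) (ℚP.+-identityˡ _)))
        (ρ-class 3 11 2 refl (toWitness {a? = All.all? (11 ℕP.≤?_) (cls 3)} tt)))
      (ρ-class 4 17 5 refl (toWitness {a? = All.all? (17 ℕP.≤?_) (cls 4)} tt)))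
      (ρ-class 5 37 7 refl (toWitness {a? = All.all? (37 ℕP.≤?_) (cls 5)} tt))
  tail : ∀ k → ρ (5 + k) ⊕ (iv (2 ^ (5 + k)) ⊕ iv (2 ^ (5 + k))) ≤ℚ ρ₅ ⊕ (iv (2 ^ 5) ⊕ iv (2 ^ 5))
  tail zero    = ℚP.+-monoˡ-≤ (iv (2 ^ 5) ⊕ iv (2 ^ 5)) base
  tail (suc k) = ℚP.≤-trans (ℚP.≤-trans (ℚP.+-monoˡ-≤ (i ⊕ i) (ℚP.+-monoʳ-≤ (ρ (5 + k)) cl)) (ℚP.≤-reflexive (trans (lem (ρ (5 + k)) i) (cong (λ t → ρ (5 + k) ⊕ (t ⊕ t)) halve)))) (tail k)
    where
    j : ℕ
    j = suc (5 + k)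
    i : ℚ
    i = iv (2 ^ j)
    instance
      nz : NonZero (2 ^ j)
      nz = ℕP.m^n≢0 2 j
      nz′ : NonZero (2 ^ (5 + k))
      nz′ = ℕP.m^n≢0 2 (5 + k)
    lem : ∀ r i → r ⊕ (i ⊕ i) ⊕ (i ⊕ i) ≡ r ⊕ (2ℚ ⊗ i ⊕ 2ℚ ⊗ i)
    lem = solve-∀ ℚring
    halve : 2ℚ ⊗ i ≡ iv (2 ^ (5 + k))
    halve = trans (cong₂ _⊗_ (sym ι2) (iv-* 2 (2 ^ (5 + k)))) (trans (sym (ℚP.*-assoc (ι 2) (iv 2) (iv (2 ^ (5 + k))))) (trans (cong (_⊗ iv (2 ^ (5 + k))) (ι⊗iv 2)) (ℚP.*-identityˡ (iv (2 ^ (5 + k))))))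
    cl : ι j ⊗ ΣL (cls j) iv² ≤ℚ i ⊕ i
    cl = ℚP.≤-trans (⊗-monoʳ (0≤ι j) (ΣLiv²≤ (2 ^ j) (cls j) (All.map (λ { (_ , _ , lo , _) → lo }) (cls-in j))))
       (ℚP.≤-trans (ℚP.≤-reflexive (trans (sym (ℚP.*-assoc (ι j) (ι (length (cls j))) (i ⊗ i))) (cong (_⊗ (i ⊗ i)) (sym (ι-* j (length (cls j)))))))
       (ℚP.≤-trans (⊗-monoˡ (0≤⊗ (0≤iv (2 ^ j)) (0≤iv (2 ^ j))) (ι-mono-≤ (chebyshev j)))
         (ℚP.≤-reflexive (trans (cong (_⊗ (i ⊗ i)) (ι-* 2 (2 ^ j))) (trans (lem₂ (ι 2) (ι (2 ^ j)) i) (trans (cong (λ t → ι 2 ⊗ (t ⊗ i)) (ι⊗iv (2 ^ j))) (trans (cong₂ _⊗_ ι2 (ℚP.*-identityˡ i)) (lem₃ i))))))))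
      where
      lem₂ : ∀ a b i → a ⊗ b ⊗ (i ⊗ i) ≡ a ⊗ (b ⊗ i ⊗ i)
      lem₂ = solve-∀ ℚring
      lem₃ : ∀ i → 2ℚ ⊗ i ≡ i ⊕ i
      lem₃ = solve-∀ ℚring

Στ : ∀ J → Sum 1 J τ ≡ σ J ⊕ (ρ J ⊕ ρ J)
Στ zero    = refl
Στ (suc J) = trans (cong₂ _⊕_ (Στ J) (cong (ι (suc J) ⊗_) (wt-sum (cls (suc J))))) (lem (σ J) (ρ J) (ι (suc J)) (ΣL (cls (suc J)) iv) (ΣL (cls (suc J)) iv²))
  where
  lem : ∀ s r j x y → s ⊕ (r ⊕ r) ⊕ j ⊗ (x ⊕ (y ⊕ y)) ≡ s ⊕ j ⊗ x ⊕ (r ⊕ j ⊗ y ⊕ (r ⊕ j ⊗ y))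
  lem = solve-∀ ℚring
  wt-sum : ∀ ps → ΣL ps wt ≡ ΣL ps iv ⊕ (ΣL ps iv² ⊕ ΣL ps iv²)
  wt-sum []       = refl
  wt-sum (p ∷ ps) = trans (cong (_⊕ wt p) (wt-sum ps)) (lem′ (ΣL ps iv) (ΣL ps iv²) (iv p) (iv² p))
    where
    lem′ : ∀ a b i k → a ⊕ (b ⊕ b) ⊕ (i ⊕ (k ⊕ k)) ≡ a ⊕ i ⊕ (b ⊕ k ⊕ (b ⊕ k))
    lem′ = solve-∀ ℚring

-- multiples of the unit iv U serve as decimal approximations
iv-lower : ∀ U k m → .{{_ : NonZero U}} → .{{_ : NonZero k}} → m * k ≤ U → ι m ⊗ iv U ≤ℚ iv k
iv-lower U k m le = ℚP.≤-trans (ℚP.≤-reflexive (sym (trans (lem₁ (ι m) (ι k) (iv k) (iv U)) (trans (cong (λ t → ι m ⊗ (t ⊗ iv U)) (ι⊗iv k)) (cong (ι m ⊗_) (ℚP.*-identityˡ (iv U)))))))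
    (ℚP.≤-trans (⊗-monoˡ (0≤⊗ (0≤iv k) (0≤iv U)) (ℚP.≤-trans (ℚP.≤-reflexive (sym (ι-* m k))) (ι-mono-≤ le)))
      (ℚP.≤-reflexive (trans (lem₂ (ι U) (iv k) (iv U)) (trans (cong (iv k ⊗_) (ι⊗iv U)) (ℚP.*-identityʳ (iv k))))))
  where
  lem₁ : ∀ m k i u → m ⊗ k ⊗ (i ⊗ u) ≡ m ⊗ (k ⊗ i ⊗ u)
  lem₁ = solve-∀ ℚring
  lem₂ : ∀ n i u → n ⊗ (i ⊗ u) ≡ i ⊗ (n ⊗ u)
  lem₂ = solve-∀ ℚring

iv-upper : ∀ U k m → .{{_ : NonZero U}} → .{{_ : NonZero k}} → U ≤ m * k → iv k ≤ℚ ι m ⊗ iv U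
iv-upper U k m le = ℚP.≤-trans (ℚP.≤-reflexive (sym (trans (lem₂ (ι U) (iv k) (iv U)) (trans (cong (iv k ⊗_) (ι⊗iv U)) (ℚP.*-identityʳ (iv k))))))
    (ℚP.≤-trans (⊗-monoˡ (0≤⊗ (0≤iv k) (0≤iv U)) (ℚP.≤-trans (ι-mono-≤ le) (ℚP.≤-reflexive (ι-* m k))))
      (ℚP.≤-reflexive (trans (lem₁ (ι m) (ι k) (iv k) (iv U)) (trans (cong (λ t → ι m ⊗ (t ⊗ iv U)) (ι⊗iv k)) (cong (ι m ⊗_) (ℚP.*-identityˡ (iv U)))))))
  where
  lem₁ : ∀ m k i u → m ⊗ k ⊗ (i ⊗ u) ≡ m ⊗ (k ⊗ i ⊗ u)
  lem₁ = solve-∀ ℚring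
  lem₂ : ∀ n i u → n ⊗ (i ⊗ u) ≡ i ⊗ (n ⊗ u)
  lem₂ = solve-∀ ℚring

module _ (U : ℕ) .{{_ : NonZero U}} where
  Below Above : ℚ → ℕ → Set
  Below x m = ι m ⊗ iv U ≤ℚ x
  Above x m = x ≤ℚ ι m ⊗ iv U

  unit-+ : ∀ m n → ι (m + n) ⊗ iv U ≡ ι m ⊗ iv U ⊕ ι n ⊗ iv U
  unit-+ m n = trans (cong (_⊗ iv U) (ι-+ m n)) (ℚP.*-distribʳ-+ (iv U) (ι m) (ι n))

  unit-* : ∀ s m → ι (s * m) ⊗ iv U ≡ ι s ⊗ (ι m ⊗ iv U)
  unit-* s m = trans (cong (_⊗ iv U) (ι-* s m)) (ℚP.*-assoc (ι s) (ι m) (iv U))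

  below-⊕ : ∀ {x y m n} → Below x m → Below y n → Below (x ⊕ y) (m + n)
  below-⊕ {m = m} {n} p q = ℚP.≤-trans (ℚP.≤-reflexive (unit-+ m n)) (ℚP.+-mono-≤ p q)

  above-⊕ : ∀ {x y m n} → Above x m → Above y n → Above (x ⊕ y) (m + n)
  above-⊕ {m = m} {n} p q = ℚP.≤-trans (ℚP.+-mono-≤ p q) (ℚP.≤-reflexive (sym (unit-+ m n)))

  below-⊗ : ∀ s {x m} → Below x m → Below (ι s ⊗ x) (s * m)
  below-⊗ s {m = m} p = ℚP.≤-trans (ℚP.≤-reflexive (unit-* s m)) (⊗-monoʳ (0≤ι s) p)

  above-⊗ : ∀ s {x m} → Above x m → Above (ι s ⊗ x) (s * m)
  above-⊗ s {m = m} p = ℚP.≤-trans (⊗-monoʳ (0≤ι s) p) (ℚP.≤-reflexive (sym (unit-* s m)))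

-- `σ≤` is one unit too large, so ω has to cover 1 + ¾ and twice the bound for ρ. The margin is
-- thin: 2.1788 against 2.1638.
mertens : ∀ n → Sum 1 (suc n) τ ≤ℚ ι (suc n) ⊖ ¾
mertens zero    = ℚP.≤-trans (ℚP.≤-reflexive (cong (0ℚ ⊕_) (ℚP.*-zeroʳ (ι 1)))) (subst (λ t → 0ℚ ≤ℚ t ⊖ ¾) (sym ι1) (toWitness {a? = 0ℚ ℚP.≤? (1ℚ ⊖ ¾)} tt))
mertens (suc J) = ℚP.≤-trans (ℚP.≤-reflexive (Στ (2 + J)))
    (ℚP.≤-trans (ℚP.+-mono-≤ (σ≤ J) (ℚP.+-mono-≤ (ρ≤ (2 + J)) (ρ≤ (2 + J))))
      (≤-by (ω ⊖ (1ℚ ⊕ ¾ ⊕ (c ⊕ c))) (0≤⊖ numeric) (trans (cong (λ t → t ⊖ ω ⊕ (c ⊕ c) ⊕ (ω ⊖ (1ℚ ⊕ ¾ ⊕ (c ⊕ c)))) (ι-suc (2 + J))) (lem (ι (2 + J)) ω c ¾))))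
  where
  c : ℚ
  c = ρ₅ ⊕ (iv (2 ^ 5) ⊕ iv (2 ^ 5))
  lem : ∀ i w c q → 1ℚ ⊕ i ⊖ w ⊕ (c ⊕ c) ⊕ (w ⊖ (1ℚ ⊕ q ⊕ (c ⊕ c))) ≡ i ⊖ q
  lem = solve-∀ ℚring
  U : ℕ
  U = 1000000
  numeric : 1ℚ ⊕ ¾ ⊕ (c ⊕ c) ≤ℚ ω
  numeric = ℚP.≤-trans (above-⊕ U {m = 1750000} {n = 2 * C} (ℚP.≤-reflexive one¾) cc)
      (ℚP.≤-trans (⊗-monoˡ (0≤iv U) (ι-mono-≤ (ℕP.≤ᵇ⇒≤ (1750000 + 2 * C) M tt))) ω-below)
    where
    C M : ℕ
    C = 3 * (2 * 8265) + 4 * (5 * 3461) + 5 * (7 * 731) + (31250 + 31250)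
    M = 0 + 500000 + 250000 + 125000 + 62500 + (1 * 333333 + 2 * 111111) + 2 * 200000 + 2 * 142857
    one¾ : 1ℚ ⊕ ¾ ≡ ι 1750000 ⊗ iv U
    one¾ = trans (sym (ℚP.*-identityʳ (1ℚ ⊕ ¾))) (trans (cong ((1ℚ ⊕ ¾) ⊗_) (trans (sym (ι⊗iv U)) (cong (_⊗ iv U) (ι-* 4 250000))))
      (trans (sym (ℚP.*-assoc (1ℚ ⊕ ¾) (ι 4 ⊗ ι 250000) (iv U))) (cong (_⊗ iv U) (trans (sym (ℚP.*-assoc (1ℚ ⊕ ¾) (ι 4) (ι 250000))) (trans (cong (_⊗ ι 250000) (trans (cong ((1ℚ ⊕ ¾) ⊗_) (ι-val 4)) (sym (ι-val 7)))) (sym (ι-* 7 250000)))))))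
    sqr : ∀ k m → .{{_ : NonZero k}} → .{{_ : NonZero (k * k)}} → T (U ≤ᵇ m * (k * k)) → Above U (iv² k) m
    sqr k m t = subst (λ x → Above U x m) (iv-* k k) (iv-upper U (k * k) m (ℕP.≤ᵇ⇒≤ U (m * (k * k)) t))
    c-above : Above U c C
    c-above = above-⊕ U (above-⊕ U (above-⊕ U (above-⊗ U 3 (above-⊗ U 2 (sqr 11 8265 tt))) (above-⊗ U 4 (above-⊗ U 5 (sqr 17 3461 tt)))) (above-⊗ U 5 (above-⊗ U 7 (sqr 37 731 tt))))
        (above-⊕ U (up 32 31250) (up 32 31250))
      where
      up : ∀ k m → .{{_ : NonZero k}} → {T (U ≤ᵇ m * k)} → Above U (iv k) m
      up k m {t} = iv-upper U k m (ℕP.≤ᵇ⇒≤ U (m * k) t)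
    cc : Above U (c ⊕ c) (2 * C)
    cc = subst (Above U (c ⊕ c)) (cong (C +_) (sym (ℕP.+-identityʳ C))) (above-⊕ U {c} {c} {C} {C} c-above c-above)
    lo : ∀ k m → .{{_ : NonZero k}} → {T (m * k ≤ᵇ U)} → Below U (iv k) m
    lo k m {t} = iv-lower U k m (ℕP.≤ᵇ⇒≤ (m * k) U t)
    ω-below : Below U ω M
    ω-below = below-⊕ U (below-⊕ U (below-⊕ U (below-⊕ U (below-⊕ U (below-⊕ U (below-⊕ U (ℚP.≤-reflexive (trans (cong (_⊗ iv U) ι0) (ℚP.*-zeroˡ (iv U)))) (lo 2 500000)) (lo 4 250000)) (lo 8 125000)) (lo 16 62500))
      (below-⊕ U (below-⊗ U 1 (lo 3 333333)) (below-⊗ U 2 (lo 9 111111)))) (below-⊗ U 2 (lo 5 200000))) (below-⊗ U 2 (lo 7 142857))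

-- The norm of the sieve weight

_^ℚ_ : ℚ → ℕ → ℚ
x ^ℚ zero  = 1ℚ
x ^ℚ suc n = x ⊗ (x ^ℚ n)

0≤^ℚ : ∀ {x} n → 0ℚ ≤ℚ x → 0ℚ ≤ℚ x ^ℚ n
0≤^ℚ zero    h = 0≤1
0≤^ℚ (suc n) h = 0≤⊗ h (0≤^ℚ n h)

-- This is (1 + 2y)^m ≤ (1 - my)^(-2) without division. For v = 1 - (m+1)y, (v + y)² exceeds (1 +
-- 2y) v² by 2yv(1 - v) + y².
bernoulli² : ∀ y m → 0ℚ ≤ℚ y → 0ℚ ≤ℚ 1ℚ ⊖ ι m ⊗ y → ((1ℚ ⊕ (y ⊕ y)) ^ℚ m) ⊗ ((1ℚ ⊖ ι m ⊗ y) ⊗ (1ℚ ⊖ ι m ⊗ y)) ≤ℚ 1ℚ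
bernoulli² y zero    y0 h = ℚP.≤-reflexive (trans (cong (λ t → 1ℚ ⊗ ((1ℚ ⊖ t ⊗ y) ⊗ (1ℚ ⊖ t ⊗ y))) ι0) (lem y))
  where
  lem : ∀ y → 1ℚ ⊗ ((1ℚ ⊖ 0ℚ ⊗ y) ⊗ (1ℚ ⊖ 0ℚ ⊗ y)) ≡ 1ℚ
  lem = solve-∀ ℚring
bernoulli² y (suc m) y0 h = ℚP.≤-trans (≤-by (P ⊗ ((y ⊕ y) ⊗ v ⊗ (1ℚ ⊖ v) ⊕ y ⊗ y)) (0≤⊗ (0≤^ℚ m (0≤⊕ 0≤1 (0≤⊕ y0 y0))) (0≤⊕ (0≤⊗ (0≤⊗ (0≤⊕ y0 y0) h) 1-v) (0≤⊗ y0 y0)))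
      (trans (lem P y v) (cong (λ t → P ⊗ (t ⊗ t)) u)))
    (bernoulli² y m y0 (subst (0ℚ ≤ℚ_) u (0≤⊕ h y0)))
  where
  P v : ℚ
  P = (1ℚ ⊕ (y ⊕ y)) ^ℚ m
  v = 1ℚ ⊖ ι (suc m) ⊗ y
  lem : ∀ P y v → (1ℚ ⊕ (y ⊕ y)) ⊗ P ⊗ (v ⊗ v) ⊕ P ⊗ ((y ⊕ y) ⊗ v ⊗ (1ℚ ⊖ v) ⊕ y ⊗ y) ≡ P ⊗ ((v ⊕ y) ⊗ (v ⊕ y))
  lem = solve-∀ ℚring
  lem₂ : ∀ x y → 1ℚ ⊖ (1ℚ ⊕ x) ⊗ y ⊕ y ≡ 1ℚ ⊖ x ⊗ y
  lem₂ = solve-∀ ℚring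
  lem₃ : ∀ x → 1ℚ ⊖ (1ℚ ⊖ x) ≡ x
  lem₃ = solve-∀ ℚring
  u : v ⊕ y ≡ 1ℚ ⊖ ι m ⊗ y
  u = trans (cong (λ t → 1ℚ ⊖ t ⊗ y ⊕ y) (ι-suc m)) (lem₂ (ι m) y)
  1-v : 0ℚ ≤ℚ 1ℚ ⊖ v
  1-v = subst (0ℚ ≤ℚ_) (sym (lem₃ (ι (suc m) ⊗ y))) (0≤⊗ (0≤ι (suc m)) y0)

q : ℕ → ℚ
q j = iv (2 ^ j)

rj : ℕ → ℚ
rj j = 1ℚ ⊕ (q j ⊕ q j)

yj : ℕ → ℚ
yj j = ½ ⊗ (q j ⊗ rj j)

0≤q : ∀ j → 0ℚ ≤ℚ q j
0≤q j = 0≤iv (2 ^ j)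

0≤rj : ∀ j → 0ℚ ≤ℚ rj j
0≤rj j = 0≤⊕ 0≤1 (0≤⊕ (0≤q j) (0≤q j))

4j≤2^j : ∀ i → 4 * (4 + i) ≤ 2 ^ (4 + i)
4j≤2^j zero    = ℕP.≤-refl
4j≤2^j (suc i) = ℕP.≤-trans (ℕP.≤-reflexive (lem i)) (ℕP.≤-trans (ℕP.+-mono-≤ (4j≤2^j i) (ℕP.≤-trans (ℕP.≤ᵇ⇒≤ 4 16 tt) (ℕP.^-monoʳ-≤ 2 (ℕP.m≤m+n 4 i)))) (ℕP.≤-reflexive (cong (2 ^ (4 + i) +_) (sym (ℕP.+-identityʳ (2 ^ (4 + i)))))))
  where
  lem : ∀ i → 4 * (5 + i) ≡ 4 * (4 + i) + 4
  lem = ℕRing.solve-∀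

-- With q = 2^(-j), the count gives mq ≤ 2/j, so m yj ≤ (1 + 2q)/j; and (1 - (1 + 2q)/j)² ≥ 1 - 2/j
-- because 4q ≤ 1/j. So a class contributes at most j/(j - 2), and the product over classes
-- telescopes.
factor : ∀ i m → (4 + i) * m ≤ 2 ^ (5 + i) → ((1ℚ ⊕ (yj (4 + i) ⊕ yj (4 + i))) ^ℚ m) ⊗ ι (2 + i) ≤ℚ ι (4 + i)
factor i m hm = ℚP.≤-trans (≤-by (P ⊗ (ι j ⊗ (U² ⊖ (1ℚ ⊖ (z ⊕ z))))) (0≤⊗ P0 (0≤⊗ (0≤ι j) (0≤⊖ key))) eq)
    (ℚP.≤-trans (ℚP.≤-reflexive (comm P (ι j) U²)) (ℚP.≤-trans (⊗-monoʳ (0≤ι j) (bernoulli² (yj j) m y0 (ℚP.≤-trans u0 uu))) (ℚP.≤-reflexive (ℚP.*-identityʳ (ι j)))))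
  where
  j : ℕ
  j = 4 + i
  instance
    nz : NonZero (2 ^ j)
    nz = ℕP.m^n≢0 2 j
  z P U² : ℚ
  z = iv j
  P = (1ℚ ⊕ (yj j ⊕ yj j)) ^ℚ m
  U² = (1ℚ ⊖ ι m ⊗ yj j) ⊗ (1ℚ ⊖ ι m ⊗ yj j)
  y0 : 0ℚ ≤ℚ yj j
  y0 = 0≤⊗ (ℚP.nonNegative⁻¹ ½) (0≤⊗ (0≤q j) (0≤rj j))
  P0 : 0ℚ ≤ℚ P
  P0 = 0≤^ℚ m (0≤⊕ 0≤1 (0≤⊕ y0 y0))
  comm : ∀ p j u → p ⊗ (j ⊗ u) ≡ j ⊗ (p ⊗ u)
  comm = solve-∀ ℚring
  jz : ι j ⊗ z ≡ 1ℚ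
  jz = ι⊗iv j
  m≤ : ι m ⊗ q j ≤ℚ z ⊕ z
  m≤ = ⊗-cancel-≤ (ι j) (0<ι j) (ℚP.≤-trans (ℚP.≤-reflexive (trans (sym (ℚP.*-assoc (ι j) (ι m) (q j))) (cong (_⊗ q j) (sym (ι-* j m)))))
      (ℚP.≤-trans (⊗-monoˡ (0≤q j) (ι-mono-≤ hm)) (ℚP.≤-reflexive (trans (cong (_⊗ q j) (ι-* 2 (2 ^ j))) (trans (ℚP.*-assoc (ι 2) (ι (2 ^ j)) (q j))
        (trans (cong₂ _⊗_ ι2 (ι⊗iv (2 ^ j))) (trans (two 1ℚ) (sym (trans (ℚP.*-distribˡ-+ (ι j) z z) (cong₂ _⊕_ jz jz))))))))))
    where
    two : ∀ x → 2ℚ ⊗ x ≡ x ⊕ x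
    two = solve-∀ ℚring
  my≤ : ι m ⊗ yj j ≤ℚ z ⊗ rj j
  my≤ = ℚP.≤-trans (ℚP.≤-reflexive (l (ι m) (q j) (rj j))) (ℚP.≤-trans (⊗-monoʳ (ℚP.nonNegative⁻¹ ½) (⊗-monoˡ (0≤rj j) m≤)) (ℚP.≤-reflexive (l′ z (rj j))))
    where
    l : ∀ m q r → m ⊗ (½ ⊗ (q ⊗ r)) ≡ ½ ⊗ (m ⊗ q ⊗ r)
    l = solve-∀ ℚring
    l′ : ∀ z r → ½ ⊗ ((z ⊕ z) ⊗ r) ≡ z ⊗ r
    l′ = solve-∀ ℚring
  4q≤z : 4ℚ ⊗ q j ≤ℚ z
  4q≤z = ⊗-cancel-≤ (ι j) (0<ι j) (ℚP.≤-trans (ℚP.≤-reflexive (trans (l (ι j) (q j)) (trans (cong (λ t → t ⊗ ι j ⊗ q j) (sym ι4)) (cong (_⊗ q j) (sym (ι-* 4 j))))))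
      (ℚP.≤-trans (⊗-monoˡ (0≤q j) (ι-mono-≤ (4j≤2^j i))) (ℚP.≤-reflexive (trans (ι⊗iv (2 ^ j)) (sym jz)))))
    where
    l : ∀ j q → j ⊗ (4ℚ ⊗ q) ≡ 4ℚ ⊗ j ⊗ q
    l = solve-∀ ℚring
  z≤1/4 : 4ℚ ⊗ z ≤ℚ 1ℚ
  z≤1/4 = ⊗-cancel-≤ (ι j) (0<ι j) (ℚP.≤-trans (ℚP.≤-reflexive (trans (l (ι j) z) (trans (cong (4ℚ ⊗_) jz) (ℚP.*-identityʳ 4ℚ))))
      (ℚP.≤-trans (ℚP.≤-reflexive (sym ι4)) (ℚP.≤-trans (ι-mono-≤ (ℕP.m≤m+n 4 i)) (ℚP.≤-reflexive (sym (ℚP.*-identityʳ (ι j)))))))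
    where
    l : ∀ j q → j ⊗ (4ℚ ⊗ q) ≡ 4ℚ ⊗ (j ⊗ q)
    l = solve-∀ ℚring
  z0 : 0ℚ ≤ℚ z
  z0 = 0≤iv j
  u₁ : ℚ
  u₁ = 1ℚ ⊖ z ⊗ rj j
  uu : u₁ ≤ℚ 1ℚ ⊖ ι m ⊗ yj j
  uu = ℚP.+-monoʳ-≤ 1ℚ (ℚP.neg-antimono-≤ my≤)
  1-z : 0ℚ ≤ℚ 1ℚ ⊖ z
  1-z = 0≤⊖ {z} {1ℚ} (ℚP.≤-trans (≤-by (z ⊕ z ⊕ z) (0≤⊕ (0≤⊕ z0 z0) z0) (l z)) z≤1/4)
    where
    l : ∀ z → z ⊕ (z ⊕ z ⊕ z) ≡ 4ℚ ⊗ z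
    l = solve-∀ ℚring
  u0 : 0ℚ ≤ℚ u₁
  u0 = subst (0ℚ ≤ℚ_) (l z (q j)) (0≤⊕ (0≤⊖ z≤1/4) (0≤⊗ z0 (0≤⊕ (0≤⊕ (0≤⊖ (ℚP.≤-trans 4q≤z z≤)) (0≤⊕ (0≤q j) (0≤q j))) (ℚP.nonNegative⁻¹ 2ℚ))))
    where
    z≤ : z ≤ℚ 1ℚ
    z≤ = ≤-by (1ℚ ⊖ z) 1-z (l₀ z)
      where
      l₀ : ∀ z → z ⊕ (1ℚ ⊖ z) ≡ 1ℚ
      l₀ = solve-∀ ℚring
    l : ∀ z q → 1ℚ ⊖ 4ℚ ⊗ z ⊕ z ⊗ (1ℚ ⊖ 4ℚ ⊗ q ⊕ (q ⊕ q) ⊕ 2ℚ) ≡ 1ℚ ⊖ z ⊗ (1ℚ ⊕ (q ⊕ q))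
    l = solve-∀ ℚring
  key : 1ℚ ⊖ (z ⊕ z) ≤ℚ U²
  key = ℚP.≤-trans (≤-by (z ⊗ (z ⊖ 4ℚ ⊗ q j) ⊕ (z ⊗ z ⊗ 4ℚ ⊗ q j ⊕ 4ℚ ⊗ (z ⊗ z) ⊗ (q j ⊗ q j))) (0≤⊕ (0≤⊗ z0 (0≤⊖ 4q≤z)) (0≤⊕ (0≤⊗ (0≤⊗ (0≤⊗ z0 z0) 4≥0) (0≤q j)) (0≤⊗ (0≤⊗ 4≥0 (0≤⊗ z0 z0)) (0≤⊗ (0≤q j) (0≤q j))))) (l z (q j)))
     (⊗-mono u0 (ℚP.≤-trans u0 uu) uu uu)
    where
    4≥0 : 0ℚ ≤ℚ 4ℚ
    4≥0 = ℚP.nonNegative⁻¹ 4ℚ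
    l : ∀ z q → 1ℚ ⊖ (z ⊕ z) ⊕ (z ⊗ (z ⊖ 4ℚ ⊗ q) ⊕ (z ⊗ z ⊗ 4ℚ ⊗ q ⊕ 4ℚ ⊗ (z ⊗ z) ⊗ (q ⊗ q)))
      ≡ (1ℚ ⊖ z ⊗ (1ℚ ⊕ (q ⊕ q))) ⊗ (1ℚ ⊖ z ⊗ (1ℚ ⊕ (q ⊕ q)))
    l = solve-∀ ℚring
  eq : P ⊗ ι (2 + i) ⊕ P ⊗ (ι j ⊗ (U² ⊖ (1ℚ ⊖ (z ⊕ z)))) ≡ P ⊗ (ι j ⊗ U²)
  eq = trans (l P (ι (2 + i)) (ι j) U² z) (trans (cong (λ t → P ⊗ (ι j ⊗ U²) ⊕ P ⊗ (ι (2 + i) ⊖ ι j ⊕ (t ⊕ t))) jz) (trans (cong (λ t → P ⊗ (ι j ⊗ U²) ⊕ P ⊗ (ι (2 + i) ⊖ t ⊕ 2ℚ)) (trans (ι-+ 2 (2 + i)) (cong (_⊕ ι (2 + i)) ι2))) (l′ P (ι (2 + i)) (ι j ⊗ U²))))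
    where
    l : ∀ p a j u z → p ⊗ a ⊕ p ⊗ (j ⊗ (u ⊖ (1ℚ ⊖ (z ⊕ z)))) ≡ p ⊗ (j ⊗ u) ⊕ p ⊗ (a ⊖ j ⊕ (j ⊗ z ⊕ j ⊗ z))
    l = solve-∀ ℚring
    l′ : ∀ p a u → p ⊗ u ⊕ p ⊗ (a ⊖ (2ℚ ⊕ a) ⊕ 2ℚ) ≡ p ⊗ u
    l′ = solve-∀ ℚring

nu0 : ∀ es → nu es 0 ≡ 0ℚ
nu0 []             = ι0
nu0 ((p , s) ∷ es) = trans (cong₂ (λ x y → x ⊕ (1ℚ ⊕ (ih p ⊕ ih p)) ⊗ y) (nu0 es) (trans (cong (nu es) (ℕP.0∸n≡0 s)) (nu0 es))) (lem (1ℚ ⊕ (ih p ⊕ ih p)))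
  where
  lem : ∀ r → 0ℚ ⊕ r ⊗ 0ℚ ≡ 0ℚ
  lem = solve-∀ ℚring

nu-skip : ∀ ps j es K → K ≤ j → nu (map (λ p → p , j) ps ++ es) K ≡ nu es K
nu-skip []       j es K le = refl
nu-skip (p ∷ ps) j es K le = trans (cong₂ (λ x y → x ⊕ (1ℚ ⊕ (ih p ⊕ ih p)) ⊗ y) (nu-skip ps j es K le)
    (trans (cong (nu (map (λ p → p , j) ps ++ es)) (ℕP.m≤n⇒m∸n≡0 le)) (nu0 (map (λ p → p , j) ps ++ es)))) (lem (nu es K) (1ℚ ⊕ (ih p ⊕ ih p)))
  where
  lem : ∀ x r → x ⊕ r ⊗ 0ℚ ≡ x
  lem = solve-∀ ℚring

-- A prime of class at least K multiplies only `nu` at 0, which is 0. So the norm involves primes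
-- below 2^K only, although `W` runs up to 2^(Y+1).
nu-trunc : ∀ j k K → K ≤ suc j → nu (es (k + j)) K ≡ nu (es j) K
nu-trunc j zero    K le = refl
nu-trunc j (suc k) K le = trans (nu-skip (cls (suc (k + j))) (suc (k + j)) (es (k + j)) K (ℕP.≤-trans le (s≤s (ℕP.m≤n+m j k)))) (nu-trunc j k K le)

-- Rankin's trick: the cutoff at K is majorised by a multiple of 2^K, so that a prime of class j
-- costs the factor 2^(-j) and the norm becomes an Euler product.
shift-bound : ∀ es P j → 0ℚ ≤ℚ P → (∀ K → nu es K ≤ℚ ½ ⊗ (ι (2 ^ K) ⊗ P)) → ∀ K → nu es (K ∸ j) ≤ℚ ½ ⊗ (ι (2 ^ K) ⊗ P) ⊗ q j
shift-bound es P j P0 h K with j ℕP.≤? K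
... | no j≰K = ℚP.≤-trans (ℚP.≤-reflexive (trans (cong (nu es) (ℕP.m≤n⇒m∸n≡0 (ℕP.<⇒≤ (ℕP.≰⇒> j≰K)))) (nu0 es))) (0≤⊗ (0≤⊗ (ℚP.nonNegative⁻¹ ½) (0≤⊗ (0≤ι (2 ^ K)) P0)) (0≤q j))
... | yes j≤K = ℚP.≤-trans (h (K ∸ j)) (ℚP.≤-reflexive (sym (trans (cong (λ t → ½ ⊗ (t ⊗ P) ⊗ q j) (trans (cong (λ t → ι (2 ^ t)) (sym (ℕP.m∸n+n≡m j≤K))) (trans (cong ι (ℕP.^-distribˡ-+-* 2 (K ∸ j) j)) (ι-* (2 ^ (K ∸ j)) (2 ^ j)))))
    (trans (lem ½ (ι (2 ^ (K ∸ j))) (ι (2 ^ j)) P (q j)) (trans (cong (½ ⊗ (ι (2 ^ (K ∸ j)) ⊗ P) ⊗_) (ι⊗iv (2 ^ j) {{ℕP.m^n≢0 2 j}})) (ℚP.*-identityʳ (½ ⊗ (ι (2 ^ (K ∸ j)) ⊗ P))))))))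
  where
  lem : ∀ h a b p i → h ⊗ (a ⊗ b ⊗ p) ⊗ i ≡ h ⊗ (a ⊗ p) ⊗ (b ⊗ i)
  lem = solve-∀ ℚring

r≤rj : ∀ {j p} → InClass j p → 1ℚ ⊕ (ih p ⊕ ih p) ≤ℚ rj j
r≤rj {j} {p} (pr , h , lo , _) = ℚP.+-monoʳ-≤ 1ℚ (ℚP.+-mono-≤ le le)
  where
  le : ih p ≤ℚ q j
  le = iv-antimono {{ℕP.m^n≢0 2 j}} (ℕP.≤-pred (ℕP.≤-trans (ℕP.≤∧≢⇒< lo (λ e → prime-not-2^ j pr h (sym e))) (ℕP.≤-reflexive (sym (ℕP.suc-pred p {{prime⇒nonZero pr}})))))

nu-class : ∀ ps j es P → All (InClass j) ps → 0ℚ ≤ℚ P → (∀ K → nu es K ≤ℚ ½ ⊗ (ι (2 ^ K) ⊗ P)) →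
  ∀ K → nu (map (λ p → p , j) ps ++ es) K ≤ℚ ½ ⊗ (ι (2 ^ K) ⊗ (((1ℚ ⊕ (yj j ⊕ yj j)) ^ℚ length ps) ⊗ P))
nu-class []       j es P []       P0 h K = ℚP.≤-trans (h K) (ℚP.≤-reflexive (cong (λ t → ½ ⊗ (ι (2 ^ K) ⊗ t)) (sym (ℚP.*-identityˡ P))))
nu-class (p ∷ ps) j es P (c ∷ cs) P0 h K = ℚP.≤-trans (ℚP.+-mono-≤ (IH K) (⊗-mono (0≤r p) (0≤⊗ (0≤⊗ (ℚP.nonNegative⁻¹ ½) (0≤⊗ (0≤ι (2 ^ K)) P′0)) (0≤q j)) (r≤rj {j} {p} c) (shift-bound (map (λ p → p , j) ps ++ es) P′ j P′0 IH K)))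
    (ℚP.≤-reflexive (lem (ι (2 ^ K)) ((1ℚ ⊕ (yj j ⊕ yj j)) ^ℚ length ps) P (rj j) (q j)))
  where
  P′ : ℚ
  P′ = ((1ℚ ⊕ (yj j ⊕ yj j)) ^ℚ length ps) ⊗ P
  P′0 : 0ℚ ≤ℚ P′
  P′0 = 0≤⊗ (0≤^ℚ (length ps) (0≤⊕ 0≤1 (0≤⊕ y0 y0))) P0
    where
    y0 : 0ℚ ≤ℚ yj j
    y0 = 0≤⊗ (ℚP.nonNegative⁻¹ ½) (0≤⊗ (0≤q j) (0≤rj j))
  IH : ∀ K → nu (map (λ p → p , j) ps ++ es) K ≤ℚ ½ ⊗ (ι (2 ^ K) ⊗ P′)
  IH = nu-class ps j es P cs P0 h
  lem : ∀ k x p r q → ½ ⊗ (k ⊗ (x ⊗ p)) ⊕ r ⊗ (½ ⊗ (k ⊗ (x ⊗ p)) ⊗ q) ≡ ½ ⊗ (k ⊗ ((1ℚ ⊕ (½ ⊗ (q ⊗ r) ⊕ ½ ⊗ (q ⊗ r))) ⊗ x ⊗ p))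
  lem = solve-∀ ℚring

2K≤2^K : ∀ K → K + K ≤ 2 ^ K
2K≤2^K zero                = z≤n
2K≤2^K (suc zero)          = ℕP.≤-refl
2K≤2^K (suc (suc zero))    = ℕP.≤-refl
2K≤2^K (suc K@(suc (suc _))) = ℕP.≤-trans (ℕP.≤-reflexive (lem K)) (ℕP.≤-trans (ℕP.+-mono-≤ (2K≤2^K K) (ℕP.^-monoʳ-≤ 2 {1} {K} (s≤s z≤n))) (ℕP.≤-reflexive (cong (2 ^ K +_) (sym (ℕP.+-identityʳ (2 ^ K))))))
  where
  lem : ∀ K → suc K + suc K ≡ K + K + 2
  lem = ℕRing.solve-∀

nu-base : ∀ K → nu (es 2) K ≤ℚ ½ ⊗ (ι (2 ^ K) ⊗ 1ℚ)
nu-base K = ℚP.≤-trans (ℚP.≤-reflexive (lem (ι K))) (⊗-monoʳ (ℚP.nonNegative⁻¹ ½) (ℚP.≤-trans (ℚP.≤-reflexive (sym (ι-+ K K))) (ℚP.≤-trans (ι-mono-≤ (2K≤2^K K)) (ℚP.≤-reflexive (sym (ℚP.*-identityʳ (ι (2 ^ K))))))))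
  where
  lem : ∀ k → k ≡ ½ ⊗ (k ⊕ k)
  lem = solve-∀ ℚring

-- In the bound 9/40 · j(j-1), class 3 contributes (37/32)² ≤ 9/40 · 6, and each later class at most j/(j-2).
9/40 : ℚ
9/40 = ι 9 ⊗ iv 40

0≤9/40 : 0ℚ ≤ℚ 9/40
0≤9/40 = 0≤⊗ (0≤ι 9) (0≤iv 40)

nu≤ : ∀ i K → nu (es (3 + i)) K ≤ℚ ½ ⊗ (ι (2 ^ K) ⊗ (9/40 ⊗ ι ((3 + i) * (2 + i))))
nu≤ zero K = ℚP.≤-trans (nu-class (cls 3) 3 (es 2) 1ℚ (cls-in 3) 0≤1 nu-base K) (⊗-monoʳ (ℚP.nonNegative⁻¹ ½) (⊗-monoʳ (0≤ι (2 ^ K)) small-case))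
  where
  small-case : ((1ℚ ⊕ (yj 3 ⊕ yj 3)) ^ℚ length (cls 3)) ⊗ 1ℚ ≤ℚ 9/40 ⊗ ι 6
  small-case = toReal
    where
    toReal : ((1ℚ ⊕ (½ ⊗ (iv 8 ⊗ (1ℚ ⊕ (iv 8 ⊕ iv 8))) ⊕ ½ ⊗ (iv 8 ⊗ (1ℚ ⊕ (iv 8 ⊕ iv 8))))) ^ℚ 2) ⊗ 1ℚ ≤ℚ ι 9 ⊗ iv 40 ⊗ ι 6
    toReal = subst₂ _≤ℚ_ (cong (λ t → ((1ℚ ⊕ (½ ⊗ (t ⊗ (1ℚ ⊕ (t ⊕ t))) ⊕ ½ ⊗ (t ⊗ (1ℚ ⊕ (t ⊕ t))))) ^ℚ 2) ⊗ 1ℚ) (sym (iv-val 7)))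
       (trans (cong₂ (λ s t → s ⊗ t ⊗ ι′ 6) (sym (ι-val 9)) (sym (iv-val 39))) (cong (λ t → ι 9 ⊗ iv 40 ⊗ t) (sym (ι-val 6)))) (ℚP.≤ᵇ⇒≤ tt)
      where
      ι′ : ℕ → ℚ
      ι′ n = mkℚ (ℤ.+ n) 0 (CP.sym (CP.1-coprimeTo n))
nu≤ (suc i) K = ℚP.≤-trans (nu-class (cls (4 + i)) (4 + i) (es (3 + i)) (9/40 ⊗ ι ((3 + i) * (2 + i))) (cls-in (4 + i)) (0≤⊗ 0≤9/40 (0≤ι ((3 + i) * (2 + i)))) (nu≤ i) K)
    (⊗-monoʳ (ℚP.nonNegative⁻¹ ½) (⊗-monoʳ (0≤ι (2 ^ K)) (ℚP.≤-trans (ℚP.≤-reflexive (trans (cong (λ t → R ⊗ (9/40 ⊗ t)) (ι-* (3 + i) (2 + i))) (lem R 9/40 (ι (3 + i)) (ι (2 + i)))))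
      (ℚP.≤-trans (⊗-monoʳ (0≤⊗ 0≤9/40 (0≤ι (3 + i))) (factor i (length (cls (4 + i))) (chebyshev (4 + i))))
         (ℚP.≤-reflexive (trans (ℚP.*-assoc 9/40 (ι (3 + i)) (ι (4 + i))) (cong (9/40 ⊗_) (trans (sym (ι-* (3 + i) (4 + i))) (cong ι (ℕP.*-comm (3 + i) (4 + i)))))))))))
  where
  R : ℚ
  R = (1ℚ ⊕ (yj (4 + i) ⊕ yj (4 + i))) ^ℚ length (cls (4 + i))
  lem : ∀ r c a b → r ⊗ (c ⊗ (a ⊗ b)) ≡ c ⊗ a ⊗ (r ⊗ b)
  lem = solve-∀ ℚring

nu-bound : ∀ Y i → 3 + i ≤ Y → ι 80 ⊗ nu (es Y) (4 + i) ≤ℚ ι (2 ^ (4 + i) * (9 * ((3 + i) * (2 + i))))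
nu-bound Y i le = ℚP.≤-trans (⊗-monoʳ (0≤ι 80) (subst (λ t → nu (es t) (4 + i) ≤ℚ ½ ⊗ (ι (2 ^ (4 + i)) ⊗ (9/40 ⊗ ι ((3 + i) * (2 + i))))) (ℕP.m∸n+n≡m le)
      (ℚP.≤-trans (ℚP.≤-reflexive (nu-trunc (3 + i) (Y ∸ (3 + i)) (4 + i) ℕP.≤-refl)) (nu≤ i (4 + i)))))
    (ℚP.≤-reflexive (trans (cong (_⊗ (½ ⊗ (ι (2 ^ (4 + i)) ⊗ (9/40 ⊗ ι ((3 + i) * (2 + i)))))) (trans (ι-* 2 40) (cong (_⊗ ι 40) ι2)))
      (trans (lem (ι 40) (ι (2 ^ (4 + i))) (ι 9) (iv 40) (ι ((3 + i) * (2 + i)))) (trans (cong (λ t → t ⊗ (ι (2 ^ (4 + i)) ⊗ (ι 9 ⊗ ι ((3 + i) * (2 + i))))) (ι⊗iv 40))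
        (trans (ℚP.*-identityˡ _) (trans (cong (ι (2 ^ (4 + i)) ⊗_) (sym (ι-* 9 ((3 + i) * (2 + i))))) (sym (ι-* (2 ^ (4 + i)) (9 * ((3 + i) * (2 + i)))))))))))
  where
  lem : ∀ f k n v m → 2ℚ ⊗ f ⊗ (½ ⊗ (k ⊗ (n ⊗ v ⊗ m))) ≡ f ⊗ v ⊗ (k ⊗ (n ⊗ m))
  lem = solve-∀ ℚring

-- Nonempty classes have index at least 3, so for K = 2 no prime enters and the norm is 2.
nu-bound₂ : ∀ Y → 1 ≤ Y → ι 80 ⊗ nu (es Y) 2 ≤ℚ ι 160
nu-bound₂ Y le = ℚP.≤-reflexive (trans (cong (λ t → ι 80 ⊗ nu (es t) 2) (sym (ℕP.m∸n+n≡m le))) (trans (cong (ι 80 ⊗_) (nu-trunc 1 (Y ∸ 1) 2 ℕP.≤-refl)) (sym (ι-* 80 2))))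

count-bound : ℕ → ℕ
count-bound j@(suc (suc (suc _))) = 2 ^ suc j / j
count-bound _                     = 0

total : ℕ → ℕ
total zero    = 0
total (suc Y) = count-bound (suc Y) + total Y

3len≤ : ∀ Y → 3len (es Y) ≤ℚ 3ℚ ⊗ ι (total Y)
3len≤ zero    = ℚP.≤-reflexive (sym (trans (cong (3ℚ ⊗_) ι0) (ℚP.*-zeroʳ 3ℚ)))
3len≤ (suc Y) = ℚP.≤-trans (ℚP.≤-reflexive (app (cls (suc Y)))) (ℚP.≤-trans (ℚP.+-mono-≤ (3len≤ Y) (⊗-monoʳ 0≤3ℚ (ι-mono-≤ (cnt (suc Y)))))
    (ℚP.≤-reflexive (trans (lem (ι (total Y)) (ι (count-bound (suc Y)))) (cong (3ℚ ⊗_) (sym (ι-+ (count-bound (suc Y)) (total Y)))))))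
  where
  lem : ∀ a b → 3ℚ ⊗ a ⊕ 3ℚ ⊗ b ≡ 3ℚ ⊗ (b ⊕ a)
  lem = solve-∀ ℚring
  app : ∀ ps → 3len (map (λ p → p , suc Y) ps ++ es Y) ≡ 3len (es Y) ⊕ 3ℚ ⊗ ι (length ps)
  app []       = sym (trans (cong (λ t → 3len (es Y) ⊕ 3ℚ ⊗ t) ι0) (l₀ (3len (es Y))))
    where
    l₀ : ∀ x → x ⊕ 3ℚ ⊗ 0ℚ ≡ x
    l₀ = solve-∀ ℚring
  app (p ∷ ps) = trans (cong (_⊕ 3ℚ) (app ps)) (trans (l₁ (3len (es Y)) (ι (length ps))) (cong (λ t → 3len (es Y) ⊕ 3ℚ ⊗ t) (sym (ι-suc (length ps)))))
    where
    l₁ : ∀ x n → x ⊕ 3ℚ ⊗ n ⊕ 3ℚ ≡ x ⊕ 3ℚ ⊗ (1ℚ ⊕ n)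
    l₁ = solve-∀ ℚring
  cnt : ∀ j → length (cls j) ≤ count-bound j
  cnt zero                  = z≤n
  cnt (suc zero)            = z≤n
  cnt (suc (suc zero))      = z≤n
  cnt j@(suc (suc (suc _))) = subst (_≤ 2 ^ suc j / j) (trans (cong (_/ j) (ℕP.*-comm j (length (cls j)))) (DM.m*n/n≡m (length (cls j)) j)) (DM./-monoˡ-≤ j (chebyshev j))

-- The numerical criterion

AlmostPrimeAbove : ℕ → Set
AlmostPrimeAbove n = Σ ℕ λ a → n * n < a × a < suc n * suc n × Ω≤4 a

-- Multiplying the hypothesis of `sieve` by 80² gives 560 · 3 (1 + total) ν² < 80² · 2n E; a common
-- factor 80 cancels and leaves 21 and 160.
core : ∀ n Y K ν → suc K ≤ Y → suc n * suc n ≤ (2 ^ suc Y) ^ 3 → (∀ v → 1 ≤ v → v ≤ suc K → 0ℚ ≤ℚ E Y (suc K) v) →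
  ι 80 ⊗ nu (es Y) (suc K) ≤ℚ ι ν → ι (21 * ((1 + total Y) * (ν * ν))) <ℚ ι (160 * n) ⊗ E Y (suc K) (suc K) → AlmostPrimeAbove n
core n Y K ν K≤Y n≤ ptw hν hR = finish (sieve (n * n) (n + n) Y (suc K) hyp)
  where
  k : ℕ
  k = suc K
  D e V : ℚ
  D = 8ℚ ⊗ (3ℚ ⊗ A (es Y) k k ⊖ B (es Y) k k)
  e = E Y k k
  V = nu (es Y) k
  e≤D : e ≤ℚ D
  e≤D = mean-bound mertens Y K K≤Y ptw
  0≤80V : 0ℚ ≤ℚ ι 80 ⊗ V
  0≤80V = 0≤⊗ (0≤ι 80) (0≤nu (es Y) k)
  L : ℚ
  L = 3ℚ ⊕ 3len (es Y)
  L≤ : L ≤ℚ 3ℚ ⊗ ι (1 + total Y)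
  L≤ = ℚP.≤-trans (ℚP.+-monoʳ-≤ 3ℚ (3len≤ Y)) (ℚP.≤-reflexive (trans (lem (ι (total Y))) (cong (3ℚ ⊗_) (sym (ι-suc (total Y))))))
    where
    lem : ∀ x → 3ℚ ⊕ 3ℚ ⊗ x ≡ 3ℚ ⊗ (1ℚ ⊕ x)
    lem = solve-∀ ℚring
  hyp : ι 560 ⊗ (L ⊗ (V ⊗ V)) <ℚ ι (n + n) ⊗ D
  hyp = ⊗-cancel-< (ι 80 ⊗ ι 80) (subst (0ℚ <ℚ_) (ι-* 80 80) (0<ι 6400)) (ℚP.≤-<-trans
      (ℚP.≤-trans (ℚP.≤-reflexive (lem₁ (ι 80) (ι 560) L V))
        (⊗-monoʳ (0≤ι 560) (⊗-mono (0≤⊕ 0≤3ℚ (0≤3len (es Y))) (0≤⊗ (0≤ι ν) (0≤ι ν)) L≤ (⊗-mono 0≤80V (0≤ι ν) hν hν))))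
      (ℚP.<-≤-trans (subst (_<ℚ ι 80 ⊗ (ι (160 * n) ⊗ e)) (sym lhs) (ℚP.*-monoʳ-<-pos (ι 80) {{positive (0<ι 80)}} hR))
        (ℚP.≤-trans (ℚP.≤-reflexive rhs) (⊗-monoʳ (0≤⊗ (0≤ι 80) (0≤ι 80)) (⊗-monoʳ (0≤ι (n + n)) e≤D)))))
    where
    lem₁ : ∀ c x l v → c ⊗ c ⊗ (x ⊗ (l ⊗ (v ⊗ v))) ≡ x ⊗ (l ⊗ (c ⊗ v ⊗ (c ⊗ v)))
    lem₁ = solve-∀ ℚring
    lhs : ι 560 ⊗ (3ℚ ⊗ ι (1 + total Y) ⊗ (ι ν ⊗ ι ν)) ≡ ι 80 ⊗ ι (21 * ((1 + total Y) * (ν * ν)))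
    lhs = trans (cong (λ t → ι 560 ⊗ (t ⊗ ι (1 + total Y) ⊗ (ι ν ⊗ ι ν))) (sym ι3))
      (trans (cong₂ (λ s t → ι 560 ⊗ (s ⊗ t)) (sym (ι-* 3 (1 + total Y))) (sym (ι-* ν ν))) (trans (cong (ι 560 ⊗_) (sym (ι-* (3 * (1 + total Y)) (ν * ν)))) (trans (sym (ι-* 560 (3 * (1 + total Y) * (ν * ν))))
        (trans (cong ι (trans (nat 560 3 (1 + total Y) (ν * ν)) (ℕP.*-assoc 80 21 ((1 + total Y) * (ν * ν))))) (ι-* 80 (21 * ((1 + total Y) * (ν * ν))))))))
      where
      nat : ∀ a b t v → a * (b * t * v) ≡ a * b * (t * v)
      nat = ℕRing.solve-∀
    rhs : ι 80 ⊗ (ι (160 * n) ⊗ e) ≡ ι 80 ⊗ ι 80 ⊗ (ι (n + n) ⊗ e)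
    rhs = trans (cong (λ t → ι 80 ⊗ (t ⊗ e)) (trans (cong ι (trans (ℕP.*-assoc 80 2 n) (cong (80 *_) (cong (n +_) (ℕP.+-identityʳ n))))) (ι-* 80 (n + n)))) (lem (ι 80) (ι (n + n)) e)
      where
      lem : ∀ c m e → c ⊗ (c ⊗ m ⊗ e) ≡ c ⊗ c ⊗ (m ⊗ e)
      lem = solve-∀ ℚring
  sq-suc : suc (n * n) + (n + n) ≡ suc n * suc n
  sq-suc = nat n
    where
    nat : ∀ n → suc (n * n) + (n + n) ≡ suc n * suc n
    nat = ℕRing.solve-∀
  finish : Σ[ a ∈ ℕ ] suc (n * n) ≤ a × a < suc (n * n) + (n + n) × (2 ∤ a × 3 ∤ a × 5 ∤ a × 7 ∤ a) × W (es Y) a <ℚ 3ℚ → AlmostPrimeAbove n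
  finish (a , lo , hi , rough , w<3) = a , lo , subst (a <_) sq-suc hi , sieved⇒Ω≤4 Y a {{ℕ.>-nonZero (ℕP.≤-trans (s≤s z≤n) lo)}} (ℕP.<-≤-trans (subst (a <_) sq-suc hi) n≤) rough w<3

square-cancel-< : ∀ m n → m * m < n * n → m < n
square-cancel-< m n h = ℕP.≰⇒> (λ n≤m → ℕP.<-irrefl refl (ℕP.<-≤-trans h (ℕP.*-mono-≤ n≤m n≤m)))

Hm-+ : ∀ v k → Hm (v + k) ⊖ Hm v ≡ Sum (1 + v) k iv
Hm-+ v k = trans (cong (_⊖ Hm v) (Sum-++ 1 v k iv)) (lem (Hm v) (Sum (1 + v) k iv))
  where
  lem : ∀ a b → a ⊕ b ⊖ a ≡ b
  lem = solve-∀ ℚring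

-- Certificates in natural numbers

module Decimal (U : ℕ) .{{_ : NonZero U}} where
  -- Reciprocals rounded up to multiples of 1/U, which turns the conditions on `E` into comparisons
  -- of natural numbers.
  up : ℕ → ℕ → ℕ
  up v zero    = 0
  up v (suc k) = up v k + suc (U / suc (v + k))

  Hm-up : ∀ v Y → v ≤ Y → Hm Y ⊖ Hm v ≤ℚ ι (up v (Y ∸ v)) ⊗ iv U
  Hm-up v Y le = subst (λ t → Hm t ⊖ Hm v ≤ℚ ι (up v (Y ∸ v)) ⊗ iv U) (ℕP.m+[n∸m]≡n le) (ℚP.≤-trans (ℚP.≤-reflexive (Hm-+ v (Y ∸ v))) (go (Y ∸ v)))
    where
    go : ∀ k → Sum (1 + v) k iv ≤ℚ ι (up v k) ⊗ iv U
    go zero    = ℚP.≤-reflexive (sym (trans (cong (_⊗ iv U) ι0) (ℚP.*-zeroˡ (iv U))))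
    go (suc k) = above-⊕ U {m = up v k} {n = suc (U / suc (v + k))} (go k) (iv-upper U (suc (v + k)) (suc (U / suc (v + k))) (ℕP.<⇒≤ (lt (suc (v + k)))))
      where
      lt : ∀ d → .{{_ : NonZero d}} → U < suc (U / d) * d
      lt d = subst (_< suc (U / d) * d) (sym (DM.m≡m%n+[m/n]*n U d)) (ℕP.+-monoˡ-< (U / d * d) (DM.m%n<n U d))

  E-lower : ∀ Y K v → v ≤ Y → ι ((10 * (v * v) + 4 * (K * v) + 11 * v) * U) ⊖ ι (3 * U + 8 * (v * v) * up v (Y ∸ v)) ≤ℚ ι U ⊗ E Y K v
  E-lower Y K v le = ≤-by (ι U ⊗ (8ℚ ⊗ (sq v ⊗ (ι h ⊗ iv U ⊖ (Hm Y ⊖ Hm v))))) (0≤⊗ (0≤ι U) (0≤⊗ (ℚP.nonNegative⁻¹ 8ℚ) (0≤⊗ (0≤⊗ (0≤ι v) (0≤ι v)) (0≤⊖ (Hm-up v Y le)))))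
      (trans (cong₂ (λ s t → s ⊖ t ⊕ R) eq₁ eq₂) (trans (lem (ι U) (ι v) (ι K) (ι h) (iv U) (Hm Y ⊖ Hm v)) (trans (cong (λ t → ι U ⊗ E Y K v ⊕ 8ℚ ⊗ (sq v ⊗ ι h) ⊗ (t ⊖ 1ℚ)) (ι⊗iv U)) (z (ι U ⊗ E Y K v) (8ℚ ⊗ (sq v ⊗ ι h))))))
    where
    h : ℕ
    h = up v (Y ∸ v)
    R : ℚ
    R = ι U ⊗ (8ℚ ⊗ (sq v ⊗ (ι h ⊗ iv U ⊖ (Hm Y ⊖ Hm v))))
    eq₁ : ι ((10 * (v * v) + 4 * (K * v) + 11 * v) * U) ≡ ((8ℚ ⊕ 2ℚ) ⊗ (ι v ⊗ ι v) ⊕ 4ℚ ⊗ (ι K ⊗ ι v) ⊕ (8ℚ ⊕ 3ℚ) ⊗ ι v) ⊗ ι U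
    eq₁ = trans (ι-* (10 * (v * v) + 4 * (K * v) + 11 * v) U) (cong (_⊗ ι U) (trans (ι-+ (10 * (v * v) + 4 * (K * v)) (11 * v)) (cong₂ _⊕_ (trans (ι-+ (10 * (v * v)) (4 * (K * v)))
       (cong₂ _⊕_ (trans (ι-* 10 (v * v)) (cong₂ _⊗_ (trans (ι-+ 8 2) (cong₂ _⊕_ ι8 ι2)) (ι-* v v))) (trans (ι-* 4 (K * v)) (cong₂ _⊗_ ι4 (ι-* K v))))) (trans (ι-* 11 v) (cong (_⊗ ι v) (trans (ι-+ 8 3) (cong₂ _⊕_ ι8 ι3)))))))
    eq₂ : ι (3 * U + 8 * (v * v) * h) ≡ 3ℚ ⊗ ι U ⊕ 8ℚ ⊗ (ι v ⊗ ι v) ⊗ ι h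
    eq₂ = trans (ι-+ (3 * U) (8 * (v * v) * h)) (cong₂ _⊕_ (trans (ι-* 3 U) (cong (_⊗ ι U) ι3)) (trans (ι-* (8 * (v * v)) h) (cong (_⊗ ι h) (trans (ι-* 8 (v * v)) (cong₂ _⊗_ ι8 (ι-* v v))))))
    lem : ∀ u v k h i L → ((8ℚ ⊕ 2ℚ) ⊗ (v ⊗ v) ⊕ 4ℚ ⊗ (k ⊗ v) ⊕ (8ℚ ⊕ 3ℚ) ⊗ v) ⊗ u ⊖ (3ℚ ⊗ u ⊕ 8ℚ ⊗ (v ⊗ v) ⊗ h) ⊕ u ⊗ (8ℚ ⊗ (v ⊗ v ⊗ (h ⊗ i ⊖ L)))
       ≡ u ⊗ ((8ℚ ⊕ 2ℚ) ⊗ (v ⊗ v) ⊕ 4ℚ ⊗ (k ⊗ v) ⊕ (8ℚ ⊕ 3ℚ) ⊗ v ⊖ 3ℚ ⊖ 8ℚ ⊗ (v ⊗ v ⊗ L)) ⊕ 8ℚ ⊗ (v ⊗ v ⊗ h) ⊗ (u ⊗ i ⊖ 1ℚ)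
    lem = solve-∀ ℚring
    z : ∀ x y → x ⊕ y ⊗ (1ℚ ⊖ 1ℚ) ≡ x
    z = solve-∀ ℚring

  E-nonneg : ∀ Y K v → v ≤ Y → 3 * U + 8 * (v * v) * up v (Y ∸ v) ≤ (10 * (v * v) + 4 * (K * v) + 11 * v) * U → 0ℚ ≤ℚ E Y K v
  E-nonneg Y K v le h = ⊗-cancel-≤ (ι U) (0<ι U) (ℚP.≤-trans (ℚP.≤-reflexive (ℚP.*-zeroʳ (ι U))) (ℚP.≤-trans (0≤⊖ (ι-mono-≤ h)) (E-lower Y K v le)))

-- Applied with M = 8^Y; squaring avoids the square root of 8^Y.
large-n : ∀ c L e n M → 1 ≤ c * e → (L + c * e) * (L + c * e) ≤ c * e * (c * e) * M → M < suc n * suc n → L < c * n * e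
large-n c L e n M 1≤ce h lt = ℕP.≰⇒> (λ le → ℕP.<-irrefl refl (ℕP.<-≤-trans lt (ℕP.*-cancelˡ-≤ (c * e * (c * e)) {{nz}} (ℕP.≤-trans (ℕP.≤-trans (ℕP.≤-reflexive (l₁ (c * e) (suc n)))
    (ℕP.*-mono-≤ (x≤ le) (x≤ le))) h))))
  where
  nz : NonZero (c * e * (c * e))
  nz = ℕP.m*n≢0 (c * e) (c * e) {{ℕ.>-nonZero 1≤ce}} {{ℕ.>-nonZero 1≤ce}}
  l₁ : ∀ a m → a * a * (m * m) ≡ a * m * (a * m)
  l₁ = ℕRing.solve-∀
  l₂ : ∀ c e n → c * e * suc n ≡ c * n * e + c * e
  l₂ = ℕRing.solve-∀
  x≤ : c * n * e ≤ L → c * e * suc n ≤ L + c * e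
  x≤ le = ℕP.≤-trans (ℕP.≤-reflexive (l₂ c e n)) (ℕP.+-monoˡ-≤ (c * e) le)

if-T : ∀ {b c} → T (if b then c else false) → T b × T c
if-T {true} t = _ , t

module Certificate (U : ℕ) .{{_ : NonZero U}} where
  open Decimal U

  pointwise? : ℕ → ℕ → ℕ → Bool
  pointwise? Y K v = 3 * U + 8 * (v * v) * up v (Y ∸ v) ≤ᵇ (10 * (v * v) + 4 * (K * v) + 11 * v) * U

  all-pointwise? : ℕ → ℕ → ℕ → Bool
  all-pointwise? Y K zero    = true
  all-pointwise? Y K (suc v) = if pointwise? Y K (suc v) then all-pointwise? Y K v else false

  Kof : ℕ → ℕ
  Kof zero    = 2
  Kof (suc g) = 4 + 2 * g

  νof : ℕ → ℕ
  νof zero    = 160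
  νof (suc g) = 2 ^ (4 + 2 * g) * (9 * ((3 + 2 * g) * (2 + 2 * g)))

  -- The subtraction is truncated; `check` asks for a value of at least 1, which shows that nothing
  -- was cut off.
  e : ℕ → ℕ → ℕ
  e Y K = (10 * (K * K) + 4 * (K * K) + 11 * K) * U ∸ (3 * U + 8 * (K * K) * up K (Y ∸ K))

  final? : ℕ → ℕ → ℕ → ℕ → Bool
  final? c L e M = (L + c * e) * (L + c * e) ≤ᵇ c * e * (c * e) * M

  check : ℕ → ℕ → ℕ → Bool
  check Y K ν = if K ≤ᵇ Y then (if all-pointwise? Y K K then (if 1 ≤ᵇ e Y K then final? 160 (21 * ((1 + total Y) * (ν * ν)) * U) (e Y K) (8 ^ Y) else false) else false) else false

  cert : ℕ → ℕ → Bool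
  cert Y g = check Y (Kof g) (νof g)

  private
    all-sound : ∀ Y K k → T (all-pointwise? Y K k) → ∀ v → 1 ≤ v → v ≤ k → T (pointwise? Y K v)
    all-sound Y K zero    t v 1≤v v≤ = ⊥-elim (ℕP.<-irrefl refl (ℕP.≤-trans 1≤v v≤))
    all-sound Y K (suc k) t v 1≤v v≤ with v ℕP.≟ suc k | if-T {pointwise? Y K (suc k)} t
    ... | yes refl | t₁ , _ = t₁
    ... | no ne    | _ , t₂ = all-sound Y K k t₂ v 1≤v (ℕP.≤-pred (ℕP.≤∧≢⇒< v≤ ne))

    νof-sound : ∀ Y g → Kof g ≤ Y → ι 80 ⊗ nu (es Y) (Kof g) ≤ℚ ι (νof g)
    νof-sound Y zero    le = nu-bound₂ Y (ℕP.≤-trans (s≤s z≤n) le)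
    νof-sound Y (suc g) le = nu-bound Y (2 * g) (ℕP.≤-trans (ℕP.n≤1+n (3 + 2 * g)) le)

    finish : ∀ n Y K ν e → K ≤ Y → 1 ≤ e → ι e ≤ℚ ι U ⊗ E Y K K → 21 * ((1 + total Y) * (ν * ν)) * U < 160 * n * e →
      ι (21 * ((1 + total Y) * (ν * ν))) <ℚ ι (160 * n) ⊗ E Y K K
    finish n Y K ν e K≤Y 1≤e le lt = ⊗-cancel-< (ι U) (0<ι U) (ℚP.<-≤-trans
        (subst₂ _<ℚ_ (trans (ι-* (21 * ((1 + total Y) * (ν * ν))) U) (ℚP.*-comm (ι (21 * ((1 + total Y) * (ν * ν)))) (ι U))) (ι-* (160 * n) e) (ι-mono-< lt))
        (ℚP.≤-trans (⊗-monoʳ (0≤ι (160 * n)) le) (ℚP.≤-reflexive (lem (ι (160 * n)) (ι U) (E Y K K)))))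
      where
      lem : ∀ a b c → a ⊗ (b ⊗ c) ≡ b ⊗ (a ⊗ c)
      lem = solve-∀ ℚring

    final-sound : ∀ c → .{{_ : NonZero c}} → ∀ L e n M → 1 ≤ e → T (final? c L e M) → M < suc n * suc n → L < c * n * e
    final-sound c L e n M 1≤e t lt = large-n c L e n M (ℕP.≤-trans 1≤e (ℕP.m≤n*m e c)) (ℕP.≤ᵇ⇒≤ ((L + c * e) * (L + c * e)) (c * e * (c * e) * M) t) lt

  check-sound : ∀ n Y k ν → T (check Y (suc k) ν) → (suc k ≤ Y → ι 80 ⊗ nu (es Y) (suc k) ≤ℚ ι ν) →
    8 ^ Y < suc n * suc n → suc n * suc n ≤ (2 ^ suc Y) ^ 3 → AlmostPrimeAbove n
  check-sound n Y k ν t νs lo hi = core n Y k ν K≤Y hi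
        (λ v 1≤v v≤K → E-nonneg Y K v (ℕP.≤-trans v≤K K≤Y) (ℕP.≤ᵇ⇒≤ (3 * U + 8 * (v * v) * up v (Y ∸ v)) ((10 * (v * v) + 4 * (K * v) + 11 * v) * U) (all-sound Y K K (proj₁ t₂) v 1≤v v≤K)))
        (νs K≤Y)
        (finish n Y K ν (e Y K) K≤Y 1≤e e≤ (final-sound 160 (21 * ((1 + total Y) * (ν * ν)) * U) (e Y K) n (8 ^ Y) 1≤e (proj₂ t₃) lo))
    where
    K : ℕ
    K = suc k
    t₁ : T (K ≤ᵇ Y) × _
    t₁ = if-T {K ≤ᵇ Y} t
    K≤Y : K ≤ Y
    K≤Y = ℕP.≤ᵇ⇒≤ K Y (proj₁ t₁)
    t₂ : T (all-pointwise? Y K K) × _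
    t₂ = if-T {all-pointwise? Y K K} (proj₂ t₁)
    t₃ : T (1 ≤ᵇ e Y K) × _
    t₃ = if-T {1 ≤ᵇ e Y K} (proj₂ t₂)
    1≤e : 1 ≤ e Y K
    1≤e = ℕP.≤ᵇ⇒≤ 1 (e Y K) (proj₁ t₃)
    e≤ : ι (e Y K) ≤ℚ ι U ⊗ E Y K K
    e≤ = ℚP.≤-trans (ℚP.≤-reflexive (ι-∸ {(10 * (K * K) + 4 * (K * K) + 11 * K) * U} {3 * U + 8 * (K * K) * up K (Y ∸ K)}
        (ℕP.<⇒≤ (ℕP.m∸n≢0⇒n<m (λ z → ℕP.<-irrefl (sym z) 1≤e))))) (E-lower Y K K K≤Y)

  cert-sound : ∀ n Y g → cert Y g ≡ true → 8 ^ Y < suc n * suc n → suc n * suc n ≤ (2 ^ suc Y) ^ 3 → AlmostPrimeAbove n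
  cert-sound n Y zero    t = check-sound n Y 1 (νof zero) (subst T (sym t) tt) (νof-sound Y zero)
  cert-sound n Y (suc g) t = check-sound n Y (3 + 2 * g) (νof (suc g)) (subst T (sym t) tt) (νof-sound Y (suc g))

-- It yields K = 2 for Y ≤ 22 and K = 2⌊(Y-5)/9⌋ from 23 on, the same K as for large n.
gOf : ℕ → ℕ
gOf Y = if Y ≤ᵇ 13 then 0 else (Y ∸ 5) / 9 ∸ 1

all-from : (ℕ → Bool) → ℕ → ℕ → Bool
all-from P zero    m = true
all-from P (suc k) m = if P m then all-from P k (suc m) else false

if-true : ∀ {b c} → (if b then c else false) ≡ true → b ≡ true × c ≡ true
if-true {true} e = refl , e

all-from-sound : ∀ P k m → all-from P k m ≡ true → ∀ i → m ≤ i → i < k + m → P i ≡ true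
all-from-sound P zero    m t i lo hi = ⊥-elim (ℕP.<-irrefl refl (ℕP.<-≤-trans hi lo))
all-from-sound P (suc k) m t i lo hi with m ℕP.≟ i
... | yes refl = proj₁ (if-true {P m} t)
... | no ne    = all-from-sound P k (suc m) (proj₂ (if-true {P m} t)) i (ℕP.≤∧≢⇒< lo ne) (subst (i <_) (sym (ℕP.+-suc k m)) hi)

open Certificate 1000000 using (cert; cert-sound)

certificates : all-from (λ Y → cert Y (gOf Y)) 227 12 ≡ true
certificates = refl

medium : ∀ n Y → 12 ≤ Y → Y < 239 → 8 ^ Y < suc n * suc n → suc n * suc n ≤ (2 ^ suc Y) ^ 3 → AlmostPrimeAbove n
medium n Y lo hi = cert-sound n Y (gOf Y) (all-from-sound (λ Y → cert Y (gOf Y)) 227 12 certificates Y lo hi)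

-- Large n

9/4 7/12 : ℚ
9/4  = ι 9 ⊗ iv 4
7/12 = ι 7 ⊗ iv 12

Hm-mono : ∀ {m n} → m ≤ n → Hm m ≤ℚ Hm n
Hm-mono {m} le = subst (λ t → Hm m ≤ℚ Hm t) (ℕP.m+[n∸m]≡n le) (Sum-grow m _ 0≤iv)

H-ratio-base : Hm 247 ⊖ Hm 26 ≤ℚ 9/4
H-ratio-base = ℚP.≤-trans (Decimal.Hm-up 1000000 26 247 (ℕP.≤ᵇ⇒≤ 26 247 tt))
    (ℚP.≤-trans (⊗-monoˡ (0≤iv 1000000) (ι-mono-≤ (ℕP.≤ᵇ⇒≤ (Decimal.up 1000000 26 221) (9 * 250000) tt)))
      (below-⊗ 1000000 9 {m = 250000} (iv-lower 1000000 4 250000 ℕP.≤-refl)))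

ι⊗iv-* : ∀ a g → .{{_ : NonZero a}} → .{{_ : NonZero g}} → ι a ⊗ iv (a * g) ≡ iv g
ι⊗iv-* a g = trans (cong (ι a ⊗_) (iv-* a g)) (trans (sym (ℚP.*-assoc (ι a) (iv a) (iv g))) (trans (cong (_⊗ iv g) (ι⊗iv a)) (ℚP.*-identityˡ (iv g))))

-- H(9g+13) - H(g) decreases in g, since the nine new terms are each at most 1/(9(g+1)).
H-ratio : ∀ i → Hm (i * 9 + 247) ⊖ Hm (i + 26) ≤ℚ 9/4
H-ratio zero    = H-ratio-base
H-ratio (suc i) = ℚP.≤-trans (≤-by (iv (suc c₀) ⊖ Sum (1 + m) 9 iv) (0≤⊖ incr) eq) (H-ratio i)
  where
  c₀ m : ℕ
  c₀ = i + 26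
  m = i * 9 + 247
  m9 : 9 + m ≡ m + 9
  m9 = ℕP.+-comm 9 m
  9g : ∀ i → 9 * suc (i + 26) + 4 ≡ i * 9 + 247
  9g = ℕRing.solve-∀
  incr : Sum (1 + m) 9 iv ≤ℚ iv (suc c₀)
  incr = ℚP.≤-trans (Sum-≤-const (1 + m) 9 (iv (9 * suc c₀)) (λ a lo _ → iv-antimono (ℕP.≤-trans (ℕP.≤-trans (ℕP.m≤m+n (9 * suc c₀) 4) (ℕP.≤-reflexive (9g i))) (ℕP.≤-trans (ℕP.n≤1+n m) lo))))
     (ℚP.≤-reflexive (ι⊗iv-* 9 (suc c₀)))
  lem : ∀ a b c d → a ⊕ d ⊖ (b ⊕ c) ⊕ (c ⊖ d) ≡ a ⊖ b
  lem = solve-∀ ℚring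
  eq : Hm (9 + m) ⊖ Hm (suc c₀) ⊕ (iv (suc c₀) ⊖ Sum (1 + m) 9 iv) ≡ Hm m ⊖ Hm c₀
  eq = trans (cong (λ t → t ⊖ Hm (suc c₀) ⊕ (iv (suc c₀) ⊖ Sum (1 + m) 9 iv)) (trans (cong Hm m9) (Sum-++ 1 m 9 iv))) (lem (Hm m) (Hm c₀) (iv (suc c₀)) (Sum (1 + m) 9 iv))

-- H(2m) - H(m) increases with m, because 1/(2m+1) + 1/(2m+2) ≥ 1/(m+1); at m = 2 it is 1/3 + 1/4.
H-double : ∀ i → 7/12 ≤ℚ Hm (2 * (2 + i)) ⊖ Hm (2 + i)
H-double zero = ℚP.≤-trans (below-⊕ 12 {m = 4} {n = 3} (iv-lower 12 3 4 ℕP.≤-refl) (iv-lower 12 4 3 ℕP.≤-refl)) (ℚP.≤-reflexive (lem (iv 1) (iv 2) (iv 3) (iv 4)))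
  where
  lem : ∀ a b c d → c ⊕ d ≡ 0ℚ ⊕ a ⊕ b ⊕ c ⊕ d ⊖ (0ℚ ⊕ a ⊕ b)
  lem = solve-∀ ℚring
H-double (suc i) = ℚP.≤-trans (H-double i) (≤-by ((iv (suc (2 * c₀)) ⊖ iv (2 * suc c₀)) ⊕ (iv (suc (suc (2 * c₀))) ⊖ iv (2 * suc c₀))) (0≤⊕ (0≤⊖ (iv-antimono (ℕP.≤-trans (ℕP.n≤1+n _) (ℕP.≤-reflexive (sym 2g))))) (0≤⊖ (ℚP.≤-reflexive (cong iv 2g)))) eq)
  where
  c₀ : ℕ
  c₀ = 2 + i
  2g : 2 * suc c₀ ≡ suc (suc (2 * c₀))
  2g = ℕP.*-suc 2 c₀
  halves : iv (suc c₀) ≡ iv (2 * suc c₀) ⊕ iv (2 * suc c₀)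
  halves = trans (sym (ι⊗iv-* 2 (suc c₀))) (trans (cong (_⊗ iv (2 * suc c₀)) ι2) (two (iv (2 * suc c₀))))
    where
    two : ∀ x → 2ℚ ⊗ x ≡ x ⊕ x
    two = solve-∀ ℚring
  lem : ∀ a b c d h → a ⊖ b ⊕ ((c ⊖ h) ⊕ (d ⊖ h)) ≡ a ⊕ c ⊕ d ⊖ (b ⊕ (h ⊕ h))
  lem = solve-∀ ℚring
  eq : Hm (2 * c₀) ⊖ Hm c₀ ⊕ ((iv (suc (2 * c₀)) ⊖ iv (2 * suc c₀)) ⊕ (iv (suc (suc (2 * c₀))) ⊖ iv (2 * suc c₀))) ≡ Hm (2 * suc c₀) ⊖ Hm (suc c₀)
  eq = trans (lem (Hm (2 * c₀)) (Hm c₀) (iv (suc (2 * c₀))) (iv (suc (suc (2 * c₀)))) (iv (2 * suc c₀))) (cong₂ (λ x y → x ⊖ (Hm c₀ ⊕ y)) (cong Hm (sym 2g)) (sym halves))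

-- The discrete form of log(g/v) ≤ g/v - 1, valid on both sides of v = g.
H-tangent : ∀ g v → 1 ≤ v → ι v ⊗ (Hm g ⊖ Hm v) ≤ℚ ι g ⊖ ι v
H-tangent g v 1≤v with ℕP.≤-total v g
... | inj₁ v≤g = subst (λ t → ι v ⊗ (Hm t ⊖ Hm v) ≤ℚ ι t ⊖ ι v) (ℕP.m+[n∸m]≡n v≤g) (ℚP.≤-trans
      (⊗-monoʳ (0≤ι v) (ℚP.≤-trans (ℚP.≤-reflexive (Hm-+ v k)) (Sum-≤-const (1 + v) k (iv v) (λ a lo _ → iv-antimono {{ℕ.>-nonZero 1≤v}} (ℕP.≤-trans (ℕP.n≤1+n v) lo)))))
      (ℚP.≤-reflexive (trans (l₁ (ι v) (ι k) (iv v)) (trans (cong (ι k ⊗_) (ι⊗iv v {{ℕ.>-nonZero 1≤v}})) (trans (l₂ (ι k) (ι v)) (cong (_⊖ ι v) (sym (ι-+ v k))))))))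
  where
  k : ℕ
  k = g ∸ v
  l₁ : ∀ a b c → a ⊗ (b ⊗ c) ≡ b ⊗ (a ⊗ c)
  l₁ = solve-∀ ℚring
  l₂ : ∀ k v → k ⊗ 1ℚ ≡ v ⊕ k ⊖ v
  l₂ = solve-∀ ℚring
... | inj₂ g≤v = subst (λ t → ι t ⊗ (Hm g ⊖ Hm t) ≤ℚ ι g ⊖ ι t) (ℕP.m+[n∸m]≡n g≤v) (≤-by (ι u ⊗ (Sum (1 + g) k iv ⊖ ι k ⊗ iv u)) (0≤⊗ (0≤ι u) (0≤⊖ low))
      (trans (cong (λ t → ι u ⊗ (Hm g ⊖ t) ⊕ ι u ⊗ (Sum (1 + g) k iv ⊖ ι k ⊗ iv u)) (Sum-++ 1 g k iv)) (trans (l₁ (ι u) (Hm g) (Sum (1 + g) k iv) (ι k) (iv u)) (trans (cong (λ t → ⊝ (ι k ⊗ t)) (ι⊗iv u {{nz}}))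
         (trans (l₂ (ι k) (ι g)) (cong (λ t → ι g ⊖ t) (sym (ι-+ g k))))))))
  where
  k u : ℕ
  k = v ∸ g
  u = g + k
  nz : NonZero u
  nz = ℕ.>-nonZero (subst (1 ≤_) (sym (ℕP.m+[n∸m]≡n g≤v)) 1≤v)
  l₁ : ∀ u a s k i → u ⊗ (a ⊖ (a ⊕ s)) ⊕ u ⊗ (s ⊖ k ⊗ i) ≡ ⊝ (k ⊗ (u ⊗ i))
  l₁ = solve-∀ ℚring
  l₂ : ∀ k g → ⊝ (k ⊗ 1ℚ) ≡ g ⊖ (g ⊕ k)
  l₂ = solve-∀ ℚring
  below : ∀ N → g + N ≤ u → ι N ⊗ iv u ≤ℚ Sum (1 + g) N iv
  below zero    h = ℚP.≤-reflexive (trans (cong (_⊗ iv u) ι0) (ℚP.*-zeroˡ (iv u)))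
  below (suc N) h = ℚP.≤-trans (ℚP.≤-reflexive (trans (cong (_⊗ iv u) (ι-suc N)) (l₃ (ι N) (iv u))))
      (ℚP.+-mono-≤ (below N (ℕP.≤-trans (ℕP.+-monoʳ-≤ g (ℕP.n≤1+n N)) h)) (iv-antimono (subst (_≤ u) (ℕP.+-suc g N) h)))
    where
    l₃ : ∀ n i → (1ℚ ⊕ n) ⊗ i ≡ n ⊗ i ⊕ i
    l₃ = solve-∀ ℚring
  low : ι k ⊗ iv u ≤ℚ Sum (1 + g) k iv
  low = below k ℕP.≤-refl

module Large (Y h : ℕ) (ratio : Hm Y ⊖ Hm h ≤ℚ 9/4) where
  private
    K : ℕ
    K = 2 * h

    ιK : ι K ≡ ι h ⊕ ι h
    ιK = trans (ι-* 2 h) (trans (cong (_⊗ ι h) ι2) (lem (ι h)))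
      where
      lem : ∀ x → 2ℚ ⊗ x ≡ x ⊕ x
      lem = solve-∀ ℚring


    4t : 4ℚ ⊗ 9/4 ≡ 8ℚ ⊕ 1ℚ
    4t = trans (cong (_⊗ 9/4) (sym ι4)) (trans (lem (ι 4) (ι 9) (iv 4)) (trans (cong (ι 9 ⊗_) (ι⊗iv 4)) (trans (ℚP.*-identityʳ (ι 9)) (trans (ι-+ 8 1) (cong₂ _⊕_ ι8 ι1)))))
      where
      lem : ∀ a b c → a ⊗ (b ⊗ c) ≡ b ⊗ (a ⊗ c)
      lem = solve-∀ ℚring

  -- Splitting H(Y) - H(v) at h and using the tangent there bounds 8v² (H(Y) - H(v)) by 18v² + 8v(h
  -- - v). For K = 2h this is exactly 10v² + 4Kv, so 9/4 uses up the quadratic terms.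
  E-nonneg′ : ∀ v → 1 ≤ v → 0ℚ ≤ℚ E Y K v
  E-nonneg′ v 1≤v = subst (0ℚ ≤ℚ_) eq (0≤⊕ (0≤⊗ (ℚP.nonNegative⁻¹ 8ℚ) (0≤⊗ (0≤⊗ (0≤ι v) (0≤ι v)) (0≤⊖ ratio)))
      (0≤⊕ (0≤⊗ (ℚP.nonNegative⁻¹ 8ℚ) (0≤⊗ (0≤ι v) (0≤⊖ (H-tangent h v 1≤v))))
           (0≤⊕ (0≤⊗ 0≤3ℚ (0≤⊖ (subst (_≤ℚ ι v) ι1 (ι-mono-≤ 1≤v)))) (0≤⊗ (ℚP.nonNegative⁻¹ 8ℚ) (0≤ι v)))))
    where
    lem : ∀ t v g Y G V → 8ℚ ⊗ (v ⊗ v ⊗ (t ⊖ (Y ⊖ G))) ⊕ (8ℚ ⊗ (v ⊗ (g ⊖ v ⊖ v ⊗ (G ⊖ V))) ⊕ (3ℚ ⊗ (v ⊖ 1ℚ) ⊕ 8ℚ ⊗ v))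
      ≡ 2ℚ ⊗ (4ℚ ⊗ t) ⊗ (v ⊗ v) ⊖ 8ℚ ⊗ (v ⊗ v) ⊕ 8ℚ ⊗ (v ⊗ g) ⊕ (8ℚ ⊕ 3ℚ) ⊗ v ⊖ 3ℚ ⊖ 8ℚ ⊗ (v ⊗ v ⊗ (Y ⊖ V))
    lem = solve-∀ ℚring
    lem₂ : ∀ v g L → 2ℚ ⊗ (8ℚ ⊕ 1ℚ) ⊗ (v ⊗ v) ⊖ 8ℚ ⊗ (v ⊗ v) ⊕ 8ℚ ⊗ (v ⊗ g) ⊕ (8ℚ ⊕ 3ℚ) ⊗ v ⊖ 3ℚ ⊖ 8ℚ ⊗ (v ⊗ v ⊗ L)
      ≡ (8ℚ ⊕ 2ℚ) ⊗ (v ⊗ v) ⊕ 4ℚ ⊗ ((g ⊕ g) ⊗ v) ⊕ (8ℚ ⊕ 3ℚ) ⊗ v ⊖ 3ℚ ⊖ 8ℚ ⊗ (v ⊗ v ⊗ L)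
    lem₂ = solve-∀ ℚring
    eq : 8ℚ ⊗ (ι v ⊗ ι v ⊗ (9/4 ⊖ (Hm Y ⊖ Hm h))) ⊕ (8ℚ ⊗ (ι v ⊗ (ι h ⊖ ι v ⊖ ι v ⊗ (Hm h ⊖ Hm v))) ⊕ (3ℚ ⊗ (ι v ⊖ 1ℚ) ⊕ 8ℚ ⊗ ι v)) ≡ E Y K v
    eq = trans (lem 9/4 (ι v) (ι h) (Hm Y) (Hm h) (Hm v)) (trans (cong (λ t → 2ℚ ⊗ t ⊗ (ι v ⊗ ι v) ⊖ 8ℚ ⊗ (ι v ⊗ ι v) ⊕ 8ℚ ⊗ (ι v ⊗ ι h) ⊕ (8ℚ ⊕ 3ℚ) ⊗ ι v ⊖ 3ℚ ⊖ 8ℚ ⊗ (ι v ⊗ ι v ⊗ (Hm Y ⊖ Hm v))) 4t)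
       (trans (lem₂ (ι v) (ι h) (Hm Y ⊖ Hm v)) (cong (λ t → (8ℚ ⊕ 2ℚ) ⊗ sq v ⊕ 4ℚ ⊗ (t ⊗ ι v) ⊕ (8ℚ ⊕ 3ℚ) ⊗ ι v ⊖ 3ℚ ⊖ 8ℚ ⊗ (sq v ⊗ (Hm Y ⊖ Hm v))) (sym ιK))))

  -- H(Y) - H(K) is at most 9/4 - 7/12 = 5/3, and 14 - 8 · 5/3 = 2/3.
  E-large : 1 ≤ K → 7/12 ≤ℚ Hm K ⊖ Hm h → 2ℚ ⊗ sq K ≤ℚ 3ℚ ⊗ E Y K K
  E-large 1≤K dbl = ≤-by (8ℚ ⊗ 3ℚ ⊗ (sq K ⊗ ((9/4 ⊖ (Hm Y ⊖ Hm h)) ⊕ (Hm K ⊖ Hm h ⊖ 7/12))) ⊕ (3ℚ ⊗ 3ℚ ⊗ (ι K ⊖ 1ℚ) ⊕ 8ℚ ⊗ 3ℚ ⊗ ι K))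
      (0≤⊕ (0≤⊗ (ℚP.nonNegative⁻¹ (8ℚ ⊗ 3ℚ)) (0≤⊗ (0≤⊗ (0≤ι K) (0≤ι K)) (0≤⊕ (0≤⊖ ratio) (0≤⊖ dbl))))
           (0≤⊕ (0≤⊗ (ℚP.nonNegative⁻¹ (3ℚ ⊗ 3ℚ)) (0≤⊖ (subst (_≤ℚ ι K) ι1 (ι-mono-≤ 1≤K)))) (0≤⊗ (ℚP.nonNegative⁻¹ (8ℚ ⊗ 3ℚ)) (0≤ι K))))
      (trans (lem 9/4 7/12 (ι K) (Hm Y) (Hm h) (Hm K)) (trans (cong₂ (λ s t → 2ℚ ⊗ (ι K ⊗ ι K) ⊕ (2ℚ ⊗ 3ℚ ⊗ s ⊖ 2ℚ ⊗ t) ⊗ (ι K ⊗ ι K) ⊕ (8ℚ ⊗ 4ℚ ⊕ 1ℚ) ⊗ ι K ⊖ 3ℚ ⊗ 3ℚ ⊖ 8ℚ ⊗ 3ℚ ⊗ (ι K ⊗ ι K ⊗ (Hm Y ⊖ Hm K))) 4t 12s)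
        (lem₂ (ι K) (Hm Y ⊖ Hm K))))
    where
    12s : 3ℚ ⊗ 4ℚ ⊗ 7/12 ≡ 3ℚ ⊕ 4ℚ
    12s = trans (cong (_⊗ 7/12) (trans (cong₂ _⊗_ (sym ι3) (sym ι4)) (sym (ι-* 3 4)))) (trans (l (ι 12) (ι 7) (iv 12)) (trans (cong (ι 7 ⊗_) (ι⊗iv 12)) (trans (ℚP.*-identityʳ (ι 7)) (trans (ι-+ 3 4) (cong₂ _⊕_ ι3 ι4)))))
      where
      l : ∀ a b c → a ⊗ (b ⊗ c) ≡ b ⊗ (a ⊗ c)
      l = solve-∀ ℚring
    lem : ∀ t s k Y G V → 2ℚ ⊗ (k ⊗ k) ⊕ (8ℚ ⊗ 3ℚ ⊗ (k ⊗ k ⊗ ((t ⊖ (Y ⊖ G)) ⊕ (V ⊖ G ⊖ s))) ⊕ (3ℚ ⊗ 3ℚ ⊗ (k ⊖ 1ℚ) ⊕ 8ℚ ⊗ 3ℚ ⊗ k))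
      ≡ 2ℚ ⊗ (k ⊗ k) ⊕ (2ℚ ⊗ 3ℚ ⊗ (4ℚ ⊗ t) ⊖ 2ℚ ⊗ (3ℚ ⊗ 4ℚ ⊗ s)) ⊗ (k ⊗ k) ⊕ (8ℚ ⊗ 4ℚ ⊕ 1ℚ) ⊗ k ⊖ 3ℚ ⊗ 3ℚ ⊖ 8ℚ ⊗ 3ℚ ⊗ (k ⊗ k ⊗ (Y ⊖ V))
    lem = solve-∀ ℚring
    lem₂ : ∀ k L → 2ℚ ⊗ (k ⊗ k) ⊕ (2ℚ ⊗ 3ℚ ⊗ (8ℚ ⊕ 1ℚ) ⊖ 2ℚ ⊗ (3ℚ ⊕ 4ℚ)) ⊗ (k ⊗ k) ⊕ (8ℚ ⊗ 4ℚ ⊕ 1ℚ) ⊗ k ⊖ 3ℚ ⊗ 3ℚ ⊖ 8ℚ ⊗ 3ℚ ⊗ (k ⊗ k ⊗ L)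
      ≡ 3ℚ ⊗ ((8ℚ ⊕ 2ℚ) ⊗ (k ⊗ k) ⊕ 4ℚ ⊗ (k ⊗ k) ⊕ (8ℚ ⊕ 3ℚ) ⊗ k ⊖ 3ℚ ⊖ 8ℚ ⊗ (k ⊗ k ⊗ L))
    lem₂ = solve-∀ ℚring

count-bound≤ : ∀ y → 6 ≤ y → count-bound (2 + y) ≤ 2 ^ y
count-bound≤ (suc y) h = ℕP.≤-trans (DM./-monoʳ-≤ (2 ^ (4 + y)) {3 + y} {8} (ℕP.+-monoʳ-≤ 3 (ℕP.≤-pred h)))
    (ℕP.≤-reflexive (trans (cong (_/ 8) (trans (cong (2 ^_) (ℕP.+-comm 3 (suc y))) (ℕP.^-distribˡ-+-* 2 (suc y) 3))) (DM.m*n/n≡m (2 ^ suc y) 8)))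

total≤ : ∀ i → 1 + total (suc (i + 11)) ≤ 2 ^ (i + 11)
total≤ zero    = ℕP.≤ᵇ⇒≤ (1 + total 12) (2 ^ 11) tt
total≤ (suc i) = ℕP.≤-trans (ℕP.≤-reflexive (lem (count-bound (2 + (i + 11))) (total (suc (i + 11)))))
    (ℕP.≤-trans (ℕP.+-mono-≤ (count-bound≤ (i + 11) (ℕP.≤-trans (ℕP.≤ᵇ⇒≤ 6 11 tt) (ℕP.m≤n+m 11 i))) (total≤ i)) (ℕP.≤-reflexive (cong (2 ^ (i + 11) +_) (sym (ℕP.+-identityʳ (2 ^ (i + 11)))))))
  where
  lem : ∀ a b → 1 + (a + b) ≡ a + (1 + b)
  lem = ℕRing.solve-∀

-- by (1 + 1/G)⁴ ≤ (7/5)² ≤ 2 for G ≥ 6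
64G⁴≤2^G : ∀ k → 64 * ((k + 25) * (k + 25) * ((k + 25) * (k + 25))) ≤ 2 ^ (k + 25)
64G⁴≤2^G zero    = ℕP.≤ᵇ⇒≤ (64 * (25 * 25 * (25 * 25))) (2 ^ 25) tt
64G⁴≤2^G (suc k) = ℕP.≤-trans (ℕP.*-monoʳ-≤ 64 (step (k + 25) (ℕP.≤-trans (ℕP.≤ᵇ⇒≤ 6 25 tt) (ℕP.m≤n+m 25 k)))) (ℕP.≤-trans (ℕP.≤-reflexive (comm 64 2 ((k + 25) * (k + 25) * ((k + 25) * (k + 25))))) (ℕP.*-monoʳ-≤ 2 (64G⁴≤2^G k)))
  where
  comm : ∀ a b c → a * (b * c) ≡ b * (a * c)
  comm = ℕRing.solve-∀
  sq-step : ∀ j → 5 * ((7 + j) * (7 + j)) ≤ 7 * ((6 + j) * (6 + j))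
  sq-step j = ℕP.≤-trans (ℕP.m≤m+n (5 * ((7 + j) * (7 + j))) (7 + 14 * j + 2 * (j * j))) (ℕP.≤-reflexive (lem j))
    where
    lem : ∀ j → 5 * ((7 + j) * (7 + j)) + (7 + 14 * j + 2 * (j * j)) ≡ 7 * ((6 + j) * (6 + j))
    lem = ℕRing.solve-∀
  step : ∀ g → 6 ≤ g → suc g * suc g * (suc g * suc g) ≤ 2 * (g * g * (g * g))
  step h 6≤h = ℕP.*-cancelˡ-≤ 25 (ℕP.≤-trans (ℕP.≤-reflexive (l₁ 5 (suc h * suc h))) (ℕP.≤-trans (ℕP.*-mono-≤ s s) (ℕP.≤-trans (ℕP.≤-reflexive (sym (l₁ 7 (h * h)))) (ℕP.≤-trans (ℕP.*-monoˡ-≤ (h * h * (h * h)) (ℕP.≤ᵇ⇒≤ 49 50 tt)) (ℕP.≤-reflexive (ℕP.*-assoc 25 2 (h * h * (h * h))))))))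
    where
    l₁ : ∀ c x → c * c * (x * x) ≡ c * x * (c * x)
    l₁ = ℕRing.solve-∀
    s : 5 * (suc h * suc h) ≤ 7 * (h * h)
    s = subst (λ t → 5 * (suc t * suc t) ≤ 7 * (t * t)) (ℕP.m+[n∸m]≡n 6≤h) (sq-step (h ∸ 6))

-- 3 · 21 · 9² = 5103 is rounded up to 5120 = 640 · 8 to fit the hypothesis on n.
final-nat : ∀ T B a c d K n → 2 * (1 + T) ≤ B → c ≤ K → .{{_ : NonZero K}} → 8 * (B * (a * a * (d * d))) < n →
  3 * (21 * ((1 + T) * (a * (9 * (c * d)) * (a * (9 * (c * d)))))) < 160 * n * (2 * (K * K))
final-nat T B a c d K n hB hc hn = ℕP.*-cancelˡ-< 2 _ _ (ℕP.≤-<-trans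
    (ℕP.≤-trans (ℕP.≤-reflexive (trans (cong (2 *_) (l₁ 3 21 9 (1 + T) a c d)) (l₂ 2 5103 (1 + T) D (c * c))))
      (ℕP.≤-trans (ℕP.*-mono-≤ (ℕP.≤ᵇ⇒≤ 5103 5120 tt) (ℕP.*-mono-≤ (ℕP.*-monoˡ-≤ D hB) (ℕP.*-mono-≤ hc hc))) (ℕP.≤-reflexive (trans (ℕP.*-assoc 640 8 (B * D * (K * K))) (cong (640 *_) (sym (ℕP.*-assoc 8 (B * D) (K * K))))))))
    (ℕP.<-≤-trans (ℕP.*-monoʳ-< 640 (ℕP.*-monoˡ-< (K * K) {{ℕP.m*n≢0 K K}} hn)) (ℕP.≤-reflexive (l₃ 2 160 n (K * K)))))
  where
  D : ℕ
  D = a * a * (d * d)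
  l₁ : ∀ p q k t a c d → p * (q * (t * (a * (k * (c * d)) * (a * (k * (c * d)))))) ≡ p * q * (k * k) * (t * (a * a * (d * d)) * (c * c))
  l₁ = ℕRing.solve-∀
  l₂ : ∀ p q t D c → p * (q * (t * D * c)) ≡ q * (p * t * D * c)
  l₂ = ℕRing.solve-∀
  l₃ : ∀ p q n k → p * q * p * (n * k) ≡ p * (q * n * (p * k))
  l₃ = ℕRing.solve-∀

-- Here a = 2^K for K = 2G + 2. The powers of 2 in a⁴ have exponent 8G + 8, and 256 d⁴ = 64 · 64 G⁴
-- adds at most G + 6. With G = h - 1 the total 9G + 14 is 9h + 5, the origin of the 5 in ⌊(Y-5)/9⌋.
large-square : ∀ G Y → G + 8 * G + 14 ≤ Y → 64 * (G * G * (G * G)) ≤ 2 ^ G → ∀ a d → a ≡ 2 ^ (2 * G + 2) → d ≡ 2 * G →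
  256 * (a * a * (d * d) * (a * a * (d * d))) ≤ 2 ^ Y
large-square G Y hY hG a d refl refl = begin
    256 * (a * a * (d * d) * (a * a * (d * d)))    ≡⟨ l₁ 64 2 2 a G ⟩
    a * a * (a * a) * (64 * (64 * G⁴))             ≤⟨ ℕP.*-monoʳ-≤ (a * a * (a * a)) (ℕP.*-monoʳ-≤ 64 hG) ⟩
    a * a * (a * a) * (64 * 2 ^ G)                 ≡⟨ cong₂ _*_ (trans (cong₂ _*_ dbl dbl) (sym (ℕP.^-distribˡ-+-* 2 (x + x) (x + x)))) (sym (ℕP.^-distribˡ-+-* 2 6 G)) ⟩
    2 ^ (x + x + (x + x)) * 2 ^ (6 + G)            ≡⟨ sym (ℕP.^-distribˡ-+-* 2 (x + x + (x + x)) (6 + G)) ⟩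
    2 ^ (x + x + (x + x) + (6 + G))                ≤⟨ ℕP.^-monoʳ-≤ 2 (subst (_≤ Y) (sym (l₂ G)) hY) ⟩
    2 ^ Y                                          ∎
  where
  open ℕP.≤-Reasoning
  x G⁴ : ℕ
  x = 2 * G + 2
  G⁴ = G * G * (G * G)
  dbl : a * a ≡ 2 ^ (x + x)
  dbl = sym (ℕP.^-distribˡ-+-* 2 x x)
  l₁ : ∀ p q r a g → p * q * r * (a * a * (q * g * (r * g)) * (a * a * (q * g * (r * g)))) ≡ a * a * (a * a) * (p * (q * r * q * (q * r * r) * (g * g * (g * g))))
  l₁ = ℕRing.solve-∀
  l₂ : ∀ G → 2 * G + 2 + (2 * G + 2) + (2 * G + 2 + (2 * G + 2)) + (6 + G) ≡ G + 8 * G + 14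
  l₂ = ℕRing.solve-∀

8^≡ : ∀ Y → 8 ^ Y ≡ 2 ^ Y * (2 ^ Y * 2 ^ Y)
8^≡ Y = trans (ℕP.^-*-assoc 2 3 Y) (trans (cong (2 ^_) (lem Y)) (trans (ℕP.^-distribˡ-+-* 2 Y (Y + Y)) (cong (2 ^ Y *_) (ℕP.^-distribˡ-+-* 2 Y Y))))
  where
  lem : ∀ Y → 3 * Y ≡ Y + (Y + Y)
  lem = ℕRing.solve-∀

-- For M = 8 · 2^Y · D the hypothesis says (2M)² ≤ 8^Y, so M + 1 ≤ 2M < n + 1.
large-n′ : ∀ n Y D → .{{_ : NonZero D}} → 256 * (D * D) ≤ 2 ^ Y → 8 ^ Y < suc n * suc n → 8 * (2 ^ Y * D) < n
large-n′ n Y D h lt = ℕP.≤-pred (square-cancel-< (suc M) (suc n) (ℕP.≤-<-trans (ℕP.≤-trans (ℕP.*-mono-≤ 1+M 1+M) big) lt))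
  where
  P M : ℕ
  P = 2 ^ Y
  M = 8 * (P * D)
  instance
    nz : NonZero (P * D)
    nz = ℕP.m*n≢0 P D {{ℕP.m^n≢0 2 Y}}
  1+M : suc M ≤ M + M
  1+M = ℕP.+-monoˡ-≤ M (ℕ.>-nonZero⁻¹ M {{ℕP.m*n≢0 8 (P * D)}})
  l₁ : ∀ c B D → (c * (B * D) + c * (B * D)) * (c * (B * D) + c * (B * D)) ≡ B * B * ((c + c) * (c + c) * (D * D))
  l₁ = ℕRing.solve-∀
  big : (M + M) * (M + M) ≤ 8 ^ Y
  big = ℕP.≤-trans (ℕP.≤-reflexive (l₁ 8 P D)) (ℕP.≤-trans (ℕP.*-monoʳ-≤ (P * P) h) (ℕP.≤-reflexive (trans (ℕP.*-comm (P * P) P) (sym (8^≡ Y)))))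

large : ∀ n Y → 239 ≤ Y → 8 ^ Y < suc n * suc n → suc n * suc n ≤ (2 ^ suc Y) ^ 3 → AlmostPrimeAbove n
large n Y 239≤Y lo hi = core n Y (3 + I) ν 4+I≤Y hi
    (λ v 1≤v _ → subst (λ t → 0ℚ ≤ℚ E Y t v) (sym eK) (L.E-nonneg′ v 1≤v))
    (nu-bound Y I (ℕP.≤-trans (ℕP.n≤1+n (3 + I)) 4+I≤Y))
    hR
  where
  h i G₀ I ν : ℕ
  h = (Y ∸ 5) / 9
  -- 239 = 9 · 26 + 5, so h ≥ 26 and `G₀` = h - 1 ≥ 25; the inequality 64 G⁴ ≤ 2^G still fails at G
  -- = 24.
  i = h ∸ 26
  G₀ = i + 25
  I = 2 * (i + 24)
  ν = 2 ^ (4 + I) * (9 * ((3 + I) * (2 + I)))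
  26≤h : 26 ≤ h
  26≤h = DM./-monoˡ-≤ {234} {Y ∸ 5} 9 (ℕP.∸-monoˡ-≤ 5 239≤Y)
  hi≡ : i + 26 ≡ h
  hi≡ = ℕP.m∸n+n≡m 26≤h
  5≤Y : 5 ≤ Y
  5≤Y = ℕP.≤-trans (ℕP.≤ᵇ⇒≤ 5 239 tt) 239≤Y
  h-lower : (i + 26) * 9 + 5 ≤ Y
  h-lower = ℕP.≤-trans (ℕP.+-monoˡ-≤ 5 (subst (λ t → t * 9 ≤ Y ∸ 5) (sym hi≡) (DM.m/n*n≤m (Y ∸ 5) 9))) (ℕP.≤-reflexive (ℕP.m∸n+n≡m 5≤Y))
  h-upper : Y ≤ i * 9 + 247
  h-upper = ℕP.≤-trans (ℕP.≤-reflexive (trans (sym (ℕP.m∸n+n≡m 5≤Y)) (cong (_+ 5) (trans (DM.m≡m%n+[m/n]*n (Y ∸ 5) 9) (cong (λ t → (Y ∸ 5) % 9 + t * 9) (sym hi≡))))))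
     (ℕP.≤-trans (ℕP.+-monoˡ-≤ 5 (ℕP.+-monoˡ-≤ ((i + 26) * 9) (ℕP.≤-pred (DM.m%n<n (Y ∸ 5) 9)))) (ℕP.≤-reflexive (l i)))
    where
    l : ∀ i → 8 + (i + 26) * 9 + 5 ≡ i * 9 + 247
    l = ℕRing.solve-∀
  eK : 4 + I ≡ 2 * (i + 26)
  eK = l i
    where
    l : ∀ i → 4 + 2 * (i + 24) ≡ 2 * (i + 26)
    l = ℕRing.solve-∀
  module L = Large Y (i + 26) (ℚP.≤-trans (ℚP.+-monoˡ-≤ (⊝ Hm (i + 26)) (Hm-mono h-upper)) (H-ratio i))
  4+I≤Y : 4 + I ≤ Y
  4+I≤Y = ℕP.≤-trans (ℕP.≤-reflexive eK) (ℕP.≤-trans (ℕP.*-monoˡ-≤ (i + 26) (ℕP.≤ᵇ⇒≤ 2 9 tt)) (ℕP.≤-trans (ℕP.≤-reflexive (ℕP.*-comm 9 (i + 26))) (ℕP.≤-trans (ℕP.m≤m+n ((i + 26) * 9) 5) h-lower)))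
  E≥ : 2ℚ ⊗ sq (4 + I) ≤ℚ 3ℚ ⊗ E Y (4 + I) (4 + I)
  E≥ = subst (λ t → 2ℚ ⊗ sq t ≤ℚ 3ℚ ⊗ E Y t t) (sym eK) (L.E-large (subst (1 ≤_) eK (s≤s z≤n))
     (subst (λ t → 7/12 ≤ℚ Hm (2 * t) ⊖ Hm t) (l i) (H-double (i + 24))))
    where
    l : ∀ i → 2 + (i + 24) ≡ i + 26
    l = ℕRing.solve-∀
  total-bound : 2 * (1 + total Y) ≤ 2 ^ Y
  total-bound = subst (λ t → 2 * (1 + total t) ≤ 2 ^ t) (trans (sym (ℕP.+-suc (Y ∸ 12) 11)) (ℕP.m∸n+n≡m (ℕP.≤-trans (ℕP.≤ᵇ⇒≤ 12 239 tt) 239≤Y)))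
     (ℕP.*-monoʳ-≤ 2 (total≤ (Y ∸ 12)))
  a d : ℕ
  a = 2 ^ (4 + I)
  d = 2 + I
  small-enough : 256 * (a * a * (d * d) * (a * a * (d * d))) ≤ 2 ^ Y
  small-enough = large-square G₀ Y (ℕP.≤-trans (ℕP.≤-reflexive (l i)) h-lower) (64G⁴≤2^G i) a d (cong (2 ^_) (l₁ i)) (l₂ i)
    where
    l : ∀ i → i + 25 + 8 * (i + 25) + 14 ≡ (i + 26) * 9 + 5
    l = ℕRing.solve-∀
    l₁ : ∀ i → 4 + 2 * (i + 24) ≡ 2 * (i + 25) + 2
    l₁ = ℕRing.solve-∀
    l₂ : ∀ i → 2 + 2 * (i + 24) ≡ 2 * (i + 25)
    l₂ = ℕRing.solve-∀
  n-large : 8 * (2 ^ Y * (a * a * (d * d))) < n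
  n-large = large-n′ n Y (a * a * (d * d)) {{ℕP.m*n≢0 (a * a) (d * d) {{ℕP.m*n≢0 a a {{a≢0}} {{a≢0}}}}}} small-enough lo
    where
    a≢0 : NonZero a
    a≢0 = ℕP.m^n≢0 2 (4 + I)
  hR : ι (21 * ((1 + total Y) * (ν * ν))) <ℚ ι (160 * n) ⊗ E Y (4 + I) (4 + I)
  hR = ⊗-cancel-< (ι 3) (0<ι 3) (ℚP.<-≤-trans
      (subst₂ _<ℚ_ (ι-* 3 (21 * ((1 + total Y) * (ν * ν)))) (trans (ι-* (160 * n) (2 * ((4 + I) * (4 + I)))) (cong (ι (160 * n) ⊗_) (trans (ι-* 2 ((4 + I) * (4 + I))) (cong₂ _⊗_ ι2 (ι-* (4 + I) (4 + I))))))
        (ι-mono-< (final-nat (total Y) (2 ^ Y) a (3 + I) d (4 + I) n total-bound (ℕP.n≤1+n (3 + I)) n-large)))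
      (ℚP.≤-trans (⊗-monoʳ (0≤ι (160 * n)) E≥) (ℚP.≤-reflexive (trans (cong (λ t → ι (160 * n) ⊗ (t ⊗ E Y (4 + I) (4 + I))) (sym ι3)) (l (ι (160 * n)) (ι 3) (E Y (4 + I) (4 + I)))))))
    where
    l : ∀ a b c → a ⊗ (b ⊗ c) ≡ b ⊗ (a ⊗ c)
    l = solve-∀ ℚring

-- Small n

trial : List ℕ → ℕ → Bool
trial []           a = true
trial (zero ∷ ps)  a = false
trial (suc p ∷ ps) a = if (a % suc p ≡ᵇ 0) then false else trial ps a

trial-sound : ∀ ps a → trial ps a ≡ true → ∀ {p} → p ∈ ps → ¬ p ∣ a
trial-sound (suc q ∷ ps) a t m h with (a % suc q ≡ᵇ 0) in eq
trial-sound (suc q ∷ ps) a () m           h | true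
trial-sound (suc q ∷ ps) a t  (here refl) h | false with subst (λ x → (x ≡ᵇ 0) ≡ false) (∣P.n∣m⇒m%n≡0 a (suc q) h) eq
... | ()
trial-sound (suc q ∷ ps) a t  (there m)   h | false = trial-sound ps a t m h

-- The primes below 149, the least prime whose fifth power exceeds 2^36. The candidates are odd, so
-- 2 comes last.
trials : List ℕ
trials = 3 ∷ 5 ∷ 7 ∷ 11 ∷ 13 ∷ 17 ∷ 19 ∷ 23 ∷ 29 ∷ 31 ∷ 37 ∷ 41 ∷ 43 ∷ 47 ∷ 53 ∷ 59 ∷ 61 ∷ 67 ∷ 71 ∷ 73 ∷ 79 ∷ 83 ∷ 89 ∷ 97
  ∷ 101 ∷ 103 ∷ 107 ∷ 109 ∷ 113 ∷ 127 ∷ 131 ∷ 137 ∷ 139 ∷ 2 ∷ []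

covered? : ℕ → Bool
covered? p = if does (prime? p) then does (p ∈? trials) else true

all-covered : all-from covered? 149 0 ≡ true
all-covered = refl

implied : ∀ {P Q : Set} (p? : Dec P) (q? : Dec Q) → (if does p? then does q? else true) ≡ true → P → Q
implied (no ¬p) _       _  p = ⊥-elim (¬p p)
implied (yes _) (yes q) _  _ = q
implied (yes _) (no _)  () _

prime<149⇒∈ : ∀ p → Prime p → p < 149 → p ∈ trials
prime<149⇒∈ p pr lt = implied (prime? p) (p ∈? trials) (all-from-sound covered? 149 0 all-covered p z≤n lt) pr

product-≥ : ∀ b ps → All (b ≤_) ps → b ^ length ps ≤ product ps
product-≥ b []       []       = ℕP.≤-refl
product-≥ b (p ∷ ps) (h ∷ hs) = ℕP.*-mono-≤ h (product-≥ b ps hs)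

trial⇒Ω≤4 : ∀ a → .{{_ : NonZero a}} → a < 149 ^ 5 → trial trials a ≡ true → Ω≤4 a
trial⇒Ω≤4 a a< t = factored a bound
  where
  bound : ∀ ps → All Prime ps → product ps ≡ a → length ps ≤ 4
  bound ps prs refl = ℕP.≤-pred (ℕP.≰⇒> (λ 5≤ → ℕP.<-irrefl refl (ℕP.<-≤-trans a< (ℕP.≤-trans (ℕP.^-monoʳ-≤ 149 5≤) (product-≥ 149 ps (big ps prs (λ m → m)))))))
    where
    big : ∀ qs → All Prime qs → (∀ {q} → q ∈ qs → q ∈ ps) → All (149 ≤_) qs
    big []       []         sub = []
    big (q ∷ qs) (pr ∷ prs) sub = ℕP.≮⇒≥ (λ lt → trial-sound trials (product ps) t (prime<149⇒∈ q pr lt) (NLP.∈⇒∣product (sub (here refl)))) ∷ big qs prs (λ m → sub (there m))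

search : ℕ → ℕ → Bool
search zero    a = false
search (suc f) a = if trial trials a then true else search f (2 + a)

search-sound : ∀ f a → search f a ≡ true → Σ[ i ∈ ℕ ] i < f × trial trials (i * 2 + a) ≡ true
search-sound (suc f) a h with trial trials a in eq
... | true = 0 , s≤s z≤n , eq
... | false with search-sound f (2 + a) h
...   | i , lt , e = suc i , s≤s lt , subst (λ x → trial trials x ≡ true) (lem i a) e
  where
  lem : ∀ i a → i * 2 + (2 + a) ≡ suc i * 2 + a
  lem = ℕRing.solve-∀

-- the first odd number above n²
start : ℕ → ℕ
start n = suc (n * n + n % 2)

-- The interval contains exactly n odd numbers, hence the fuel n.
found? : ℕ → Bool
found? n = search n (start n)

found⇒ : ∀ n → n < 2 ^ 18 → found? n ≡ true → AlmostPrimeAbove n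
found⇒ n n< h with search-sound n (start n) h
... | i , i<n , t = a , lo , hi , trial⇒Ω≤4 a {{ℕ.>-nonZero (ℕP.≤-trans (s≤s z≤n) lo)}} (ℕP.<-≤-trans hi (ℕP.≤-trans (ℕP.*-mono-≤ n< n<) (ℕP.≤ᵇ⇒≤ (2 ^ 18 * 2 ^ 18) (149 ^ 5) tt))) t
  where
  a : ℕ
  a = i * 2 + start n
  lo : n * n < a
  lo = ℕP.≤-trans (s≤s (ℕP.m≤m+n (n * n) (n % 2))) (ℕP.m≤n+m (start n) (i * 2))
  l₁ : ∀ i n r → suc (i * 2 + suc (n * n + r)) ≡ suc i * 2 + n * n + r
  l₁ = ℕRing.solve-∀
  l₂ : ∀ n → n * 2 + n * n + 1 ≡ suc n * suc n
  l₂ = ℕRing.solve-∀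
  hi : a < suc n * suc n
  hi = ℕP.≤-trans (ℕP.≤-reflexive (l₁ i n (n % 2))) (ℕP.≤-trans (ℕP.+-mono-≤ (ℕP.+-monoˡ-≤ (n * n) (ℕP.*-monoˡ-≤ 2 i<n)) (ℕP.≤-pred (DM.m%n<n n 2))) (ℕP.≤-reflexive (l₂ n)))

searches : all-from found? 262132 12 ≡ true
searches = refl

prime-above : ∀ n p → {T (n * n ℕ.<ᵇ p)} → {T (p ℕ.<ᵇ suc n * suc n)} → {True (prime? p)} → AlmostPrimeAbove n
prime-above n p {lo} {hi} {pr} = p , ℕP.<ᵇ⇒< (n * n) p lo , ℕP.<ᵇ⇒< p (suc n * suc n) hi , 1 , (p ∷ [] , toWitness pr ∷ [] , ℕP.*-identityʳ p , refl) , s≤s z≤n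

-- Here (n + 1)² ≤ 144, so every candidate has a prime factor below 149 and the search cannot
-- succeed; a prime is named instead.
tiny : ∀ n → 1 ≤ n → n < 12 → AlmostPrimeAbove n
tiny 1  _ _ = prime-above 1 2
tiny 2  _ _ = prime-above 2 5
tiny 3  _ _ = prime-above 3 11
tiny 4  _ _ = prime-above 4 17
tiny 5  _ _ = prime-above 5 29
tiny 6  _ _ = prime-above 6 37
tiny 7  _ _ = prime-above 7 53
tiny 8  _ _ = prime-above 8 67
tiny 9  _ _ = prime-above 9 83
tiny 10 _ _ = prime-above 10 101
tiny 11 _ _ = prime-above 11 127
tiny (suc (suc (suc (suc (suc (suc (suc (suc (suc (suc (suc (suc n)))))))))))) _ lt = ⊥-elim (ℕP.<-irrefl refl (ℕP.<-≤-trans lt (ℕP.m≤m+n 12 n)))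

-- Choice of Y and the ranges of n

m≤8^m : ∀ m → m ≤ 8 ^ m
m≤8^m zero    = z≤n
m≤8^m (suc m) = ℕP.≤-trans (ℕP.+-mono-≤ (ℕ.>-nonZero⁻¹ (8 ^ m) {{ℕP.m^n≢0 8 m}}) (m≤8^m m)) (ℕP.≤-trans (ℕP.≤-reflexive (cong (8 ^ m +_) (sym (ℕP.+-identityʳ (8 ^ m))))) (ℕP.*-monoˡ-≤ (8 ^ m) (ℕP.≤ᵇ⇒≤ 2 8 tt)))

between-powers : ∀ m k j → 8 ^ j < m → m ≤ 8 ^ k → Σ[ Y ∈ ℕ ] j ≤ Y × 8 ^ Y < m × m ≤ 8 ^ suc Y
between-powers m zero    j lo hi = ⊥-elim (ℕP.<-irrefl refl (ℕP.<-≤-trans lo (ℕP.≤-trans hi (ℕP.^-monoʳ-≤ 8 {0} {j} z≤n))))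
between-powers m (suc k) j lo hi with m ℕP.≤? 8 ^ k
... | yes p = between-powers m k j lo p
... | no ¬p = k , ℕP.≮⇒≥ (λ k<j → ℕP.<-irrefl refl (ℕP.<-≤-trans lo (ℕP.≤-trans hi (ℕP.^-monoʳ-≤ 8 k<j)))) , ℕP.≰⇒> ¬p , hi

beyond : ∀ n → 2 ^ 18 ≤ n → AlmostPrimeAbove n
-- n ≥ 2^18 gives (n + 1)² > 2^36 = 8^12, so Y is at least 12, where the certificates start.
beyond n h = go (between-powers m m 12 (ℕP.*-mono-< (s≤s h) (s≤s h)) (m≤8^m m))
  where
  m : ℕ
  m = suc n * suc n
  8^ : ∀ Y → 8 ^ suc Y ≡ (2 ^ suc Y) ^ 3
  8^ Y = trans (ℕP.^-*-assoc 2 3 (suc Y)) (trans (cong (2 ^_) (ℕP.*-comm 3 (suc Y))) (sym (ℕP.^-*-assoc 2 (suc Y) 3)))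
  go : Σ[ Y ∈ ℕ ] 12 ≤ Y × 8 ^ Y < m × m ≤ 8 ^ suc Y → AlmostPrimeAbove n
  go (Y , 12≤Y , lo , hi) with 239 ℕP.≤? Y
  ... | yes p = large n Y p lo (subst (m ≤_) (8^ Y) hi)
  ... | no ¬p = medium n Y 12≤Y (ℕP.≰⇒> ¬p) lo (subst (m ≤_) (8^ Y) hi)

theorem1p2 : ∀ (n : ℕ) → 1 ≤ n →
    Σ ℕ λ a → n * n < a × a < suc n * suc n × Σ ℕ λ k → Ω a k × k ≤ 4
theorem1p2 n 1≤n with n ℕP.<? 12 | n ℕP.<? 2 ^ 18
... | yes p | _     = tiny n 1≤n p
... | no ¬p | yes q = found⇒ n q (all-from-sound found? 262132 12 searches n (ℕP.≮⇒≥ ¬p) q)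
... | no _  | no ¬q = beyond n (ℕP.≮⇒≥ ¬q)
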